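{- Let $n,m\ge 0$ and let $f_0,\dots,f_m\colon\{ -1,1\}^n\to\{ -1,1\}$ and $g_0,\dots,g_n\colon\{ -1,1\}^m\to\{ -1,1\}$ be arbitrary Boolean functions such that for all $z=(z_{ij})\in\{ -1,1\}^{[n]\times[m]}$, \[ f_0(g_1(z_{11},\dots,z_{1m}),\dots,g_n(z_{n1},\dots,z_{nm}))=g_0(f_1(z_{11},\dots,z_{n1}),\dots,f_m(z_{1m},\dots,z_{nm})). \] Let $J\subseteq[m]$ be the set of $j$ such that $f_j$ is non-constant, and let $G_0\colon\{ -1,1\}^J\to\{ -1,1\}$ be obtained from $g_0$ by fixing, for each $j\notin J$, the $j$-th input to the constant value of $f_j$. Similarly let $I\subseteq[n]$ be the set of $i$ such that $g_i$ is non-constant, and let $F_0\colon\{ -1,1\}^I\to\{ -1,1\}$ be obtained from $f_0$ by fixing, for each $i\notin I$, the $i$-th input to the constant value of $g_i$. Let $\tilde J=\mathrm{Dep}(G_0)$ and $\tilde G_0$ the restriction of $G_0$ to the coordinates in $\tilde J$; let $\tilde I=\mathrm{Dep}(F_0)$ and $\tilde F_0$ the restriction of $F_0$ to the coordinates in $\tilde I$. Then each $f_j$ ($j\in\tilde J$) depends only on coordinates in $\tilde I$, each $g_i$ ($i\in\tilde I$) depends only on coordinates in $\tilde J$, and, writing $n'=\tilde I$, $m'=\tilde J$ as index sets and regarding $f_j$ ($j\in\tilde J$) as functions on $\{ -1,1\}^{\tilde I}$ and $g_i$ ($i\in\tilde I$) as functions on $\{ -1,1\}^{\tilde J}$, the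 system $\tilde F_0,(f_j)_{j\in\tilde J},\tilde G_0,(g_i)_{i\in\tilde I}$ has the following form. There exist a set $Z_0\subseteq\tilde I\times\tilde J$ and a partition $Z_0=Z_1\sqcup\dots\sqcup Z_k$ whose parts are pairwise disjoint in rows and in columns, such that for every $(i,j)\in Z_\ell$ we have $\mathrm{Dep}(g_i)\subseteq\mathrm{cols}(Z_\ell)$ and $\mathrm{Dep}(f_j)\subseteq\mathrm{rows}(Z_\ell)$, and for all $i'\in\mathrm{rows}(Z_\ell)$, $j'\in\mathrm{cols}(Z_\ell)$ we have $j'\in\mathrm{Dep}(g_{i'})$ iff $i'\in\mathrm{Dep}(f_{j'})$; there exist a function $h\colon\{ -1,1\}^k\to\{ -1,1\}$ and, for each $\ell\in[k]$, functions $f_0^{(\ell)}$ of $x|_{\mathrm{rows}(Z_\ell)}$ and $g_0^{(\ell)}$ of $y|_{\mathrm{cols}(Z_\ell)}$, such that \[ \tilde F_0(x)=h(f_0^{(1)},\dots,f_0^{(k)}),\qquad \tilde G_0(y)=h(g_0^{(1)},\dots,g_0^{(k)}), \] and for every $\ell\in[k]$ one of the following holds: (1) $Z_\ell=\{(i,j)\}$ is a singleton and $f_j(x)=\mathrm{sgn}(f_j)x_i$, $g_i(y)=\mathrm{sgn}(g_i)y_j$, $f_0^{(\ell)}(x)=\mathrm{sgn}(f_j)x_i$, $g_0^{(\ell)}(y)=\mathrm{sgn}(g_i)y_j$; (2) for every $i\in\mathrm{rows}(Z_\ell)$ and $j\in\mathrm{cols}(Z_\ell)$, $f_j(x)=\phi_j(x|_{\mathrm{Dep}_{=1}(f_j)})\prod_{i'\in\mathrm{Dep}_{\ge2}(f_j)}x_{i'}$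 and $g_i(y)=\gamma_i(y|_{\mathrm{Dep}_{=1}(g_i)})\prod_{j'\in\mathrm{Dep}_{\ge2}(g_i)}y_{j'}$ for some functions $\phi_j,\gamma_i$ with values in $\{ -1,1\}$, and $f_0^{(\ell)}(x)=\prod_{i\in\mathrm{rows}_{\ge2}(Z_\ell)}x_i\prod_{j\in\mathrm{cols}_{\ge2}(Z_\ell)}\phi_j(x^{\mathrm{sgn}})$, $g_0^{(\ell)}(y)=\prod_{j\in\mathrm{cols}_{\ge2}(Z_\ell)}y_j\prod_{i\in\mathrm{rows}_{\ge2}(Z_\ell)}\gamma_i(y^{\mathrm{sgn}})$, both $\{ -1,1\}$-valued; (3) for every $i\in\mathrm{rows}_{=1}(Z_\ell)$ and $j\in\mathrm{cols}_{=1}(Z_\ell)$ the functions $f_j,g_i$ are dictators; there are $B_j,D_i\in\{ -1,1\}$ for $j\in\mathrm{cols}_{\ge2}(Z_\ell)$, $i\in\mathrm{rows}_{\ge2}(Z_\ell)$ and $\kappa_{ij}\in\{ -1,1\}$ for $(i,j)\in Z_\ell$ with $i\in\mathrm{rows}_{\ge2}(Z_\ell)$, $j\in\mathrm{cols}_{\ge2}(Z_\ell)$, and functions $\tilde\phi_j,\tilde\gamma_i$ with values in $\{0,1\}$, such that for $j\in\mathrm{cols}_{\ge2}(Z_\ell)$, $i\in\mathrm{rows}_{\ge2}(Z_\ell)$: $f_j(x)=\tilde\phi_j(x|_{\mathrm{Dep}_{=1}(f_j)})\cdot 2B_j\prod_{i'\in\mathrm{Dep}_{\ge2}(f_j)}\frac{\kappa_{i'j}x_{i'}+1}{2}-B_j$,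 $g_i(y)=\tilde\gamma_i(y|_{\mathrm{Dep}_{=1}(g_i)})\cdot 2D_i\prod_{j'\in\mathrm{Dep}_{\ge2}(g_i)}\frac{\kappa_{ij'}y_{j'}+1}{2}-D_i$, and $f_0^{(\ell)}(x)=2\prod_{i\in\mathrm{rows}_{\ge2}(Z_\ell)}\frac{D_ix_i+1}{2}\prod_{j\in\mathrm{cols}_{\ge2}(Z_\ell)}\tilde\phi_j(x^{\mathrm{sgn}})-1$, $g_0^{(\ell)}(y)=2\prod_{j\in\mathrm{cols}_{\ge2}(Z_\ell)}\frac{B_jy_j+1}{2}\prod_{i\in\mathrm{rows}_{\ge2}(Z_\ell)}\tilde\gamma_i(y^{\mathrm{sgn}})-1$, both $\{ -1,1\}$-valued. Finally, the functions $f_j$ for $j\in J\setminus\tilde J$ and $g_i$ for $i\in I\setminus\tilde I$ are completely arbitrary (unconstrained by the identity).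
   Context: Boolean values are encoded as $\pm1$. Every $f\colon\{ -1,1\}^n\to\mathbb R$ is identified with its unique multilinear (Fourier) expansion $f(x)=\sum_{S\subseteq[n]}\hat f(S)\prod_{i\in S}x_i$; $\deg f$ is the degree of this polynomial; $\mathrm{Dep}(f)$ is the set of coordinates on which $f$ depends. A dictator is a non-constant function depending on exactly one coordinate; a Boolean dictator has the form $s\,x_i$ with $s\in\{ -1,1\}$, and $\mathrm{sgn}$ of it is $s$. For $W\subseteq I\times J$, $\mathrm{rows}(W)$ and $\mathrm{cols}(W)$ are its projections to the first and second coordinate. For a block $Z_\ell$: $\mathrm{rows}_{=1}(Z_\ell)=\{i\in\mathrm{rows}(Z_\ell):\deg g_i=1\}$, $\mathrm{rows}_{\ge2}(Z_\ell)=\{i\in\mathrm{rows}(Z_\ell):\deg g_i\ge2\}$, and $\mathrm{cols}_{=1},\mathrm{cols}_{\ge2}$ analogously with $\deg f_j$. For $i$: $\mathrm{Dep}_{=1}(g_i)=\{j\in\mathrm{Dep}(g_i):\deg f_j=1\}$, $\mathrm{Dep}_{\ge2}(g_i)=\{j\in\mathrm{Dep}(g_i):\deg f_j\ge2\}$; for $j$: $\mathrm{Dep}_{=1}(f_j)=\{i\in\mathrm{Dep}(f_j):\deg g_i=1\}$, $\mathrm{Dep}_{\ge2}(f_j)=\{i\in\mathrm{Dep}(f_j):\deg g_i\ge2\}$. $x^{\mathrm{sgn}}$ is obtained from $x$ by replacing $x_i$ by $\mathrm{sgn}(g_i)x_i$ whenever $\deg g_i=1$ (other entries unchanged), and $y^{\mathrm{sgn}}$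 from $y$ by replacing $y_j$ by $\mathrm{sgn}(f_j)y_j$ whenever $\deg f_j=1$; $\phi_j(x^{\mathrm{sgn}})$ means $\phi_j$ applied to the coordinates of $x^{\mathrm{sgn}}$ indexed by $\mathrm{Dep}_{=1}(f_j)$, and similarly for $\gamma_i,\tilde\phi_j,\tilde\gamma_i$. -}

module Defs where

open import Data.Nat as ℕ using (ℕ; zero; suc; _⊔_; _≤ᵇ_; _≡ᵇ_)
open import Data.Fin using (Fin; zero; suc)
open import Data.Fin.Subset using (Subset; ∣_∣)
open import Data.Vec using (Vec; []; _∷_; lookup; tabulate; replicate; _[_]≔_)
open import Data.Sign.Base as Sign using (Sign; opposite)
open import Data.Sign.Properties as SignP using ()
open import Data.Bool using (Bool; true; false; if_then_else_; _∧_; _∨_; T)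
open import Data.List as L using (List; map; foldr; _++_)
open import Data.Product using (Σ; ∃; ∃₂; _×_; _,_; proj₁; proj₂)
open import Data.Sum using (_⊎_)
open import Relation.Nullary using (Dec; yes; no; ¬_; does; ¬?)
open import Relation.Binary.PropositionalEquality using (_≡_; _≢_; refl)
open import Data.Rational as ℚ using (ℚ; 0ℚ; 1ℚ; ½)

Pt : ℕ → Set
Pt n = Vec Sign n

BF : ℕ → Set
BF n = Pt n → Sign

toℚ : Sign → ℚ
toℚ Sign.+ = 1ℚ
toℚ Sign.- = ℚ.- 1ℚ

b01 : Bool → ℚ
b01 true = 1ℚ
b01 false = 0ℚ

twoℚ : ℚ
twoℚ = 1ℚ ℚ.+ 1ℚ

allPt? : ∀ n {P : Pt n → Set} → (∀ x → Dec (P x)) → Dec (∀ x → P x)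
allPt? zero P? with P? []
... | yes p = yes λ { [] → p }
... | no ¬p = no λ h → ¬p (h [])
allPt? (suc n) P? with allPt? n (λ t → P? (Sign.+ ∷ t)) | allPt? n (λ t → P? (Sign.- ∷ t))
... | yes a | yes b = yes λ { (Sign.+ ∷ t) → a t ; (Sign.- ∷ t) → b t }
... | no ¬a | _ = no λ h → ¬a (λ t → h (Sign.+ ∷ t))
... | yes _ | no ¬b = no λ h → ¬b (λ t → h (Sign.- ∷ t))

anyPt? : ∀ n {P : Pt n → Set} → (∀ x → Dec (P x)) → Dec (∃ P)
anyPt? zero P? with P? []
... | yes p = yes ([] , p)
... | no ¬p = no λ { ([] , p) → ¬p p }
anyPt? (suc n) P? with anyPt? n (λ t → P? (Sign.+ ∷ t)) | anyPt? n (λ t → P? (Sign.- ∷ t))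
... | yes (t , p) | _ = yes (Sign.+ ∷ t , p)
... | no _ | yes (t , p) = yes (Sign.- ∷ t , p)
... | no ¬a | no ¬b = no λ { (Sign.+ ∷ t , p) → ¬a (t , p) ; (Sign.- ∷ t , p) → ¬b (t , p) }

flipAt : ∀ {n} → Pt n → Fin n → Pt n
flipAt x i = x [ i ]≔ opposite (lookup x i)

Dep : ∀ {n} {A : Set} → (Pt n → A) → Fin n → Set
Dep f i = ∃ λ x → f x ≢ f (flipAt x i)

dep? : ∀ {n} (f : BF n) (i : Fin n) → Dec (Dep f i)
dep? {n} f i = anyPt? n (λ x → ¬? (f x SignP.≟ f (flipAt x i)))

depᵇ : ∀ {n} → BF n → Fin n → Bool
depᵇ f i = does (dep? f i)

IsConst : ∀ {n} → BF n → Set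
IsConst {n} f = ∀ x → f x ≡ f (replicate n Sign.+)

const? : ∀ {n} (f : BF n) → Dec (IsConst f)
const? {n} f = allPt? n (λ x → f x SignP.≟ f (replicate n Sign.+))

NonConst : ∀ {n} → BF n → Set
NonConst f = ¬ IsConst f

Dictator : ∀ {n} → BF n → Set
Dictator {n} f = Σ Sign λ s → Σ (Fin n) λ i → ∀ x → f x ≡ s Sign.* lookup x i

-- sgn of a dictator s·x_i is s = its value at (1,…,1)
sgnD : ∀ {n} → BF n → Sign
sgnD {n} f = f (replicate n Sign.+)

allPts : (n : ℕ) → List (Pt n)
allPts zero = L._∷_ [] L.[]
allPts (suc n) = map (Sign.+ ∷_) (allPts n) ++ map (Sign.- ∷_) (allPts n)

allSubsets : (n : ℕ) → List (Subset n)
allSubsets zero = L._∷_ [] L.[]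
allSubsets (suc n) = map (true ∷_) (allSubsets n) ++ map (false ∷_) (allSubsets n)

χ : ∀ {n} → Subset n → Pt n → Sign
χ [] [] = Sign.+
χ (b ∷ S) (s ∷ x) = (if b then s else Sign.+) Sign.* χ S x

sumℚ : List ℚ → ℚ
sumℚ = foldr ℚ._+_ 0ℚ

pow½ : ℕ → ℚ
pow½ zero = 1ℚ
pow½ (suc n) = ½ ℚ.* pow½ n

fourier : ∀ {n} → BF n → Subset n → ℚ
fourier {n} f S = sumℚ (map (λ x → toℚ (f x Sign.* χ S x)) (allPts n)) ℚ.* pow½ n

deg : ∀ {n} → BF n → ℕ
deg {n} f = foldr _⊔_ 0 (map (λ S → if does (fourier f S ℚ.≟ 0ℚ) then 0 else ∣ S ∣) (allSubsets n))

∏S : ∀ {n} → (Fin n → Bool) → (Fin n → Sign) → Sign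
∏S {zero} p v = Sign.+
∏S {suc n} p v = (if p zero then v zero else Sign.+) Sign.* ∏S (λ i → p (suc i)) (λ i → v (suc i))

∏Q : ∀ {n} → (Fin n → Bool) → (Fin n → ℚ) → ℚ
∏Q {zero} p v = 1ℚ
∏Q {suc n} p v = (if p zero then v zero else 1ℚ) ℚ.* ∏Q (λ i → p (suc i)) (λ i → v (suc i))

anyᵇ : ∀ {n} → (Fin n → Bool) → Bool
anyᵇ {zero} p = false
anyᵇ {suc n} p = p zero ∨ anyᵇ (λ i → p (suc i))

Identity : ∀ {n m} → BF n → (Fin m → BF n) → BF m → (Fin n → BF m) → Set
Identity {n} {m} f0 f g0 g =
  ∀ (z : Fin n → Fin m → Sign) →
    f0 (tabulate λ i → g i (tabulate λ j → z i j)) ≡ g0 (tabulate λ j → f j (tabulate λ i → z i j))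

module System {n m : ℕ} (f0 : BF n) (f : Fin m → BF n) (g0 : BF m) (g : Fin n → BF m) where

  I : Fin n → Set
  I i = NonConst (g i)

  J : Fin m → Set
  J j = NonConst (f j)

  -- F₀ : f₀ with input i fixed to the constant value of g_i when g_i is constant
  -- (as a function on {-1,1}^n that ignores coordinates outside I)
  F0 : BF n
  F0 x = f0 (tabulate λ i → if does (const? (g i)) then g i (replicate m Sign.+) else lookup x i)

  G0 : BF m
  G0 y = g0 (tabulate λ j → if does (const? (f j)) then f j (replicate n Sign.+) else lookup y j)

  -- Ĩ = Dep(F₀), J̃ = Dep(G₀);  F̃₀, G̃₀ are F₀, G₀ viewed on these coordinates
  Itil : Fin n → Set
  Itil i = Dep F0 i

  Jtil : Fin m → Set
  Jtil j = Dep G0 j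

  degG1 degG2 : Fin n → Bool
  degG1 i = deg (g i) ≡ᵇ 1
  degG2 i = 2 ≤ᵇ deg (g i)

  degF1 degF2 : Fin m → Bool
  degF1 j = deg (f j) ≡ᵇ 1
  degF2 j = 2 ≤ᵇ deg (f j)

  xsgn : Pt n → Pt n
  xsgn x = tabulate λ i → if degG1 i then sgnD (g i) Sign.* lookup x i else lookup x i

  ysgn : Pt m → Pt m
  ysgn y = tabulate λ j → if degF1 j then sgnD (f j) Sign.* lookup y j else lookup y j

  module Block (Z : Fin n → Fin m → Bool) where

    rowsᵇ : Fin n → Bool
    rowsᵇ i = anyᵇ (λ j → Z i j)

    colsᵇ : Fin m → Bool
    colsᵇ j = anyᵇ (λ i → Z i j)

    rows1 rows2 : Fin n → Bool
    rows1 i = rowsᵇ i ∧ degG1 i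
    rows2 i = rowsᵇ i ∧ degG2 i

    cols1 cols2 : Fin m → Bool
    cols1 j = colsᵇ j ∧ degF1 j
    cols2 j = colsᵇ j ∧ degF2 j

    depF2 : Fin m → Fin n → Bool
    depF2 j i = depᵇ (f j) i ∧ degG2 i

    depG2 : Fin n → Fin m → Bool
    depG2 i j = depᵇ (g i) j ∧ degF2 j

    -- φ is a function of x|Dep_{=1}(f_j)
    OnDepF1 : ∀ {A : Set} → Fin m → (Pt n → A) → Set
    OnDepF1 j φ = ∀ i → Dep φ i → Dep (f j) i × deg (g i) ≡ 1

    OnDepG1 : ∀ {A : Set} → Fin n → (Pt m → A) → Set
    OnDepG1 i γ = ∀ j → Dep γ j → Dep (g i) j × deg (f j) ≡ 1

    Case1 : BF n → BF m → Set
    Case1 f0ℓ g0ℓ =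
      Σ (Fin n) λ i → Σ (Fin m) λ j →
        (∀ i' j' → (T (Z i' j') → i' ≡ i × j' ≡ j) × (i' ≡ i × j' ≡ j → T (Z i' j'))) ×
        Σ Sign λ s → Σ Sign λ t →
          (∀ x → f j x ≡ s Sign.* lookup x i) ×
          (∀ y → g i y ≡ t Sign.* lookup y j) ×
          (∀ x → f0ℓ x ≡ s Sign.* lookup x i) ×
          (∀ y → g0ℓ y ≡ t Sign.* lookup y j)

    Case2 : BF n → BF m → Set
    Case2 f0ℓ g0ℓ =
      Σ (Fin m → BF n) λ φ → Σ (Fin n → BF m) λ γ →
        (∀ j → T (colsᵇ j) →
           OnDepF1 j (φ j) ×
           (∀ x → f j x ≡ φ j x Sign.* ∏S (depF2 j) (lookup x))) ×
        (∀ i → T (rowsᵇ i) →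
           OnDepG1 i (γ i) ×
           (∀ y → g i y ≡ γ i y Sign.* ∏S (depG2 i) (lookup y))) ×
        (∀ x → f0ℓ x ≡ ∏S rows2 (lookup x) Sign.* ∏S cols2 (λ j → φ j (xsgn x))) ×
        (∀ y → g0ℓ y ≡ ∏S cols2 (lookup y) Sign.* ∏S rows2 (λ i → γ i (ysgn y)))

    Case3 : BF n → BF m → Set
    Case3 f0ℓ g0ℓ =
      (∀ i → T (rows1 i) → Dictator (g i)) ×
      (∀ j → T (cols1 j) → Dictator (f j)) ×
      Σ (Fin m → Sign) λ B → Σ (Fin n → Sign) λ D → Σ (Fin n → Fin m → Sign) λ κ →
      Σ (Fin m → Pt n → Bool) λ φ~ → Σ (Fin n → Pt m → Bool) λ γ~ →
        (∀ j → T (cols2 j) →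
           OnDepF1 j (φ~ j) ×
           (∀ x → toℚ (f j x) ≡
                    b01 (φ~ j x) ℚ.* (twoℚ ℚ.* toℚ (B j) ℚ.*
                      ∏Q (depF2 j) (λ i' → (toℚ (κ i' j) ℚ.* toℚ (lookup x i') ℚ.+ 1ℚ) ℚ.* ½))
                    ℚ.- toℚ (B j))) ×
        (∀ i → T (rows2 i) →
           OnDepG1 i (γ~ i) ×
           (∀ y → toℚ (g i y) ≡
                    b01 (γ~ i y) ℚ.* (twoℚ ℚ.* toℚ (D i) ℚ.*
                      ∏Q (depG2 i) (λ j' → (toℚ (κ i j') ℚ.* toℚ (lookup y j') ℚ.+ 1ℚ) ℚ.* ½))
                    ℚ.- toℚ (D i))) ×
        (∀ x → toℚ (f0ℓ x) ≡
                 twoℚ ℚ.* ∏Q rows2 (λ i → (toℚ (D i) ℚ.* toℚ (lookup x i) ℚ.+ 1ℚ) ℚ.* ½)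
                      ℚ.* ∏Q cols2 (λ j → b01 (φ~ j (xsgn x)))
                 ℚ.- 1ℚ) ×
        (∀ y → toℚ (g0ℓ y) ≡
                 twoℚ ℚ.* ∏Q cols2 (λ j → (toℚ (B j) ℚ.* toℚ (lookup y j) ℚ.+ 1ℚ) ℚ.* ½)
                      ℚ.* ∏Q rows2 (λ i → b01 (γ~ i (ysgn y)))
                 ℚ.- 1ℚ)

    Cases : BF n → BF m → Set
    Cases f0ℓ g0ℓ = Case1 f0ℓ g0ℓ ⊎ Case2 f0ℓ g0ℓ ⊎ Case3 f0ℓ g0ℓ

{-# OPTIONS --safe #-}
module Submission where

open import Defs
open import Data.Nat using (ℕ; zero; suc; _≤_; _<_; z≤n; s≤s; _⊔_; _≤ᵇ_; _≡ᵇ_)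
import Data.Nat.Properties as ℕP
open import Data.Fin using (Fin; zero; suc; toℕ; fromℕ<)
import Data.Fin.Properties as FinP
open import Data.Fin.Subset using (Subset; ∣_∣; ⁅_⁆; ⊥)
open import Data.Fin.Subset.Properties using (∣⁅x⁆∣≡1; ∣⊥∣≡0)
open import Data.Vec using ([]; _∷_; tail; lookup; tabulate; replicate; _[_]≔_)
open import Data.Vec.Properties using (lookup∘update; lookup∘update′; lookup∘tabulate; tabulate∘lookup; tabulate-cong; lookup-replicate; ≡-dec)
open import Data.Sign.Base as Sign using (Sign; opposite) renaming (_*_ to _·_)
import Data.Sign.Properties as SignP
open import Data.Bool using (Bool; true; false; if_then_else_; _∧_; T)
open import Data.Bool.Properties as BoolP using (T?)
open import Data.List as List using (List; map; foldr; _++_)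
open import Data.List.Properties using (map-++; map-∘; map-cong)
open import Data.List.Membership.Propositional using (_∈_)
open import Data.List.Membership.Propositional.Properties using (∈-map⁺; ∈-map⁻; ∈-++⁺ˡ; ∈-++⁺ʳ; ∈-filter⁺; ∈-filter⁻; ∈-cartesianProduct⁺; ∈-allFin)
open import Data.List.Relation.Unary.Any using (here; there)
open import Data.Product using (Σ; ∃; ∃₂; _×_; _,_; proj₁; proj₂)
open import Data.Sum using (_⊎_; inj₁; inj₂)
open import Data.Empty using (⊥-elim)
open import Data.Unit using (tt)
open import Data.Rational as ℚ using (ℚ; 0ℚ; 1ℚ; ½)
import Data.Rational.Properties as ℚP
open import Data.Rational.Solver using (module +-*-Solver)
open import Relation.Nullary using (Dec; yes; no; ¬_; does; ¬?)
open import Relation.Nullary.Decidable using (_×-dec_; decidable-stable)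
open import Relation.Binary.PropositionalEquality using (_≡_; _≢_; refl; sym; trans; cong; cong₂; subst; module ≡-Reasoning)
open import Function using (_∘_; case_of_)
open import Algebra.Properties.CommutativeSemigroup (SignP.*-commutativeSemigroup) using (interchange; x∙yz≈y∙xz)

-- Put H(z) = F₀(g₁(z₁), …) = G₀(f₁(z¹), …) and join a row i ∈ Ĩ to a column j ∈ J̃ when H
-- depends on z_ij; this happens iff j ∈ Dep(g_i), and iff i ∈ Dep(f_j).  The blocks are the
-- connected components of this bipartite graph, and its leaves are the functions of degree 1.
--
-- Take an edge between two vertices of degree ≥ 2.  If g_i takes a value e regardless of y_j
-- (the other inputs being suitably fixed), then x_i = e makes F₀ ignore every other row that
-- meets column j.  Comparing a few values of H then shows that either both g_i and f_j are odd
-- in z_ij, or there is a κ such that z_ij = −κ already determines g_i and f_j.  The same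
-- alternative holds at all edges of the component between vertices of degree ≥ 2, which gives
-- case (2) or case (3); a component whose edge joins two leaves gives case (1).
--
-- Inside a block, F₀ depends on x only through f₀^(ℓ), because two matrices z with the same
-- column values f_j have the same H: such moves connect all points with equal f₀^(ℓ).

-- A leaf says nothing about which of the two alternatives holds: a dictator is odd at its only
-- edge, and flipping its row may or may not change `F`. Properties are therefore passed through a
-- component as statements about the columns that a row meets; a leaf meets only one column and
-- hands them on unchanged. For the same reason a block of case (3) may be off because of its leaves
-- alone, while all rows of degree at least 2 have their value `D i`; such a point is traded for one
-- with the same `F` at which one of these rows is off. The factors of cases (2) and (3) come from
-- restriction: `f j` with its neighbours of degree at least 2 fixed to + in case (2), and to the
-- entries κ in case (3). What is left depends on leaves only, and x^sgn recovers the matrix entry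
-- behind the value of a leaf. The function `h` is read off `F` alone. It serves `G` as well
-- because, for every matrix, the row values and the column values give a block function of `F` and
-- its partner for `G` the same value.

private variable
  n m : ℕ

-- Signs, points and dependence

≢⇒≡opposite : ∀ {s t} → s ≢ t → s ≡ opposite t
≢⇒≡opposite {Sign.-} {Sign.-} ne = ⊥-elim (ne refl)
≢⇒≡opposite {Sign.-} {Sign.+} ne = refl
≢⇒≡opposite {Sign.+} {Sign.-} ne = refl
≢⇒≡opposite {Sign.+} {Sign.+} ne = ⊥-elim (ne refl)

≢-≢⇒≡ : ∀ {s t u : Sign} → s ≢ u → t ≢ u → s ≡ t
≢-≢⇒≡ p q = trans (≢⇒≡opposite p) (sym (≢⇒≡opposite q))

opp≢ : ∀ s → opposite s ≢ s
opp≢ s e = SignP.s≢opposite[s] s (sym e)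

opposite-*ˡ : ∀ s t → opposite s · t ≡ opposite (s · t)
opposite-*ˡ Sign.- t = sym (SignP.opposite-involutive t)
opposite-*ˡ Sign.+ t = refl

opposite-*ʳ : ∀ s t → s · opposite t ≡ opposite (s · t)
opposite-*ʳ Sign.- t = refl
opposite-*ʳ Sign.+ t = refl

lookup-flip : (x : Pt n) (i : Fin n) → lookup (flipAt x i) i ≡ opposite (lookup x i)
lookup-flip x i = lookup∘update i x _

lookup-flip′ : (x : Pt n) {i k : Fin n} → k ≢ i → lookup (flipAt x i) k ≡ lookup x k
lookup-flip′ x ne = lookup∘update′ ne x _

lookup-ext : {u v : Pt n} → (∀ i → lookup u i ≡ lookup v i) → u ≡ v
lookup-ext {u = u} {v} h = trans (sym (tabulate∘lookup u)) (trans (tabulate-cong h) (tabulate∘lookup v))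

flip-flip : (x : Pt n) (i : Fin n) → flipAt (flipAt x i) i ≡ x
flip-flip x i = lookup-ext λ k → lem k
  where
  lem : ∀ k → lookup (flipAt (flipAt x i) i) k ≡ lookup x k
  lem k with k FinP.≟ i
  ... | yes refl = trans (lookup-flip (flipAt x i) i) (trans (cong opposite (lookup-flip x i)) (SignP.opposite-involutive _))
  ... | no ne = trans (lookup-flip′ (flipAt x i) ne) (lookup-flip′ x ne)

-- The coordinates are changed one at a time, and a flip that alters a restriction `f (b ∷ _)` also
-- alters `f`. Applied to composites of `F`, this turns invariance under single flips into
-- invariance under any change of a set of coordinates.
agree-on-Dep : (f : BF n) {u v : Pt n} → (∀ i → Dep f i → lookup u i ≡ lookup v i) → f u ≡ f v
agree-on-Dep f {[]} {[]} h = refl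
agree-on-Dep f {a ∷ u} {b ∷ v} h =
  trans head (agree-on-Dep (λ t → f (b ∷ t)) (λ i d → h (suc i) (b ∷ proj₁ d , proj₂ d)))
  where
  head : f (a ∷ u) ≡ f (b ∷ u)
  head with a SignP.≟ b
  ... | yes refl = refl
  ... | no a≢b with f (b ∷ u) SignP.≟ f (opposite b ∷ u)
  ...   | yes e = trans (cong (λ s → f (s ∷ u)) (≢⇒≡opposite a≢b)) (sym e)
  ...   | no ne = ⊥-elim (a≢b (h zero (b ∷ u , ne)))

surjective : (f : BF n) → NonConst f → ∀ s → ∃ λ x → f x ≡ s
surjective {n} f nc s with anyPt? n (λ x → f x SignP.≟ s)
... | yes p = p
... | no np = ⊥-elim (nc λ x → ≢-≢⇒≡ (λ e → np (x , e)) (λ e → np (_ , e)))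

dependsOnSome : (f : BF n) → NonConst f → ∃ (Dep f)
dependsOnSome f nc with FinP.any? (dep? f)
... | yes p = p
... | no np = ⊥-elim (nc λ x → agree-on-Dep f λ i d → ⊥-elim (np (i , d)))

-- The end with value `s` of an edge of the cube in direction `i` along which `f` changes. It allows
-- a row to be given either value by altering a single entry.
along : (f : BF n) {i : Fin n} → Dep f i → Sign → Pt n
along f {i} (x , _) s with f x SignP.≟ s
... | yes _ = x
... | no _ = flipAt x i

along-value : (f : BF n) {i : Fin n} (d : Dep f i) (s : Sign) → f (along f d s) ≡ s
along-value f {i} (x , ne) s with f x SignP.≟ s
... | yes e = e
... | no ne' = ≢-≢⇒≡ (λ e → ne (sym e)) (λ e → ne' (sym e))

along-off : (f : BF n) {i : Fin n} (d : Dep f i) (s : Sign) {k : Fin n} → k ≢ i →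
            lookup (along f d s) k ≡ lookup (proj₁ d) k
along-off f {i} (x , ne) s k≢i with f x SignP.≟ s
... | yes e = refl
... | no ne' = lookup-flip′ x k≢i

dictator-Dep : {f : BF n} {s : Sign} {i : Fin n} → (∀ x → f x ≡ s · lookup x i) → ∀ k → Dep f k → k ≡ i
dictator-Dep {s = s} {i} h k (x , ne) with k FinP.≟ i
... | yes e = e
... | no k≢i = ⊥-elim (ne (trans (h x) (trans (cong (s ·_) (sym (lookup-flip′ x (k≢i ∘ sym)))) (sym (h _)))))

dictator-sgn : {f : BF n} {s : Sign} {i : Fin n} → (∀ x → f x ≡ s · lookup x i) → s ≡ sgnD f
dictator-sgn {n} {s = s} {i} h =
  sym (trans (h (replicate n Sign.+)) (trans (cong (s ·_) (lookup-replicate i Sign.+)) (SignP.*-identityʳ s)))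

one-Dep⇒dictator : {f : BF n} {i : Fin n} → NonConst f → (∀ k → Dep f k → k ≡ i) →
                   ∀ x → f x ≡ sgnD f · lookup x i
one-Dep⇒dictator {n} {f} {i} nc only x = go (lookup x i) refl
  where
  1s = replicate n Sign.+
  same : ∀ {u v} → lookup u i ≡ lookup v i → f u ≡ f v
  same {u} {v} e = agree-on-Dep f λ k d → subst (λ k → lookup u k ≡ lookup v k) (sym (only k d)) e
  go : ∀ t → lookup x i ≡ t → f x ≡ sgnD f · t
  go Sign.+ e = trans (same (trans e (sym (lookup-replicate i _)))) (sym (SignP.*-identityʳ _))
  go Sign.- e with f x SignP.≟ sgnD f
  ... | no ne = trans (≢⇒≡opposite ne) (trans (cong opposite (sym (SignP.*-identityʳ (sgnD f)))) (sym (opposite-*ʳ (sgnD f) Sign.+)))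
  ... | yes fx≡ = ⊥-elim (nc isC)
    where
    isC : IsConst f
    isC y with lookup y i SignP.≟ Sign.+
    ... | yes p = same (trans p (sym (lookup-replicate i _)))
    ... | no np = trans (same (trans (≢⇒≡opposite np) (sym e))) fx≡

-- Degree of a Boolean function

sumℚ-++ : ∀ xs ys → sumℚ (xs ++ ys) ≡ sumℚ xs ℚ.+ sumℚ ys
sumℚ-++ List.[] ys = sym (ℚP.+-identityˡ _)
sumℚ-++ (x List.∷ xs) ys = trans (cong (x ℚ.+_) (sumℚ-++ xs ys)) (sym (ℚP.+-assoc x _ _))

sumℚ-neg : {A : Set} (h : A → ℚ) (xs : List A) → sumℚ (map (λ x → ℚ.- h x) xs) ≡ ℚ.- sumℚ (map h xs)
sumℚ-neg h List.[] = refl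
sumℚ-neg h (x List.∷ xs) = trans (cong (ℚ.- h x ℚ.+_) (sumℚ-neg h xs)) (sym (ℚP.neg-distrib-+ (h x) _))

toℚ-opposite : ∀ s → toℚ (opposite s) ≡ ℚ.- toℚ s
toℚ-opposite Sign.- = refl
toℚ-opposite Sign.+ = refl

fourier-cong : {f f' : BF n} → (∀ x → f x ≡ f' x) → ∀ S → fourier f S ≡ fourier f' S
fourier-cong {n} h S =
  cong (λ xs → sumℚ xs ℚ.* pow½ n) (map-cong (λ x → cong (λ s → toℚ (s · χ S x)) (h x)) (allPts n))

sum-cons : (h : Pt (suc n) → ℚ) → sumℚ (map h (allPts (suc n))) ≡
           sumℚ (map (λ x → h (Sign.+ ∷ x)) (allPts n)) ℚ.+ sumℚ (map (λ x → h (Sign.- ∷ x)) (allPts n))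
sum-cons {n} h = begin
  sumℚ (map h (map (Sign.+ ∷_) (allPts n) ++ map (Sign.- ∷_) (allPts n)))
    ≡⟨ cong sumℚ (map-++ h (map (Sign.+ ∷_) (allPts n)) _) ⟩
  sumℚ (map h (map (Sign.+ ∷_) (allPts n)) ++ map h (map (Sign.- ∷_) (allPts n)))
    ≡⟨ sumℚ-++ (map h (map (Sign.+ ∷_) (allPts n))) _ ⟩
  sumℚ (map h (map (Sign.+ ∷_) (allPts n))) ℚ.+ sumℚ (map h (map (Sign.- ∷_) (allPts n)))
    ≡⟨ cong₂ (λ a b → sumℚ a ℚ.+ sumℚ b) (map-∘ (allPts n)) (map-∘ (allPts n)) ⟨
  _ ∎
  where open ≡-Reasoning

half-distrib-+ : ∀ a b p → (a ℚ.+ b) ℚ.* (½ ℚ.* p) ≡ ½ ℚ.* (a ℚ.* p ℚ.+ b ℚ.* p)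
half-distrib-+ = solve 3 (λ a b p → (a :+ b) :* (con ½ :* p) := con ½ :* (a :* p :+ b :* p)) refl
  where open +-*-Solver

half-distrib-- : ∀ a b p → (a ℚ.+ (ℚ.- b)) ℚ.* (½ ℚ.* p) ≡ ½ ℚ.* (a ℚ.* p ℚ.- b ℚ.* p)
half-distrib-- = solve 3 (λ a b p → (a :+ (:- b)) :* (con ½ :* p) := con ½ :* (a :* p :- b :* p)) refl
  where open +-*-Solver

half-sum-diff : ∀ a b → ½ ℚ.* (a ℚ.+ b) ℚ.+ ½ ℚ.* (a ℚ.- b) ≡ a
half-sum-diff = solve 2 (λ a b → con ½ :* (a :+ b) :+ con ½ :* (a :- b) := a) refl
  where open +-*-Solver

half-diff-diff : ∀ a b → ½ ℚ.* (a ℚ.+ b) ℚ.- ½ ℚ.* (a ℚ.- b) ≡ b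
half-diff-diff = solve 2 (λ a b → con ½ :* (a :+ b) :- con ½ :* (a :- b) := b) refl
  where open +-*-Solver

fourier-out : (f : BF (suc n)) (S : Subset n) →
              fourier f (false ∷ S) ≡ ½ ℚ.* (fourier (f ∘ (Sign.+ ∷_)) S ℚ.+ fourier (f ∘ (Sign.- ∷_)) S)
fourier-out {n} f S = trans (cong (ℚ._* pow½ (suc n)) (sum-cons (λ x → toℚ (f x · χ (false ∷ S) x))))
  (half-distrib-+ (sumℚ (map (λ x → toℚ (f (Sign.+ ∷ x) · χ S x)) (allPts n)))
                  (sumℚ (map (λ x → toℚ (f (Sign.- ∷ x) · χ S x)) (allPts n))) (pow½ n))

fourier-in : (f : BF (suc n)) (S : Subset n) →
             fourier f (true ∷ S) ≡ ½ ℚ.* (fourier (f ∘ (Sign.+ ∷_)) S ℚ.- fourier (f ∘ (Sign.- ∷_)) S)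
fourier-in {n} f S = trans (cong (ℚ._* pow½ (suc n)) (sum-cons (λ x → toℚ (f x · χ (true ∷ S) x))))
  (trans (cong (λ b → (A ℚ.+ b) ℚ.* pow½ (suc n)) neg)
    (half-distrib-- A B (pow½ n)))
  where
  A = sumℚ (map (λ x → toℚ (f (Sign.+ ∷ x) · χ S x)) (allPts n))
  B = sumℚ (map (λ x → toℚ (f (Sign.- ∷ x) · χ S x)) (allPts n))
  neg : sumℚ (map (λ x → toℚ (f (Sign.- ∷ x) · χ (true ∷ S) (Sign.- ∷ x))) (allPts n)) ≡ ℚ.- B
  neg = trans (cong sumℚ (map-cong (λ x → trans (cong toℚ (opposite-*ʳ (f (Sign.- ∷ x)) (χ S x))) (toℚ-opposite (f (Sign.- ∷ x) · χ S x))) (allPts n)))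
              (sumℚ-neg (λ x → toℚ (f (Sign.- ∷ x) · χ S x)) (allPts n))

half-double : ∀ a → ½ ℚ.* (a ℚ.+ a) ≡ a
half-double = solve 1 (λ a → con ½ :* (a :+ a) := a) refl
  where open +-*-Solver

half-zero : ∀ a → ½ ℚ.* (a ℚ.- a) ≡ 0ℚ
half-zero = solve 1 (λ a → con ½ :* (a :- a) := con 0ℚ) refl
  where open +-*-Solver

-- An opaque copy of the Fourier coefficient, which keeps unification from unfolding the sums.
abstract
  coeff : BF n → Subset n → ℚ
  coeff = fourier

  coeff≡fourier : (f : BF n) (S : Subset n) → coeff f S ≡ fourier f S
  coeff≡fourier f S = refl

  coeff-cong : {f f' : BF n} → (∀ x → f x ≡ f' x) → ∀ S → coeff f S ≡ coeff f' S
  coeff-cong = fourier-cong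

  coeff-[] : (f : BF 0) → coeff f [] ≡ toℚ (f [])
  coeff-[] f = lem (f [])
    where
    lem : ∀ s → (toℚ (s · Sign.+) ℚ.+ 0ℚ) ℚ.* 1ℚ ≡ toℚ s
    lem Sign.- = refl
    lem Sign.+ = refl

  coeff-out : (f : BF (suc n)) (S : Subset n) →
              coeff f (false ∷ S) ≡ ½ ℚ.* (coeff (f ∘ (Sign.+ ∷_)) S ℚ.+ coeff (f ∘ (Sign.- ∷_)) S)
  coeff-out = fourier-out

  coeff-in : (f : BF (suc n)) (S : Subset n) →
             coeff f (true ∷ S) ≡ ½ ℚ.* (coeff (f ∘ (Sign.+ ∷_)) S ℚ.- coeff (f ∘ (Sign.- ∷_)) S)
  coeff-in = fourier-in

-- `coeff-out` and `coeff-in` solved for the two halves. In this form the vanishing of the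
-- coefficients of size at least 2 passes from `f` to its restrictions.
coeff-plus : (f : BF (suc n)) (S : Subset n) →
             coeff (f ∘ (Sign.+ ∷_)) S ≡ coeff f (false ∷ S) ℚ.+ coeff f (true ∷ S)
coeff-plus f S = sym (trans (cong₂ ℚ._+_ (coeff-out f S) (coeff-in f S))
  (half-sum-diff (coeff (f ∘ (Sign.+ ∷_)) S) (coeff (f ∘ (Sign.- ∷_)) S)))

coeff-minus : (f : BF (suc n)) (S : Subset n) →
              coeff (f ∘ (Sign.- ∷_)) S ≡ coeff f (false ∷ S) ℚ.- coeff f (true ∷ S)
coeff-minus f S = sym (trans (cong₂ ℚ._-_ (coeff-out f S) (coeff-in f S))
  (half-diff-diff (coeff (f ∘ (Sign.+ ∷_)) S) (coeff (f ∘ (Sign.- ∷_)) S)))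

coeff-out-same : (f : BF (suc n)) (e : BF n) → (∀ s x → f (s ∷ x) ≡ e x) → ∀ S → coeff f (false ∷ S) ≡ coeff e S
coeff-out-same f e h S = trans (coeff-out f S)
  (trans (cong₂ (λ a b → ½ ℚ.* (a ℚ.+ b)) (coeff-cong (h Sign.+) S) (coeff-cong (h Sign.-) S)) (half-double (coeff e S)))

coeff-in-same : (f : BF (suc n)) (e : BF n) → (∀ s x → f (s ∷ x) ≡ e x) → ∀ S → coeff f (true ∷ S) ≡ 0ℚ
coeff-in-same f e h S = trans (coeff-in f S)
  (trans (cong₂ (λ a b → ½ ℚ.* (a ℚ.- b)) (coeff-cong (h Sign.+) S) (coeff-cong (h Sign.-) S)) (half-zero (coeff e S)))

coeff-const-⊥ : ∀ n s → coeff {n} (λ _ → s) ⊥ ≡ toℚ s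
coeff-const-⊥ zero s = coeff-[] (λ _ → s)
coeff-const-⊥ (suc n) s = trans (coeff-out-same (λ _ → s) (λ _ → s) (λ _ _ → refl) ⊥) (coeff-const-⊥ n s)

coeff-const-0 : ∀ s (S : Subset n) → S ≢ ⊥ → coeff (λ _ → s) S ≡ 0ℚ
coeff-const-0 s [] ne = ⊥-elim (ne refl)
coeff-const-0 s (true ∷ S) ne = coeff-in-same (λ _ → s) (λ _ → s) (λ _ _ → refl) S
coeff-const-0 s (false ∷ S) ne = trans (coeff-out-same (λ _ → s) (λ _ → s) (λ _ _ → refl) S)
  (coeff-const-0 s S (λ e → ne (cong (false ∷_) e)))

coeff-dictator-1 : (s : Sign) (i : Fin n) → coeff (λ x → s · lookup x i) ⁅ i ⁆ ≡ toℚ s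
coeff-dictator-1 {suc n} s zero = begin
  coeff (λ x → s · lookup x zero) (true ∷ ⊥)
    ≡⟨ coeff-in (λ x → s · lookup x zero) ⊥ ⟩
  ½ ℚ.* (coeff {n} (λ _ → s · Sign.+) ⊥ ℚ.- coeff {n} (λ _ → s · Sign.-) ⊥)
    ≡⟨ cong₂ (λ a b → ½ ℚ.* (a ℚ.- b)) (coeff-const-⊥ n (s · Sign.+)) (coeff-const-⊥ n (s · Sign.-)) ⟩
  ½ ℚ.* (toℚ (s · Sign.+) ℚ.- toℚ (s · Sign.-))
    ≡⟨ lem s ⟩
  toℚ s ∎
  where
  open ≡-Reasoning
  lem : ∀ s → ½ ℚ.* (toℚ (s · Sign.+) ℚ.- toℚ (s · Sign.-)) ≡ toℚ s
  lem Sign.- = refl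
  lem Sign.+ = refl
coeff-dictator-1 {suc n} s (suc i) =
  trans (coeff-out-same (λ x → s · lookup x (suc i)) (λ x → s · lookup x i) (λ _ _ → refl) ⁅ i ⁆) (coeff-dictator-1 s i)

coeff-dictator-0 : (s : Sign) (i : Fin n) (S : Subset n) → S ≢ ⁅ i ⁆ → coeff (λ x → s · lookup x i) S ≡ 0ℚ
coeff-dictator-0 {suc n} s zero (true ∷ S) ne = trans (coeff-in (λ x → s · lookup x zero) S)
  (cong₂ (λ a b → ½ ℚ.* (a ℚ.- b)) (coeff-const-0 (s · Sign.+) S S≢⊥) (coeff-const-0 (s · Sign.-) S S≢⊥))
  where
  S≢⊥ : S ≢ ⊥
  S≢⊥ e = ne (cong (true ∷_) e)
coeff-dictator-0 {suc n} s zero (false ∷ S) ne = trans (coeff-out (λ x → s · lookup x zero) S) (sum0 S)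
  where
  sum0 : ∀ {n} (S : Subset n) → ½ ℚ.* (coeff (λ _ → s · Sign.+) S ℚ.+ coeff (λ _ → s · Sign.-) S) ≡ 0ℚ
  sum0 {n} S with ≡-dec BoolP._≟_ S ⊥
  ... | no S≢⊥ = cong₂ (λ a b → ½ ℚ.* (a ℚ.+ b)) (coeff-const-0 (s · Sign.+) S S≢⊥) (coeff-const-0 (s · Sign.-) S S≢⊥)
  ... | yes refl = trans (cong₂ (λ a b → ½ ℚ.* (a ℚ.+ b)) (coeff-const-⊥ n (s · Sign.+)) (coeff-const-⊥ n (s · Sign.-))) (lem s)
    where
    lem : ∀ s → ½ ℚ.* (toℚ (s · Sign.+) ℚ.+ toℚ (s · Sign.-)) ≡ 0ℚ
    lem Sign.- = refl
    lem Sign.+ = refl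
coeff-dictator-0 {suc n} s (suc i) (true ∷ S) ne = coeff-in-same (λ x → s · lookup x (suc i)) (λ x → s · lookup x i) (λ _ _ → refl) S
coeff-dictator-0 {suc n} s (suc i) (false ∷ S) ne =
  trans (coeff-out-same (λ x → s · lookup x (suc i)) (λ x → s · lookup x i) (λ _ _ → refl) S)
    (coeff-dictator-0 s i S (λ e → ne (cong (false ∷_) e)))

LowDegree : BF n → Set
LowDegree {n} f = ∀ (S : Subset n) → 2 ≤ ∣ S ∣ → coeff f S ≡ 0ℚ

∈-allSubsets : (S : Subset n) → S ∈ allSubsets n
∈-allSubsets [] = here refl
∈-allSubsets {suc n} (true ∷ S) = ∈-++⁺ˡ (∈-map⁺ (true ∷_) (∈-allSubsets S))
∈-allSubsets {suc n} (false ∷ S) = ∈-++⁺ʳ (map (true ∷_) (allSubsets n)) (∈-map⁺ (false ∷_) (∈-allSubsets S))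

max-≥ : ∀ {x xs} → x ∈ xs → x ≤ foldr _⊔_ 0 xs
max-≥ (here refl) = ℕP.m≤m⊔n _ _
max-≥ (there p) = ℕP.≤-trans (max-≥ p) (ℕP.m≤n⊔m _ _)

max-≤ : ∀ {b} xs → (∀ x → x ∈ xs → x ≤ b) → foldr _⊔_ 0 xs ≤ b
max-≤ List.[] h = z≤n
max-≤ (x List.∷ xs) h = ℕP.⊔-lub (h x (here refl)) (max-≤ xs (λ y p → h y (there p)))

support-≤-deg : (f : BF n) (S : Subset n) → fourier f S ≢ 0ℚ → ∣ S ∣ ≤ deg f
support-≤-deg {n} f S ne = subst (_≤ deg f) val (max-≥ (∈-map⁺ _ (∈-allSubsets S)))
  where
  val : (if does (fourier f S ℚ.≟ 0ℚ) then 0 else ∣ S ∣) ≡ ∣ S ∣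
  val with fourier f S ℚ.≟ 0ℚ
  ... | yes e = ⊥-elim (ne e)
  ... | no _ = refl

deg-≤ : (f : BF n) (b : ℕ) → (∀ S → fourier f S ≢ 0ℚ → ∣ S ∣ ≤ b) → deg f ≤ b
deg-≤ {n} f b h = max-≤ _ bound
  where
  bound : ∀ x → x ∈ map (λ S → if does (fourier f S ℚ.≟ 0ℚ) then 0 else ∣ S ∣) (allSubsets n) → x ≤ b
  bound x p with ∈-map⁻ _ p
  ... | S , _ , refl with fourier f S ℚ.≟ 0ℚ
  ...   | yes _ = z≤n
  ...   | no ne = h S ne

toℚ≢0 : ∀ {s} → toℚ s ≢ 0ℚ
toℚ≢0 {Sign.-} ()
toℚ≢0 {Sign.+} ()

dictator⇒deg≡1 : {f : BF n} {s : Sign} {i : Fin n} → (∀ x → f x ≡ s · lookup x i) → deg f ≡ 1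
dictator⇒deg≡1 {f = f} {s} {i} h = ℕP.≤-antisym (deg-≤ f 1 up) (subst (_≤ deg f) (∣⁅x⁆∣≡1 i) (support-≤-deg f ⁅ i ⁆ low))
  where
  low : fourier f ⁅ i ⁆ ≢ 0ℚ
  low e = toℚ≢0 {s} (trans (sym (coeff-dictator-1 s i)) (trans (sym (coeff-cong h ⁅ i ⁆)) (trans (coeff≡fourier f ⁅ i ⁆) e)))
  up : ∀ S → fourier f S ≢ 0ℚ → ∣ S ∣ ≤ 1
  up S ne with ≡-dec BoolP._≟_ S ⁅ i ⁆
  ... | yes refl = ℕP.≤-reflexive (∣⁅x⁆∣≡1 i)
  ... | no S≢ = ⊥-elim (ne (trans (sym (coeff≡fourier f S)) (trans (coeff-cong h S) (coeff-dictator-0 s i S S≢))))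

toℚ-injective : ∀ {s t} → toℚ s ≡ toℚ t → s ≡ t
toℚ-injective {Sign.-} {Sign.-} e = refl
toℚ-injective {Sign.-} {Sign.+} ()
toℚ-injective {Sign.+} {Sign.-} ()
toℚ-injective {Sign.+} {Sign.+} e = refl

⁅⁆≢⊥ : (i : Fin n) → ⁅ i ⁆ ≢ ⊥
⁅⁆≢⊥ {n} i e with trans (sym (∣⁅x⁆∣≡1 i)) (trans (cong ∣_∣ e) (∣⊥∣≡0 n))
... | ()

⁅⁆-injective : {i k : Fin n} → ⁅ i ⁆ ≡ ⁅ k ⁆ → i ≡ k
⁅⁆-injective {i = zero} {zero} e = refl
⁅⁆-injective {i = zero} {suc k} ()
⁅⁆-injective {i = suc i} {zero} ()
⁅⁆-injective {i = suc i} {suc k} e = cong suc (⁅⁆-injective (cong tail e))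

-- Induction on the first coordinate. The coefficient of `f` at the pair formed by coordinate 0 and
-- coordinate `suc i` vanishes, so the two halves have the same coefficient at `⁅ i ⁆` (`eq1`).
-- Hence they are the same dictator or both constant; two different constants make `f` a dictator in
-- coordinate 0.
lowDegree⇒ : (f : BF n) → LowDegree f → (∃ λ s → ∀ x → f x ≡ s) ⊎ Dictator f
lowDegree⇒ {zero} f low = inj₁ (f [] , λ { [] → refl })
lowDegree⇒ {suc n} f low = combine (lowDegree⇒ f₊ low₊) (lowDegree⇒ f₋ low₋)
  where
  f₊ f₋ : BF n
  f₊ = f ∘ (Sign.+ ∷_)
  f₋ = f ∘ (Sign.- ∷_)
  low₊ : LowDegree f₊
  low₊ S le = trans (coeff-plus f S)
    (cong₂ ℚ._+_ (low (false ∷ S) le) (low (true ∷ S) (ℕP.m≤n⇒m≤1+n le)))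
  low₋ : LowDegree f₋
  low₋ S le = trans (coeff-minus f S)
    (cong₂ ℚ._-_ (low (false ∷ S) le) (low (true ∷ S) (ℕP.m≤n⇒m≤1+n le)))
  eq1 : ∀ i → coeff f₊ ⁅ i ⁆ ≡ coeff f₋ ⁅ i ⁆
  eq1 i = trans (coeff-plus f ⁅ i ⁆) (trans (add-0 (coeff f (false ∷ ⁅ i ⁆)) z) (sym (coeff-minus f ⁅ i ⁆)))
    where
    z : coeff f (true ∷ ⁅ i ⁆) ≡ 0ℚ
    z = low (true ∷ ⁅ i ⁆) (s≤s (ℕP.≤-reflexive (sym (∣⁅x⁆∣≡1 i))))
    add-0 : ∀ a {b} → b ≡ 0ℚ → a ℚ.+ b ≡ a ℚ.- b
    add-0 a refl = refl
  coeff₊ : ∀ s i → (∀ x → f₊ x ≡ s · lookup x i) → coeff f₊ ⁅ i ⁆ ≡ toℚ s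
  coeff₊ s i p = trans (coeff-cong p ⁅ i ⁆) (coeff-dictator-1 s i)
  coeff₋ : ∀ s i → (∀ x → f₋ x ≡ s · lookup x i) → coeff f₋ ⁅ i ⁆ ≡ toℚ s
  coeff₋ s i p = trans (coeff-cong p ⁅ i ⁆) (coeff-dictator-1 s i)
  combine : (∃ λ s → ∀ x → f₊ x ≡ s) ⊎ Dictator f₊ → (∃ λ s → ∀ x → f₋ x ≡ s) ⊎ Dictator f₋ →
            (∃ λ s → ∀ x → f x ≡ s) ⊎ Dictator f
  combine (inj₁ (s , p)) (inj₁ (t , q)) with s SignP.≟ t
  ... | yes refl = inj₁ (s , λ { (Sign.+ ∷ x) → p x ; (Sign.- ∷ x) → q x })
  ... | no ne = inj₂ (s , zero , λ { (Sign.+ ∷ x) → trans (p x) (sym (SignP.*-identityʳ s))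
                                  ; (Sign.- ∷ x) → trans (q x) (trans (≢⇒≡opposite (ne ∘ sym))
                                      (trans (cong opposite (sym (SignP.*-identityʳ s))) (sym (opposite-*ʳ s Sign.+)))) })
  combine (inj₂ (s , i , p)) (inj₁ (t , q)) = ⊥-elim (toℚ≢0 {s} (trans (sym (coeff₊ s i p))
    (trans (eq1 i) (trans (coeff-cong q ⁅ i ⁆) (coeff-const-0 t ⁅ i ⁆ (⁅⁆≢⊥ i))))))
  combine (inj₁ (t , q)) (inj₂ (s , i , p)) = ⊥-elim (toℚ≢0 {s} (trans (sym (coeff₋ s i p))
    (trans (sym (eq1 i)) (trans (coeff-cong q ⁅ i ⁆) (coeff-const-0 t ⁅ i ⁆ (⁅⁆≢⊥ i))))))
  combine (inj₂ (s , i , p)) (inj₂ (t , k , q)) with i FinP.≟ k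
  ... | no ne = ⊥-elim (toℚ≢0 {s} (trans (sym (coeff₊ s i p))
    (trans (eq1 i) (trans (coeff-cong q ⁅ i ⁆) (coeff-dictator-0 t k ⁅ i ⁆ (λ e → ne (⁅⁆-injective e)))))))
  ... | yes refl = inj₂ (s , suc i , λ { (Sign.+ ∷ x) → p x ; (Sign.- ∷ x) → trans (q x) (cong (_· lookup x i) (sym s≡t)) })
    where
    s≡t : s ≡ t
    s≡t = toℚ-injective {s} {t} (trans (sym (coeff₊ s i p)) (trans (eq1 i) (coeff₋ t i q)))

deg≤1⇒dictator : (f : BF n) → NonConst f → deg f ≤ 1 → Dictator f
deg≤1⇒dictator f nc le with lowDegree⇒ f low
  where
  low : LowDegree f
  low S 2≤ with fourier f S ℚ.≟ 0ℚ
  ... | yes e = trans (coeff≡fourier f S) e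
  ... | no ne = ⊥-elim (ℕP.<-irrefl refl (ℕP.≤-trans 2≤ (ℕP.≤-trans (support-≤-deg f S ne) le)))
... | inj₁ (s , h) = ⊥-elim (nc λ x → trans (h x) (sym (h _)))
... | inj₂ d = d

-- A non-constant function of the single coordinate `i` would be a dictator, of degree 1.
another-Dep : (f : BF n) → NonConst f → 2 ≤ deg f → ∀ i → ∃ λ k → k ≢ i × Dep f k
another-Dep f nc 2≤ i with FinP.any? (λ k → ¬? (k FinP.≟ i) ×-dec dep? f k)
... | yes p = p
... | no np = ⊥-elim (ℕP.<-irrefl (sym (dictator⇒deg≡1 {s = sgnD f} {i} (one-Dep⇒dictator nc only))) 2≤)
  where
  only : ∀ k → Dep f k → k ≡ i
  only k d = decidable-stable (k FinP.≟ i) λ ne → np (k , ne , d)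

-- Finite products

anyᵇ⁺ : (p : Fin n → Bool) (i : Fin n) → T (p i) → T (anyᵇ p)
anyᵇ⁺ p zero t with p zero
... | true = tt
anyᵇ⁺ p (suc i) t with p zero
... | true = tt
... | false = anyᵇ⁺ (p ∘ suc) i t

anyᵇ⁻ : (p : Fin n → Bool) → T (anyᵇ p) → ∃ λ i → T (p i)
anyᵇ⁻ {suc n} p t with p zero in eq
... | true = zero , subst T (sym eq) tt
... | false with anyᵇ⁻ (p ∘ suc) t
...   | i , u = suc i , u

fill : (Fin n → Bool) → (Fin n → Sign) → Pt n → Pt n
fill p s x = tabulate λ i → if p i then s i else lookup x i

lookup-fill : (p : Fin n → Bool) (s : Fin n → Sign) (x : Pt n) (i : Fin n) → T (p i) → lookup (fill p s x) i ≡ s i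
lookup-fill p s x i t = trans (lookup∘tabulate _ i) (lem (p i) t)
  where
  lem : ∀ b → T b → (if b then s i else lookup x i) ≡ s i
  lem true _ = refl

lookup-fill′ : (p : Fin n → Bool) (s : Fin n → Sign) (x : Pt n) (i : Fin n) → ¬ T (p i) → lookup (fill p s x) i ≡ lookup x i
lookup-fill′ p s x i nt = trans (lookup∘tabulate _ i) (lem (p i) nt)
  where
  lem : ∀ b → ¬ T b → (if b then s i else lookup x i) ≡ lookup x i
  lem true nt = ⊥-elim (nt tt)
  lem false _ = refl

∏ : (Fin n → Sign) → Sign
∏ v = ∏S (λ _ → true) v

when : Bool → Sign → Sign
when b s = if b then s else Sign.+

∏-cong : {v w : Fin n → Sign} → (∀ i → v i ≡ w i) → ∏ v ≡ ∏ w
∏-cong {zero} h = refl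
∏-cong {suc n} h = cong₂ _·_ (h zero) (∏-cong (h ∘ suc))

-- Factors outside the mask become +, so products over subsets turn into products over all of
-- `Fin n`, which can be regrouped and interchanged freely.
∏S≡∏ : (p : Fin n → Bool) (v : Fin n → Sign) → ∏S p v ≡ ∏ (λ i → when (p i) (v i))
∏S≡∏ {zero} p v = refl
∏S≡∏ {suc n} p v = cong (when (p zero) (v zero) ·_) (∏S≡∏ (p ∘ suc) (v ∘ suc))

∏-· : (v w : Fin n → Sign) → ∏ (λ i → v i · w i) ≡ ∏ v · ∏ w
∏-· {zero} v w = refl
∏-· {suc n} v w = trans (cong (v zero · w zero ·_) (∏-· (v ∘ suc) (w ∘ suc))) (interchange (v zero) (w zero) _ _)

∏-1 : ∏ {n} (λ _ → Sign.+) ≡ Sign.+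
∏-1 {zero} = refl
∏-1 {suc n} = ∏-1 {n}

∏-swap : (v : Fin n → Fin m → Sign) → ∏ (λ i → ∏ (v i)) ≡ ∏ (λ j → ∏ (λ i → v i j))
∏-swap {zero} {m} v = sym (∏-1 {m})
∏-swap {suc n} {m} v = trans (cong (∏ (v zero) ·_) (∏-swap (v ∘ suc))) (sym (∏-· (v zero) (λ j → ∏ (λ i → v (suc i) j))))

when-cong : ∀ b {s t} → (T b → s ≡ t) → when b s ≡ when b t
when-cong true h = h tt
when-cong false h = refl

when-∏ : ∀ b (v : Fin n → Sign) → when b (∏ v) ≡ ∏ (λ i → when b (v i))
when-∏ true v = refl
when-∏ {n} false v = sym (∏-1 {n})

when-when : ∀ a b s → when a (when b s) ≡ when (a ∧ b) s
when-when true b s = refl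
when-when false b s = refl

∏S-cong : (p : Fin n → Bool) {v w : Fin n → Sign} → (∀ i → T (p i) → v i ≡ w i) → ∏S p v ≡ ∏S p w
∏S-cong p {v} {w} h = trans (∏S≡∏ p v) (trans (∏-cong λ i → when-cong (p i) (h i)) (sym (∏S≡∏ p w)))

∏S-· : (p : Fin n → Bool) (v w : Fin n → Sign) → ∏S p (λ i → v i · w i) ≡ ∏S p v · ∏S p w
∏S-· p v w = trans (∏S≡∏ p _) (trans (∏-cong λ i → lem (p i)) (trans (∏-· (λ i → when (p i) (v i)) _) (sym (cong₂ _·_ (∏S≡∏ p v) (∏S≡∏ p w)))))
  where
  lem : ∀ b {s t} → when b (s · t) ≡ when b s · when b t
  lem true = refl
  lem false = refl

∏S-∏S : (p : Fin n → Bool) (q : Fin n → Fin m → Bool) (v : Fin n → Fin m → Sign) →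
        ∏S p (λ i → ∏S (q i) (v i)) ≡ ∏ (λ i → ∏ (λ j → when (p i ∧ q i j) (v i j)))
∏S-∏S p q v = trans (∏S≡∏ p _) (∏-cong λ i →
  trans (cong (when (p i)) (∏S≡∏ (q i) (v i)))
    (trans (when-∏ (p i) (λ j → when (q i j) (v i j))) (∏-cong λ j → when-when (p i) (q i j) (v i j))))

∏S-swap : (p : Fin n → Bool) (q : Fin n → Fin m → Bool) (p' : Fin m → Bool) (q' : Fin m → Fin n → Bool)
          (v : Fin n → Fin m → Sign) → (∀ i j → p i ∧ q i j ≡ p' j ∧ q' j i) →
          ∏S p (λ i → ∏S (q i) (v i)) ≡ ∏S p' (λ j → ∏S (q' j) (λ i → v i j))
∏S-swap p q p' q' v h = trans (∏S-∏S p q v) (trans (∏-cong λ i → ∏-cong λ j → cong (λ b → when b (v i j)) (h i j))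
  (trans (∏-swap (λ i j → when (p' j ∧ q' j i) (v i j))) (sym (∏S-∏S p' q' (λ j i → v i j)))))

-- A sign is its own inverse, so `v i · w i` is the quotient of the two factors at `i`.
∏S-change : (p : Fin n → Bool) (v w : Fin n → Sign) (i : Fin n) → T (p i) →
            (∀ k → k ≢ i → T (p k) → v k ≡ w k) → ∏S p v ≡ v i · w i · ∏S p w
∏S-change p v w zero t h with p zero
... | true = trans (cong (v zero ·_) (∏S-cong (p ∘ suc) λ k → h (suc k) λ ())) (lem (v zero) (w zero) _)
  where
  lem : ∀ a b c → a · c ≡ a · b · (b · c)
  lem a Sign.- c = sym (trans (cong (_· opposite c) (SignP.*-comm a Sign.-)) (trans (opposite-*ˡ a (opposite c)) (trans (sym (opposite-*ʳ a (opposite c))) (cong (a ·_) (SignP.opposite-involutive c)))))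
  lem a Sign.+ c = cong (_· c) (sym (SignP.*-identityʳ a))
∏S-change p v w (suc i) t h =
  trans (cong₂ _·_ (when-cong (p zero) (h zero λ ())) (∏S-change (p ∘ suc) (v ∘ suc) (w ∘ suc) i t λ k ne → h (suc k) λ { refl → ne refl }))
    (x∙yz≈y∙xz (when (p zero) (w zero)) (v (suc i) · w (suc i)) _)

∏S-∅ : (p : Fin n → Bool) (v : Fin n → Sign) → (∀ i → ¬ T (p i)) → ∏S p v ≡ Sign.+
∏S-∅ {n} p v h = trans (∏S≡∏ p v) (trans (∏-cong λ i → lem (p i) (h i)) (∏-1 {n}))
  where
  lem : ∀ b {s} → ¬ T b → when b s ≡ Sign.+
  lem true nt = ⊥-elim (nt tt)
  lem false _ = refl

-- Functions odd in a coordinate, that is, divisible by it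

LinearAt : BF n → Fin n → Set
LinearAt f i = ∀ x → f (flipAt x i) ≡ opposite (f x)

linearAt? : (f : BF n) (i : Fin n) → Dec (LinearAt f i)
linearAt? {n} f i = allPt? n λ x → f (flipAt x i) SignP.≟ opposite (f x)

¬LinearAt⇒ : (f : BF n) (i : Fin n) → ¬ LinearAt f i → ∃ λ x → f (flipAt x i) ≡ f x
¬LinearAt⇒ {n} f i nl with anyPt? n (λ x → f (flipAt x i) SignP.≟ f x)
... | yes p = p
... | no np = ⊥-elim (nl λ x → ≢⇒≡opposite (λ e → np (x , e)))

-- One of `a` and `flipAt a i` has its `i`-th entry equal to `opposite κ`, and `f` agrees on the
-- two.
off-insensitive : (f : BF n) {i : Fin n} {κ v : Sign} → (∀ x → lookup x i ≡ opposite κ → f x ≡ v) →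
                  ∀ a → f (flipAt a i) ≡ f a → f a ≡ v
off-insensitive f {i} {κ} off a ins with lookup a i SignP.≟ opposite κ
... | yes eq = off a eq
... | no ne = trans (sym ins) (off (flipAt a i) (trans (lookup-flip a i) (cong opposite (trans (≢⇒≡opposite ne) (SignP.opposite-involutive κ)))))

-- Each odd coordinate can be pulled out as a factor, leaving `f` with that coordinate set to +.
-- This restriction becomes the factor φ or γ of case (2).
linear-factor : (f : BF n) (p : Fin n → Bool) → (∀ i → T (p i) → LinearAt f i) →
                ∀ x → f x ≡ f (fill p (λ _ → Sign.+) x) · ∏S p (lookup x)
linear-factor {zero} f p lin [] = sym (SignP.*-identityʳ _)
linear-factor {suc n} f p lin (s ∷ x) = trans (linear-factor (f ∘ (s ∷_)) (p ∘ suc) (λ i t y → lin (suc i) t (s ∷ y)) x)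
  (trans (cong (_· P) (head (p zero) (lin zero) s)) (SignP.*-assoc (f ((if p zero then Sign.+ else s) ∷ y)) (when (p zero) s) P))
  where
  P = ∏S (p ∘ suc) (lookup x)
  y = fill (p ∘ suc) (λ _ → Sign.+) x
  head : ∀ b → (T b → LinearAt f zero) → ∀ s → f (s ∷ y) ≡ f ((if b then Sign.+ else s) ∷ y) · when b s
  head true l Sign.- = trans (l tt (Sign.+ ∷ y)) (SignP.*-comm Sign.- _)
  head true l Sign.+ = sym (SignP.*-identityʳ _)
  head false l s = sym (SignP.*-identityʳ _)

-- Conjunctions and their 0/1 products

allᵇ : (Fin n → Bool) → (Fin n → Bool) → Bool
allᵇ {zero} p w = true
allᵇ {suc n} p w = (if p zero then w zero else true) ∧ allᵇ (p ∘ suc) (w ∘ suc)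

allᵇ⁺ : (p w : Fin n → Bool) → (∀ i → T (p i) → T (w i)) → T (allᵇ p w)
allᵇ⁺ {zero} p w h = tt
allᵇ⁺ {suc n} p w h with p zero | h zero
... | false | _ = allᵇ⁺ (p ∘ suc) (w ∘ suc) (h ∘ suc)
... | true | h0 with w zero | h0 tt
...   | true | _ = allᵇ⁺ (p ∘ suc) (w ∘ suc) (h ∘ suc)

allᵇ⁻ : (p w : Fin n → Bool) → T (allᵇ p w) → ∀ i → T (p i) → T (w i)
allᵇ⁻ {suc n} p w t zero u with p zero | w zero
... | true | true = tt
allᵇ⁻ {suc n} p w t (suc i) u with p zero | w zero
... | true | true = allᵇ⁻ (p ∘ suc) (w ∘ suc) t i u
... | false | _ = allᵇ⁻ (p ∘ suc) (w ∘ suc) t i u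

b01-∧ : ∀ a b → b01 a ℚ.* b01 b ≡ b01 (a ∧ b)
b01-∧ true true = refl
b01-∧ true false = refl
b01-∧ false true = refl
b01-∧ false false = refl

∏Q≡b01 : (p : Fin n → Bool) (v : Fin n → ℚ) (w : Fin n → Bool) → (∀ i → v i ≡ b01 (w i)) → ∏Q p v ≡ b01 (allᵇ p w)
∏Q≡b01 {zero} p v w h = refl
∏Q≡b01 {suc n} p v w h = trans (cong₂ ℚ._*_ (head (p zero)) (∏Q≡b01 (p ∘ suc) (v ∘ suc) (w ∘ suc) (h ∘ suc)))
  (b01-∧ (if p zero then w zero else true) (allᵇ (p ∘ suc) (w ∘ suc)))
  where
  head : ∀ b → (if b then v zero else 1ℚ) ≡ b01 (if b then w zero else true)
  head true = h zero
  head false = refl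

_==_ : Sign → Sign → Bool
s == t = does (s SignP.≟ t)

==⇒≡ : ∀ s t → T (s == t) → s ≡ t
==⇒≡ s t h with s SignP.≟ t
... | yes e = e

≡⇒== : ∀ s t → s ≡ t → T (s == t)
≡⇒== s t e with s SignP.≟ t
... | yes _ = tt
... | no ne = ne e

half-match : ∀ s t → (toℚ s ℚ.* toℚ t ℚ.+ 1ℚ) ℚ.* ½ ≡ b01 (s == t)
half-match Sign.- Sign.- = refl
half-match Sign.- Sign.+ = refl
half-match Sign.+ Sign.- = refl
half-match Sign.+ Sign.+ = refl

-- The sign form of 2sb - s for a 0/1 value b. Threshold blocks are treated in this form and
-- translated into `ℚ` only when case (3) is stated.
choose : Bool → Sign → Sign
choose b s = if b then s else opposite s

toℚ-choose : ∀ a b s → toℚ (choose (a ∧ b) s) ≡ b01 a ℚ.* (twoℚ ℚ.* toℚ s ℚ.* b01 b) ℚ.- toℚ s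
toℚ-choose true true Sign.- = refl
toℚ-choose true true Sign.+ = refl
toℚ-choose true false Sign.- = refl
toℚ-choose true false Sign.+ = refl
toℚ-choose false true Sign.- = refl
toℚ-choose false true Sign.+ = refl
toℚ-choose false false Sign.- = refl
toℚ-choose false false Sign.+ = refl

toℚ-choose-+ : ∀ a b → toℚ (choose (a ∧ b) Sign.+) ≡ twoℚ ℚ.* b01 a ℚ.* b01 b ℚ.- 1ℚ
toℚ-choose-+ true true = refl
toℚ-choose-+ true false = refl
toℚ-choose-+ false true = refl
toℚ-choose-+ false false = refl

-- Connected components

-- Each listed pair (a , b) merges the class of b into that of a.
label : List (Fin n × Fin n) → Fin n → Fin n
label List.[] i = i
label ((a , b) List.∷ ps) i with label ps i FinP.≟ label ps b
... | yes _ = label ps a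
... | no _ = label ps i

label-cong : ∀ a b (ps : List (Fin n × Fin n)) i k → label ps i ≡ label ps k → label ((a , b) List.∷ ps) i ≡ label ((a , b) List.∷ ps) k
label-cong a b ps i k e with label ps i FinP.≟ label ps b | label ps k FinP.≟ label ps b
... | yes _ | yes _ = refl
... | yes p | no q = ⊥-elim (q (trans (sym e) p))
... | no p | yes q = ⊥-elim (p (trans e q))
... | no _ | no _ = e

label-complete : (ps : List (Fin n × Fin n)) {a b : Fin n} → (a , b) ∈ ps → label ps a ≡ label ps b
label-complete ((a , b) List.∷ ps) (here refl) with label ps a FinP.≟ label ps b | label ps b FinP.≟ label ps b
... | yes _ | yes _ = refl
... | no _ | yes _ = refl
... | _ | no ne = ⊥-elim (ne refl)
label-complete ((a , b) List.∷ ps) {c} {d} (there p) = label-cong a b ps c d (label-complete ps p)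

-- Equal labels arise only from merges along listed pairs. A merge may be crossed from either end,
-- which is why `P` must be preserved in both directions.
label-sound : (ps : List (Fin n × Fin n)) (P : Fin n → Set) →
              (∀ a b → (a , b) ∈ ps → (P a → P b) × (P b → P a)) →
              ∀ i k → label ps i ≡ label ps k → P i → P k
label-sound List.[] P cl i k refl pi = pi
label-sound ((a , b) List.∷ ps) P cl i k e pi with label ps i FinP.≟ label ps b | label ps k FinP.≟ label ps b
... | yes p | yes q = label-sound ps P (λ c d → cl c d ∘ there) i k (trans p (sym q)) pi
-- Here `i` is carried over from the class of `b`, so `P` travels from `i` to `b`, across the pair
-- to `a`, and on to `k`.
... | yes p | no q = label-sound ps P (λ c d → cl c d ∘ there) a k e
                       (proj₂ (cl a b (here refl)) (label-sound ps P (λ c d → cl c d ∘ there) i b p pi))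
... | no p | yes q = label-sound ps P (λ c d → cl c d ∘ there) b k (sym q)
                       (proj₁ (cl a b (here refl)) (label-sound ps P (λ c d → cl c d ∘ there) i a e pi))
... | no p | no q = label-sound ps P (λ c d → cl c d ∘ there) i k e pi

-- `sound` expresses connectedness as an induction principle: a predicate preserved by `R` spreads
-- over a whole class, without any reference to paths.
record Components {n : ℕ} (R : Fin n → Fin n → Set) : Set₁ where
  field
    class : Fin n → Fin n
    complete : ∀ {a b} → R a b → class a ≡ class b
    sound : (P : Fin n → Set) → (∀ a b → R a b → P a → P b) → ∀ i k → class i ≡ class k → P i → P k

components : {R : Fin n → Fin n → Set} → (∀ a b → Dec (R a b)) → (∀ {a b} → R a b → R b a) → Components R
components {n} {R} R? R-sym = record
  { class = label ps
  ; complete = λ {a} {b} r → label-complete ps (∈-filter⁺ R?′ (∈-cartesianProduct⁺ (∈-allFin a) (∈-allFin b)) r)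
  ; sound = λ P cl → label-sound ps P λ a b p → let r = proj₂ (∈-filter⁻ R?′ {xs = all} p) in cl a b r , cl b a (R-sym r)
  }
  where
  R?′ : (p : Fin n × Fin n) → Dec (R (proj₁ p) (proj₂ p))
  R?′ (a , b) = R? a b
  all = List.cartesianProduct (List.allFin n) (List.allFin n)
  ps = List.filter R?′ all

record Enumeration {n : ℕ} (P : Fin n → Set) : Set where
  field
    size : ℕ
    elem : Fin size → Fin n
    elem-injective : ∀ a b → elem a ≡ elem b → a ≡ b
    elem-∈ : ∀ a → P (elem a)
    elem-onto : ∀ i → P i → ∃ λ a → elem a ≡ i

enumerate : {P : Fin n → Set} → (∀ i → Dec (P i)) → Enumeration P
enumerate {zero} P? = record { size = 0 ; elem = λ () ; elem-injective = λ () ; elem-∈ = λ () ; elem-onto = λ () }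
enumerate {suc n} {P} P? with P? zero | enumerate (P? ∘ suc)
... | no np | E = record
  { size = E.size ; elem = suc ∘ E.elem
  ; elem-injective = λ a b e → E.elem-injective a b (FinP.suc-injective e)
  ; elem-∈ = E.elem-∈
  ; elem-onto = λ { zero p → ⊥-elim (np p) ; (suc i) p → proj₁ (E.elem-onto i p) , cong suc (proj₂ (E.elem-onto i p)) } }
  where module E = Enumeration E
... | yes p0 | E = record
  { size = suc E.size ; elem = λ { zero → zero ; (suc a) → suc (E.elem a) }
  ; elem-injective = λ { zero zero e → refl ; zero (suc b) () ; (suc a) zero ()
                       ; (suc a) (suc b) e → cong suc (E.elem-injective a b (FinP.suc-injective e)) }
  ; elem-∈ = λ { zero → p0 ; (suc a) → E.elem-∈ a }
  ; elem-onto = λ { zero p → zero , refl ; (suc i) p → suc (proj₁ (E.elem-onto i p)) , cong suc (proj₂ (E.elem-onto i p)) } }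
  where module E = Enumeration E

-- The edges of a system

sensitive : (f : BF n) {i : Fin n} → Dep f i → ∀ s → ∃ λ a → f a ≡ s × f (flipAt a i) ≡ opposite s
sensitive f {i} (x , ne) s with f x SignP.≟ s
... | yes e = x , e , trans (≢⇒≡opposite (ne ∘ sym)) (cong opposite e)
... | no ne' = flipAt x i , ≢-≢⇒≡ (ne ∘ sym) (ne' ∘ sym) , trans (cong f (flip-flip x i)) (≢⇒≡opposite ne')

Matrix : ℕ → ℕ → Set
Matrix n m = Fin n → Pt m

column : Matrix n m → Fin m → Pt n
column z j = tabulate λ i → lookup (z i) j

lookup-column : (z : Matrix n m) (j : Fin m) (i : Fin n) → lookup (column z j) i ≡ lookup (z i) j
lookup-column z j i = lookup∘tabulate _ i

column-column : (z : Matrix n m) (i : Fin n) → column (column z) i ≡ z i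
column-column z i = lookup-ext λ j → trans (lookup-column (column z) i j) (lookup-column z j i)

apply : (Fin n → BF m) → Matrix n m → Pt n
apply g z = tabulate λ i → g i (z i)

lookup-apply : (g : Fin n → BF m) (z : Matrix n m) (i : Fin n) → lookup (apply g z) i ≡ g i (z i)
lookup-apply g z i = lookup∘tabulate _ i

put : Fin n → Pt m → Matrix n m → Matrix n m
put i a z k with k FinP.≟ i
... | yes _ = a
... | no _ = z k

put-same : (i : Fin n) (a : Pt m) (z : Matrix n m) → put i a z i ≡ a
put-same i a z with i FinP.≟ i
... | yes _ = refl
... | no ne = ⊥-elim (ne refl)

put-other : (i : Fin n) (a : Pt m) (z : Matrix n m) {k : Fin n} → k ≢ i → put i a z k ≡ z k
put-other i a z {k} ne with k FinP.≟ i
... | yes e = ⊥-elim (ne e)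
... | no _ = refl

-- The hypotheses are symmetric under exchanging rows and columns (`swap`), so what is proved about
-- rows is available for columns. `F` and `G` stay functions of all coordinates; the relevant ones
-- are expressed through `Dep`.
record Sys {n m : ℕ} (F : BF n) (f : Fin m → BF n) (G : BF m) (g : Fin n → BF m) : Set where
  field
    identity : ∀ z → F (apply g z) ≡ G (apply f (column z))
    nonconst-g : ∀ i → Dep F i → NonConst (g i)
    nonconst-f : ∀ j → Dep G j → NonConst (f j)

swap : {F : BF n} {f : Fin m → BF n} {G : BF m} {g : Fin n → BF m} → Sys F f G g → Sys G g F f
swap {F = F} {f} {G} {g} S = record
  { identity = λ z → trans (cong G (tabulate-cong λ j → cong (f j) (sym (column-column z j)))) (sym (identity (column z)))
  ; nonconst-g = nonconst-f
  ; nonconst-f = nonconst-g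
  }
  where open Sys S

-- All four dependences are kept, which makes the notion symmetric; `edge-g` and `edge-f` recover
-- them from two.
record Edge (F : BF n) (f : Fin m → BF n) (G : BF m) (g : Fin n → BF m) (i : Fin n) (j : Fin m) : Set where
  constructor edge
  field
    row-dep : Dep F i
    col-dep : Dep G j
    g-dep : Dep (g i) j
    f-dep : Dep (f j) i

flipEdge : {F : BF n} {f : Fin m → BF n} {G : BF m} {g : Fin n → BF m} {i : Fin n} {j : Fin m} →
           Edge F f G g i j → Edge G g F f j i
flipEdge (edge a b c d) = edge b a d c

module Moves {n m : ℕ} {F : BF n} {f : Fin m → BF n} {G : BF m} {g : Fin n → BF m} (S : Sys F f G g) where

  open Sys S

  E : Fin n → Fin m → Set
  E = Edge F f G g

  H : Matrix n m → Sign
  H z = F (apply g z)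

  -- Only the rows that `F` reads are prescribed: another `g i` may be constant and unable to take
  -- the value of `x` at `i`.
  record Realises (z : Matrix n m) (x : Pt n) : Set where
    constructor realises
    field value : ∀ i → Dep F i → g i (z i) ≡ lookup x i
  open Realises

  H≡F : ∀ {z x} → Realises z x → H z ≡ F x
  H≡F {z} r = agree-on-Dep F λ i d → trans (lookup-apply g z i) (value r i d)

  H-cong : ∀ {z z'} → (∀ j → Dep G j → f j (column z j) ≡ f j (column z' j)) → H z ≡ H z'
  H-cong {z} {z'} h = trans (identity z) (trans (agree-on-Dep G λ j d →
    trans (lookup-apply f (column z) j) (trans (h j d) (sym (lookup-apply f (column z') j)))) (sym (identity z')))

  column-agree : ∀ {z z'} j → (∀ i → Dep (f j) i → lookup (z i) j ≡ lookup (z' i) j) →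
                 f j (column z j) ≡ f j (column z' j)
  column-agree {z} {z'} j h = agree-on-Dep (f j) λ i d →
    trans (lookup-column z j i) (trans (h i d) (sym (lookup-column z' j i)))

  move : ∀ {x x'} z z' → Realises z x → Realises z' x' →
         (∀ j → Dep G j → f j (column z j) ≡ f j (column z' j)) → F x ≡ F x'
  move z z' r r' h = trans (sym (H≡F {z} r)) (trans (H-cong {z} {z'} h) (H≡F {z'} r'))

  preimage : Fin n → Sign → Pt m
  preimage i s with dep? F i
  ... | yes d = proj₁ (surjective (g i) (nonconst-g i d) s)
  ... | no _ = replicate m Sign.+

  preimage-value : ∀ i s → Dep F i → g i (preimage i s) ≡ s
  preimage-value i s d with dep? F i
  ... | yes d' = proj₂ (surjective (g i) (nonconst-g i d') s)
  ... | no nd = ⊥-elim (nd d)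

  base : Pt n → Matrix n m
  base x i = preimage i (lookup x i)

  base-realises : ∀ x → Realises (base x) x
  base-realises x = realises λ i d → preimage-value i (lookup x i) d

  put-realises : ∀ {z x x'} i a → Realises z x → g i a ≡ lookup x' i →
                 (∀ k → k ≢ i → lookup x k ≡ lookup x' k) → Realises (put i a z) x'
  put-realises {z} {x} {x'} i a r e h = realises go
    where
    go : ∀ k → Dep F k → g k (put i a z k) ≡ lookup x' k
    go k d with k FinP.≟ i
    ... | yes refl = e
    ... | no ne = trans (value r k d) (h k ne)

  -- Changing entry `(i , j)` alone can switch row `i` and thereby change `H`. On the other side of
  -- the identity only column `j` contains that entry, so `f j` must depend on it and `G` on `f j`.
  edge-g : ∀ {i j} → Dep F i → Dep (g i) j → E i j
  edge-g {i} {j} d@(x , ne) dg = edge d (proj₁ both) dg (proj₂ both)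
    where
    Z : Sign → Matrix n m
    Z s = put i (along (g i) dg s) (base x)
    entries : ∀ s s' k j' → (k ≡ i → j' ≢ j) → lookup (Z s k) j' ≡ lookup (Z s' k) j'
    entries s s' k j' h with k FinP.≟ i
    ... | yes e = trans (along-off (g i) dg s (h e)) (sym (along-off (g i) dg s' (h e)))
    ... | no _ = refl
    both : Dep G j × Dep (f j) i
    both = decidable-stable (dep? G j ×-dec dep? (f j) i) λ np → ne (move (Z (lookup x i)) (Z (opposite (lookup x i)))
      (put-realises i _ (base-realises x) (along-value (g i) dg _) (λ _ _ → refl))
      (put-realises i _ (base-realises x) (trans (along-value (g i) dg _) (sym (lookup-flip x i))) (λ k k≢i → sym (lookup-flip′ x k≢i)))
      λ j' dj' → column-agree {Z _} {Z _} j' λ k dk → entries _ _ k j' λ { refl refl → np (dj' , dk) })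

  -- If row i is insensitive to entry (i , j), then flipping that entry moves the j-th
  -- input of G without moving H, so H ignores the whole column j.
  column-free : ∀ {i j} → E i j → (z z' : Matrix n m) → g i (flipAt (z i) j) ≡ g i (z i) →
                (∀ k j' → j' ≢ j → lookup (z' k) j' ≡ lookup (z k) j') → H z ≡ H z'
  column-free {i} {j} e z z' ins off = trans (toW z λ _ _ _ → refl) (sym (toW z' off))
    where
    b = proj₁ (Edge.f-dep e)
    W : Pt n → Matrix n m
    W c k = z k [ j ]≔ lookup c k
    row-i : ∀ s → g i (z i [ j ]≔ s) ≡ g i (z i)
    row-i s with s SignP.≟ lookup (z i) j
    ... | yes refl = cong (g i) (lookup-ext lem)
      where
      lem : ∀ k → lookup (z i [ j ]≔ lookup (z i) j) k ≡ lookup (z i) k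
      lem k with k FinP.≟ j
      ... | yes refl = lookup∘update j (z i) _
      ... | no ne = lookup∘update′ ne (z i) _
    ... | no ne = trans (cong (λ t → g i (z i [ j ]≔ t)) (≢⇒≡opposite ne)) ins
    col-j : ∀ c → column (W c) j ≡ c
    col-j c = lookup-ext λ k → trans (lookup-column (W c) j k) (lookup∘update j (z k) _)
    HW : H (W b) ≡ H (W (flipAt b i))
    HW = cong F (tabulate-cong lem)
      where
      lem : ∀ k → g k (W b k) ≡ g k (W (flipAt b i) k)
      lem k with k FinP.≟ i
      ... | yes refl = trans (row-i _) (sym (row-i _))
      ... | no ne = cong (λ t → g k (z k [ j ]≔ t)) (sym (lookup-flip′ b ne))
    toWc : ∀ u → (∀ k j' → j' ≢ j → lookup (u k) j' ≡ lookup (z k) j') → ∀ c → f j (column u j) ≡ f j c → H u ≡ H (W c)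
    toWc u h c eq = H-cong lem
      where
      lem : ∀ j' → Dep G j' → f j' (column u j') ≡ f j' (column (W c) j')
      lem j' _ with j' FinP.≟ j
      ... | yes refl = trans eq (cong (f j) (sym (col-j c)))
      ... | no ne = column-agree {u} {W c} j' λ k _ → trans (h k j' ne) (sym (lookup∘update′ ne (z k) _))
    -- `f j` takes both of its values at `b` and `flipAt b i`, so one of `W b` and `W (flipAt b i)`
    -- has the same column values as `u`; by `HW` these two matrices have the same `H`.
    toW : ∀ u → (∀ k j' → j' ≢ j → lookup (u k) j' ≡ lookup (z k) j') → H u ≡ H (W b)
    toW u h with f j (column u j) SignP.≟ f j b
    ... | yes eq = toWc u h b eq
    ... | no ne = trans (toWc u h (flipAt b i) (≢-≢⇒≡ ne (proj₂ (Edge.f-dep e) ∘ sym))) (sym HW)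

  -- Row `i'` can be switched through its entry in column `j` alone, and with row `i` equal to `a`
  -- the whole column `j` has no influence on `H`.
  insensitive-row : ∀ {i i' j} → E i j → E i' j → i' ≢ i → ∀ a → g i (flipAt a j) ≡ g i a → ∀ {x x'} →
                    lookup x i ≡ g i a → (∀ k → k ≢ i' → lookup x k ≡ lookup x' k) → F x ≡ F x'
  insensitive-row {i} {i'} {j} e e' i'≢i a ins {x} {x'} xi off =
    trans (sym (H≡F (real x xi (λ _ _ → refl))))
      (trans (column-free e (Z (lookup x i')) (Z (lookup x' i')) (subst (λ r → g i (flipAt r j) ≡ g i r) (sym (put-same i a _)) ins) entries)
        (H≡F (real x' (trans (sym (off i (i'≢i ∘ sym))) xi) off)))
    where
    d = Edge.g-dep e'
    Z : Sign → Matrix n m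
    Z s = put i a (put i' (along (g i') d s) (base x))
    real : ∀ y → lookup y i ≡ g i a → (∀ k → k ≢ i' → lookup x k ≡ lookup y k) → Realises (Z (lookup y i')) y
    real y yi h = put-realises {x = y} i a (put-realises i' _ (base-realises x) (along-value (g i') d _) h) (sym yi) λ _ _ → refl
    entries : ∀ k j' → j' ≢ j → lookup (Z (lookup x' i') k) j' ≡ lookup (Z (lookup x i') k) j'
    entries k j' ne with k FinP.≟ i
    ... | yes _ = refl
    ... | no _ with k FinP.≟ i'
    ...   | yes refl = trans (along-off (g i') d _ ne) (sym (along-off (g i') d _ ne))
    ...   | no _ = refl

-- Values of `H` around an edge that is not odd

module Edges {n m : ℕ} {F : BF n} {f : Fin m → BF n} {G : BF m} {g : Fin n → BF m} (S : Sys F f G g) where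

  open Sys S
  open Moves S

  edge-f : ∀ {i j} → Dep G j → Dep (f j) i → E i j
  edge-f dG df = flipEdge (Moves.edge-g (swap S) dG df)

  -- Besides the entry that forces `g i`, the record keeps evidence about `f j`: `p` and `p'` show
  -- that the entry κ does not determine `f j`, which later identifies the κ found from the column
  -- side with this one; `q` shows that `f j` is not odd in row `i`.
  record NonlinearEdge (i : Fin n) (j : Fin m) : Set where
    field
      κ e : Sign
      g-off : ∀ a → lookup a j ≡ opposite κ → g i a ≡ e
      p p' q : Pt n
      p-κ : lookup p i ≡ κ
      p'-κ : lookup p' i ≡ κ
      p-p' : f j p ≢ f j p'
      q-insensitive : f j (flipAt q i) ≡ f j q

  -- With the other rows fixed, only (x_i , x_i') = (− e , v*) gives F a value other than q₀.
  -- Hence f_j takes one value on the column of (a , v*), a sensitive at j with g_i a = − e,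
  -- and the other value on the three columns where a is flipped at j or v* is negated; so
  -- the j-th entry κ of such an a is determined by f_j alone.
  module _ {i i' : Fin n} {j : Fin m} (ed : E i j) (ed' : E i' j) (i'≢i : i' ≢ i)
           (a₀ : Pt m) (ins : g i (flipAt a₀ j) ≡ g i a₀) where

    private
      x* = proj₁ (Edge.row-dep ed')
      e = g i a₀

      X : Sign → Sign → Pt n
      X u v = (x* [ i ]≔ u) [ i' ]≔ v
      X-i : ∀ u v → lookup (X u v) i ≡ u
      X-i u v = trans (lookup∘update′ (i'≢i ∘ sym) (x* [ i ]≔ u) v) (lookup∘update i x* u)
      X-i' : ∀ u v → lookup (X u v) i' ≡ v
      X-i' u v = lookup∘update i' (x* [ i ]≔ u) v
      X-off : ∀ u v k → k ≢ i → k ≢ i' → lookup (X u v) k ≡ lookup x* k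
      X-off u v k k≢i k≢i' = trans (lookup∘update′ k≢i' (x* [ i ]≔ u) v) (lookup∘update′ k≢i x* u)
      X-i'-only : ∀ u v v' k → k ≢ i' → lookup (X u v) k ≡ lookup (X u v') k
      X-i'-only u v v' k ne = trans (lookup∘update′ ne (x* [ i ]≔ u) v) (sym (lookup∘update′ ne (x* [ i ]≔ u) v'))

      FX-e : ∀ v v' → F (X e v) ≡ F (X e v')
      FX-e v v' = insensitive-row ed ed' i'≢i a₀ ins (X-i e v) (X-i'-only e v v')

      x*-i : lookup x* i ≡ opposite e
      x*-i = ≢⇒≡opposite λ eq → proj₂ (Edge.row-dep ed')
        (insensitive-row ed ed' i'≢i a₀ ins eq λ k ne → sym (lookup-flip′ x* ne))

      X≡ : ∀ {y} → lookup y i ≡ opposite e → (∀ k → k ≢ i' → lookup y k ≡ lookup x* k) → X (opposite e) (lookup y i') ≡ y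
      X≡ {y} yi h = lookup-ext lem
        where
        lem : ∀ k → lookup (X (opposite e) (lookup y i')) k ≡ lookup y k
        lem k with k FinP.≟ i'
        ... | yes refl = X-i' _ _
        ... | no k≢i' with k FinP.≟ i
        ...   | yes refl = trans (X-i _ _) (sym yi)
        ...   | no k≢i = trans (X-off _ _ k k≢i k≢i') (sym (h k k≢i'))

      FX-opp : ∀ v → F (X (opposite e) v) ≢ F (X (opposite e) (opposite v))
      FX-opp v eq = proj₂ (Edge.row-dep ed') (trans (cong F (sym (X≡ x*-i λ _ _ → refl)))
        (trans (both v eq (lookup x* i')) (trans (cong (λ v → F (X (opposite e) v)) (sym (lookup-flip x* i')))
          (cong F (X≡ (trans (lookup-flip′ x* (i'≢i ∘ sym)) x*-i) λ k ne → lookup-flip′ x* ne)))))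
        where
        both : ∀ v → F (X (opposite e) v) ≡ F (X (opposite e) (opposite v)) →
               ∀ w → F (X (opposite e) w) ≡ F (X (opposite e) (opposite w))
        both Sign.- eq Sign.- = eq
        both Sign.- eq Sign.+ = sym eq
        both Sign.+ eq Sign.- = sym eq
        both Sign.+ eq Sign.+ = eq

      q₀ = F (X e Sign.+)

      choice : ∃ λ v → F (X (opposite e) v) ≢ q₀ × F (X (opposite e) (opposite v)) ≡ q₀
      choice with F (X (opposite e) Sign.+) SignP.≟ q₀
      ... | yes eq = Sign.- , (λ eq' → FX-opp Sign.- (trans eq' (sym eq))) , eq
      ... | no ne = Sign.+ , ne , ≢-≢⇒≡ {u = F (X (opposite e) Sign.+)} (FX-opp Sign.+ ∘ sym) (ne ∘ sym)

      module _ (v* : Sign) (F-high : F (X (opposite e) v*) ≢ q₀) (F-low : F (X (opposite e) (opposite v*)) ≡ q₀)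
               (a₁ : Pt m) (g-a₁ : g i a₁ ≡ opposite e) (g-a₁' : g i (flipAt a₁ j) ≡ e) where

        Z : Pt m → Sign → Matrix n m
        Z a v = put i a (put i' (along (g i') (Edge.g-dep ed') v) (base x*))
        HZ : ∀ a v → H (Z a v) ≡ F (X (g i a) v)
        HZ a v = H≡F (put-realises {x = x* [ i' ]≔ v} i a
          (put-realises i' _ (base-realises x*) (trans (along-value (g i') (Edge.g-dep ed') v) (sym (lookup∘update i' x* v)))
            λ k ne → sym (lookup∘update′ ne x* v))
          (sym (X-i (g i a) v)) off)
          where
          off : ∀ k → k ≢ i → lookup (x* [ i' ]≔ v) k ≡ lookup (X (g i a) v) k
          off k k≢i with k FinP.≟ i'
          ... | yes refl = trans (lookup∘update i' x* v) (sym (X-i' (g i a) v))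
          ... | no k≢i' = trans (lookup∘update′ k≢i' x* v) (sym (X-off _ _ k k≢i k≢i'))

        C : Pt m → Sign → Pt n
        C a v = column (Z a v) j
        lookup-C-i : ∀ a v → lookup (C a v) i ≡ lookup a j
        lookup-C-i a v = trans (lookup-column (Z a v) j i) (cong (λ r → lookup r j) (put-same i a _))
        lookup-C : ∀ a a' v k → k ≢ i → lookup (C a v) k ≡ lookup (C a' v) k
        lookup-C a a' v k ne = trans (lookup-column (Z a v) j k) (trans (cong (λ r → lookup r j)
          (trans (put-other i a _ ne) (sym (put-other i a' _ ne)))) (sym (lookup-column (Z a' v) j k)))
        C-cong : ∀ {a a'} v → lookup a j ≡ lookup a' j → C a v ≡ C a' v
        C-cong {a} {a'} v eq = lookup-ext lem
          where
          lem : ∀ k → lookup (C a v) k ≡ lookup (C a' v) k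
          lem k with k FinP.≟ i
          ... | yes refl = trans (lookup-C-i a v) (trans eq (sym (lookup-C-i a' v)))
          ... | no ne = lookup-C a a' v k ne

        -- The two matrices agree outside column `j`, so a difference of `H` can only pass through
        -- `f j`.
        differ : ∀ {a a'} v v' → (∀ j' → j' ≢ j → lookup a j' ≡ lookup a' j') →
                 F (X (g i a) v) ≢ F (X (g i a') v') → f j (C a v) ≢ f j (C a' v')
        differ {a} {a'} v v' h ne eq = ne (trans (sym (HZ a v)) (trans (H-cong {Z a v} {Z a' v'} lem) (HZ a' v')))
          where
          entries : ∀ k j' → j' ≢ j → lookup (Z a v k) j' ≡ lookup (Z a' v' k) j'
          entries k j' j'≢j with k FinP.≟ i
          ... | yes _ = h j' j'≢j
          ... | no _ with k FinP.≟ i'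
          ...   | yes refl = trans (along-off (g i') (Edge.g-dep ed') v j'≢j) (sym (along-off (g i') (Edge.g-dep ed') v' j'≢j))
          ...   | no _ = refl
          lem : ∀ j' → Dep G j' → f j' (column (Z a v) j') ≡ f j' (column (Z a' v') j')
          lem j' _ with j' FinP.≟ j
          ... | yes refl = eq
          ... | no j'≢j = column-agree {Z a v} {Z a' v'} j' λ k _ → entries k j' j'≢j

        high : ∀ {a} → g i a ≡ opposite e → F (X (g i a) v*) ≢ q₀
        high eq = subst (λ u → F (X u v*) ≢ q₀) (sym eq) F-high
        low-v : ∀ {a} → g i a ≡ opposite e → F (X (g i a) (opposite v*)) ≡ q₀
        low-v eq = subst (λ u → F (X u (opposite v*)) ≡ q₀) (sym eq) F-low
        low-e : ∀ {a} v → g i a ≡ e → F (X (g i a) v) ≡ q₀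
        low-e v eq = trans (cong (λ u → F (X u v)) eq) (FX-e v Sign.+)

        n₁ : ∀ a → g i a ≡ opposite e → g i (flipAt a j) ≡ e → f j (C a v*) ≢ f j (C (flipAt a j) v*)
        n₁ a ga ga' = differ v* v* (λ j' ne → sym (lookup-flip′ a ne)) λ eq → high ga (trans eq (low-e v* ga'))
        n₂ : ∀ a → g i a ≡ opposite e → f j (C a v*) ≢ f j (C a (opposite v*))
        n₂ a ga = differ v* (opposite v*) (λ _ _ → refl) λ eq → high ga (trans eq (low-v ga))
        n₃ : ∀ a → g i a ≡ opposite e → g i (flipAt a j) ≡ e → f j (C a v*) ≢ f j (C (flipAt a j) (opposite v*))
        n₃ a ga ga' = differ v* (opposite v*) (λ j' ne → sym (lookup-flip′ a ne)) λ eq → high ga (trans eq (low-e (opposite v*) ga'))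

        κ = lookup a₁ j

        flip-C : flipAt (C a₁ (opposite v*)) i ≡ C (flipAt a₁ j) (opposite v*)
        flip-C = lookup-ext lem
          where
          lem : ∀ k → lookup (flipAt (C a₁ (opposite v*)) i) k ≡ lookup (C (flipAt a₁ j) (opposite v*)) k
          lem k with k FinP.≟ i
          ... | yes refl = trans (lookup-flip (C a₁ (opposite v*)) i) (trans (cong opposite (lookup-C-i a₁ (opposite v*)))
                             (sym (trans (lookup-C-i (flipAt a₁ j) (opposite v*)) (lookup-flip a₁ j))))
          ... | no ne = trans (lookup-flip′ (C a₁ (opposite v*)) ne) (lookup-C a₁ (flipAt a₁ j) (opposite v*) k ne)

        g-off : ∀ a → lookup a j ≡ opposite κ → g i a ≡ e
        g-off a aj with g i a SignP.≟ e
        ... | yes eq = eq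
        ... | no ne with g i (flipAt a j) SignP.≟ g i a
        -- An insensitive point with value `opposite e` would make `F` ignore row `i'` at
        -- `opposite e` as well, against `FX-opp`.
        ...   | yes ins' = ⊥-elim (FX-opp Sign.+ (insensitive-row ed ed' i'≢i a ins'
                    (trans (X-i _ _) (sym (≢⇒≡opposite ne))) (X-i'-only (opposite e) Sign.+ Sign.-)))
        -- The column of `a` is that of `flipAt a₁ j`, on which `f j` does not tell `v*` from
        -- `opposite v*` (by `n₁` and `n₃`); this contradicts `n₂` for `a`.
        ...   | no sens = ⊥-elim (n₂ a (≢⇒≡opposite ne) (trans (cong (f j) (C-cong v* aj'))
                    (trans (≢-≢⇒≡ (n₁ a₁ g-a₁ g-a₁' ∘ sym) (n₃ a₁ g-a₁ g-a₁' ∘ sym)) (cong (f j) (sym (C-cong (opposite v*) aj'))))))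
          where
          aj' : lookup a j ≡ lookup (flipAt a₁ j) j
          aj' = trans aj (sym (lookup-flip a₁ j))

        result : NonlinearEdge i j
        result = record
          { κ = κ ; e = e ; g-off = g-off ; p = C a₁ v* ; p' = C a₁ (opposite v*) ; q = C a₁ (opposite v*)
          ; p-κ = lookup-C-i a₁ v* ; p'-κ = lookup-C-i a₁ (opposite v*)
          ; p-p' = n₂ a₁ g-a₁ ; q-insensitive = trans (cong (f j) flip-C) (≢-≢⇒≡ (n₃ a₁ g-a₁ g-a₁' ∘ sym) (n₂ a₁ g-a₁ ∘ sym)) }

    nonlinear-edge′ : NonlinearEdge i j
    nonlinear-edge′ =
      let v* , hi , lo = choice
          a₁ , ga , ga' = sensitive (g i) (Edge.g-dep ed) (opposite e)
      in result v* hi lo a₁ ga (trans ga' (SignP.opposite-involutive e))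

  nonlinear-edge : ∀ {i j} → E i j → 2 ≤ deg (f j) → ∀ a₀ → g i (flipAt a₀ j) ≡ g i a₀ → NonlinearEdge i j
  nonlinear-edge {i} {j} ed 2≤ a₀ ins =
    let i' , i'≢i , d = another-Dep (f j) (nonconst-f j (Edge.col-dep ed)) 2≤ i
    in nonlinear-edge′ ed (edge-f (Edge.col-dep ed) d) i'≢i a₀ ins

T-∧⁺ : ∀ {a b} → T a → T b → T (a ∧ b)
T-∧⁺ {true} _ t = t

T-∧⁻ : ∀ {a b} → T (a ∧ b) → T a × T b
T-∧⁻ {true} t = tt , t

T-≡ : ∀ {a b} → (T a → T b) → (T b → T a) → a ≡ b
T-≡ {true} {true} h k = refl
T-≡ {true} {false} h k = ⊥-elim (h tt)
T-≡ {false} {true} h k = ⊥-elim (k tt)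
T-≡ {false} {false} h k = refl

does⁺ : {P : Set} (d : Dec P) → P → T (does d)
does⁺ (yes _) p = tt
does⁺ (no np) p = np p

does⁻ : {P : Set} (d : Dec P) → T (does d) → P
does⁻ (yes p) _ = p

≡ᵇ-true : ∀ {d} → d ≡ 1 → (d ≡ᵇ 1) ≡ true
≡ᵇ-true refl = refl

1≢2≤ : ∀ {d} → d ≡ 1 → ¬ 2 ≤ d
1≢2≤ refl (s≤s ())

flip-comm : (x : Pt n) (i k : Fin n) → flipAt (flipAt x i) k ≡ flipAt (flipAt x k) i
flip-comm x i k with i FinP.≟ k
... | yes refl = refl
... | no i≢k = lookup-ext lem
  where
  lem : ∀ l → lookup (flipAt (flipAt x i) k) l ≡ lookup (flipAt (flipAt x k) i) l
  lem l with l FinP.≟ i | l FinP.≟ k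
  ... | yes refl | yes e = ⊥-elim (i≢k e)
  ... | yes refl | no l≢k = trans (lookup-flip′ (flipAt x i) l≢k) (trans (lookup-flip x i)
          (sym (trans (lookup-flip (flipAt x k) i) (cong opposite (lookup-flip′ x l≢k)))))
  ... | no l≢i | yes refl = trans (lookup-flip (flipAt x i) k) (trans (cong opposite (lookup-flip′ x l≢i))
          (sym (trans (lookup-flip′ (flipAt x k) l≢i) (lookup-flip x k))))
  ... | no l≢i | no l≢k = trans (lookup-flip′ (flipAt x i) l≢k) (trans (lookup-flip′ x l≢i)
          (sym (trans (lookup-flip′ (flipAt x k) l≢i) (lookup-flip′ x l≢k))))

-- Leaves, and the agreement of the two ends of an edge

module Degrees {n m : ℕ} {F : BF n} {f : Fin m → BF n} {G : BF m} {g : Fin n → BF m} (S : Sys F f G g) where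

  open Sys S
  open Moves S

  deg-cases : ∀ i → Dep F i → deg (g i) ≡ 1 ⊎ 2 ≤ deg (g i)
  deg-cases i d with 2 ℕP.≤? deg (g i)
  ... | yes le = inj₂ le
  ... | no nle with deg≤1⇒dictator (g i) (nonconst-g i d) (ℕP.≤-pred (ℕP.≰⇒> nle))
  ...   | s , k , h = inj₁ (dictator⇒deg≡1 {s = s} {k} h)

  leaf-form : ∀ {i j} → E i j → deg (g i) ≡ 1 → ∀ y → g i y ≡ sgnD (g i) · lookup y j
  leaf-form {i} {j} e eq y with deg≤1⇒dictator (g i) (nonconst-g i (Edge.row-dep e)) (ℕP.≤-reflexive eq)
  ... | s , k , h = trans (h y) (cong₂ (λ s k → s · lookup y k) (dictator-sgn {s = s} {k} h) (sym (dictator-Dep {s = s} {k} h j (Edge.g-dep e))))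

  leaf-unique : ∀ {i j j'} → E i j → E i j' → deg (g i) ≡ 1 → j' ≡ j
  leaf-unique {i} {j} {j'} e e' eq = dictator-Dep {s = sgnD (g i)} {j} (leaf-form e eq) j' (Edge.g-dep e')

  leaf-linear : ∀ {i j} → E i j → deg (g i) ≡ 1 → LinearAt (g i) j
  leaf-linear {i} {j} e eq y = trans (leaf-form e eq (flipAt y j)) (trans (cong (sgnD (g i) ·_) (lookup-flip y j))
    (trans (opposite-*ʳ (sgnD (g i)) (lookup y j)) (cong opposite (sym (leaf-form e eq y)))))

module Types {n m : ℕ} {F : BF n} {f : Fin m → BF n} {G : BF m} {g : Fin n → BF m} (S : Sys F f G g) where

  open Sys S
  open Moves S
  open Edges S
  open Degrees S

  deg-cases-f : ∀ j → Dep G j → deg (f j) ≡ 1 ⊎ 2 ≤ deg (f j)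
  deg-cases-f = Degrees.deg-cases (swap S)

  two-rows⇒2≤ : ∀ {i i' j} → E i j → E i' j → i' ≢ i → 2 ≤ deg (f j)
  two-rows⇒2≤ {j = j} e e' ne with deg-cases-f j (Edge.col-dep e)
  ... | inj₂ le = le
  ... | inj₁ eq = ⊥-elim (ne (Degrees.leaf-unique (swap S) (flipEdge e) (flipEdge e') eq))

  -- The point `q` of `NonlinearEdge` is insensitive for `f j`. Together with the transposed
  -- statement, the two ends of an edge between vertices of degree at least 2 are odd or not odd
  -- together.
  nonlinear-f : ∀ {i j} → E i j → 2 ≤ deg (f j) → ¬ LinearAt (g i) j → ¬ LinearAt (f j) i
  nonlinear-f {i} {j} e 2≤ nl lin =
    let a , ins = ¬LinearAt⇒ (g i) j nl
        N = nonlinear-edge e 2≤ a ins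
    in opp≢ _ (trans (sym (lin (NonlinearEdge.q N))) (NonlinearEdge.q-insensitive N))

  -- `D` and `B` are the values that the entry `opposite κ` excludes, so a row can reach `D` only if
  -- its entry is κ.
  record ThresholdEdge (i : Fin n) (j : Fin m) : Set where
    field
      κ D B : Sign
      g-off : ∀ y → lookup y j ≡ opposite κ → g i y ≡ opposite D
      f-off : ∀ x → lookup x i ≡ opposite κ → f j x ≡ opposite B

  threshold-edge : ∀ {i j} → E i j → 2 ≤ deg (g i) → 2 ≤ deg (f j) → ¬ LinearAt (g i) j → ThresholdEdge i j
  threshold-edge {i} {j} e 2≤g 2≤f nl =
    let a , ins = ¬LinearAt⇒ (g i) j nl
        b , ins' = ¬LinearAt⇒ (f j) i (nonlinear-f e 2≤f nl)
    in combine (nonlinear-edge e 2≤f a ins) (Edges.nonlinear-edge (swap S) (flipEdge e) 2≤g b ins')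
    where
    combine : NonlinearEdge i j → Edges.NonlinearEdge (swap S) j i → ThresholdEdge i j
    combine N N' = record
      { κ = N.κ ; D = opposite N.e ; B = opposite N'.e
      ; g-off = λ y h → trans (N.g-off y h) (sym (SignP.opposite-involutive N.e))
      ; f-off = λ x h → trans (N'.g-off x (trans h (cong opposite (sym κ≡)))) (sym (SignP.opposite-involutive N'.e)) }
      where
      module N = NonlinearEdge N
      module N' = Edges.NonlinearEdge N'
      κ≡ : N'.κ ≡ N.κ
      κ≡ with N'.κ SignP.≟ N.κ
      ... | yes eq = eq
      -- With opposite κ's, `f j` would be constant where the `i`-th entry is `N.κ`, but it
      -- separates `N.p` from `N.p'`.
      ... | no ne = ⊥-elim (N.p-p' (trans (N'.g-off N.p (trans N.p-κ opp)) (sym (N'.g-off N.p' (trans N.p'-κ opp)))))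
        where
        opp : N.κ ≡ opposite N'.κ
        opp = ≢⇒≡opposite (ne ∘ sym)

-- Blocks

record IsBlock {F : BF n} {f : Fin m → BF n} {G : BF m} {g : Fin n → BF m} (S : Sys F f G g)
               (row : Fin n → Bool) (col : Fin m → Bool) : Set₁ where
  open Moves S using (E)
  field
    row-dep : ∀ i → T (row i) → Dep F i
    col-dep : ∀ j → T (col j) → Dep G j
    row→col : ∀ {i j} → E i j → T (row i) → T (col j)
    col→row : ∀ {i j} → E i j → T (col j) → T (row i)
    connected : (P : Fin n → Set) → (∀ a b j → E a j → E b j → P a → P b) →
                ∀ i k → T (row i) → T (row k) → P i → P k

-- Connectedness is stored for rows. A predicate on columns is transported as the predicate on rows
-- that all columns meeting the row satisfy it.
swapBlock : {F : BF n} {f : Fin m → BF n} {G : BF m} {g : Fin n → BF m} {S : Sys F f G g}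
            {row : Fin n → Bool} {col : Fin m → Bool} → IsBlock S row col → IsBlock (swap S) col row
swapBlock {F = F} {f} {G} {g} {S} {row} {col} bl = record
  { row-dep = col-dep ; col-dep = row-dep
  ; row→col = λ e → col→row (flipEdge e)
  ; col→row = λ e → row→col (flipEdge e)
  ; connected = conn }
  where
  open IsBlock bl
  open Sys S
  open Moves S
  open Edges S
  conn : (P : Fin _ → Set) → (∀ a b i → Edge G g F f a i → Edge G g F f b i → P a → P b) →
         ∀ j k → T (col j) → T (col k) → P j → P k
  conn P cl j k tj tk pj =
    let i , di = dependsOnSome (f j) (nonconst-f j (col-dep j tj))
        l , dl = dependsOnSome (f k) (nonconst-f k (col-dep k tk))
        ei = edge-f (col-dep j tj) di
        el = edge-f (col-dep k tk) dl
    in connected (λ a → ∀ b → E a b → P b)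
         (λ a b c ea eb h d ed → cl c d b (flipEdge eb) (flipEdge ed) (h c ea))
         i l (col→row ei tj) (col→row el tk)
         (λ b eb → cl j b i (flipEdge ei) (flipEdge eb) pj) k el

module BlockBasics {n m : ℕ} {F : BF n} {f : Fin m → BF n} {G : BF m} {g : Fin n → BF m} (S : Sys F f G g)
                   {row : Fin n → Bool} {col : Fin m → Bool} (bl : IsBlock S row col) where

  open Sys S
  open Moves S
  open Edges S
  open Degrees S
  open Types S
  open IsBlock bl

  -- `row2`, `depF2` and `xsgn` repeat the definitions of the theorem for an arbitrary system and
  -- arbitrary masks, so that they also exist after `swap`; for the actual blocks they unfold to the
  -- same terms.
  row2 : Fin n → Bool
  row2 i = row i ∧ (2 ≤ᵇ deg (g i))

  depF2 : Fin m → Fin n → Bool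
  depF2 j i = depᵇ (f j) i ∧ (2 ≤ᵇ deg (g i))

  xsgn : Pt n → Pt n
  xsgn x = tabulate λ i → if deg (g i) ≡ᵇ 1 then sgnD (g i) · lookup x i else lookup x i

  row2⁺ : ∀ {i} → T (row i) → 2 ≤ deg (g i) → T (row2 i)
  row2⁺ t le = T-∧⁺ t (ℕP.≤⇒≤ᵇ le)

  row2⁻ : ∀ {i} → T (row2 i) → T (row i) × 2 ≤ deg (g i)
  row2⁻ {i} t = proj₁ (T-∧⁻ t) , ℕP.≤ᵇ⇒≤ 2 (deg (g i)) (proj₂ (T-∧⁻ {row i} t))

  depF2⁺ : ∀ {i j} → Dep (f j) i → 2 ≤ deg (g i) → T (depF2 j i)
  depF2⁺ {i} {j} d le = T-∧⁺ (does⁺ (dep? (f j) i) d) (ℕP.≤⇒≤ᵇ le)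

  depF2⁻ : ∀ {i j} → T (depF2 j i) → Dep (f j) i × 2 ≤ deg (g i)
  depF2⁻ {i} {j} t = does⁻ (dep? (f j) i) (proj₁ (T-∧⁻ t)) , ℕP.≤ᵇ⇒≤ 2 (deg (g i)) (proj₂ (T-∧⁻ {depᵇ (f j) i} t))

  fill-agree : (p : Fin n → Bool) (s : Fin n → Sign) {x x' : Pt n} (k : Fin n) →
               (¬ T (p k) → lookup x k ≡ lookup x' k) → lookup (fill p s x) k ≡ lookup (fill p s x') k
  fill-agree p s {x} {x'} k h with T? (p k)
  ... | yes t = trans (lookup-fill p s x k t) (sym (lookup-fill p s x' k t))
  ... | no nt = trans (lookup-fill′ p s x k nt) (trans (h nt) (sym (lookup-fill′ p s x' k nt)))

  -- `f j` with its neighbours of degree at least 2 frozen at `s`, hence a function of leaves. The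
  -- pattern + yields φ in case (2), the pattern κ yields φ~ in case (3).
  Ψ : (Fin n → Sign) → Fin m → BF n
  Ψ s j x = f j (fill (depF2 j) s x)

  Ψ-dep : ∀ s {j} → Dep G j → ∀ i → Dep (Ψ s j) i → Dep (f j) i × deg (g i) ≡ 1
  Ψ-dep s {j} dG i (x , ne) with dep? (f j) i
  ... | no nd = ⊥-elim (ne (agree-on-Dep (f j) λ k d → fill-agree (depF2 j) s {x} {flipAt x i} k λ _ → sym (lookup-flip′ x {i} {k} λ { refl → nd d })))
  ... | yes d with deg-cases i (Edge.row-dep (edge-f dG d))
  ...   | inj₁ eq = d , eq
  ...   | inj₂ le = ⊥-elim (ne (agree-on-Dep (f j) λ k _ → fill-agree (depF2 j) s {x} {flipAt x i} k λ nt →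
                      sym (lookup-flip′ x {i} {k} λ { refl → nt (depF2⁺ d le) })))

  -- A leaf has value `sgnD (g i)` times its entry, and a second multiplication by that sign cancels
  -- it. This is the purpose of x^sgn: the factors φ_j are applied to matrix entries, while the
  -- block function receives row values.
  xsgn-leaf : ∀ {z x i j} → Realises z x → E i j → deg (g i) ≡ 1 → lookup (xsgn x) i ≡ lookup (z i) j
  xsgn-leaf {z} {x} {i} {j} r e eq = begin
    lookup (xsgn x) i ≡⟨ lookup∘tabulate _ i ⟩
    (if deg (g i) ≡ᵇ 1 then sgnD (g i) · lookup x i else lookup x i)
      ≡⟨ cong (λ b → if b then sgnD (g i) · lookup x i else lookup x i) (≡ᵇ-true eq) ⟩
    sgnD (g i) · lookup x i ≡⟨ cong (sgnD (g i) ·_) (sym (Realises.value r i (Edge.row-dep e))) ⟩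
    sgnD (g i) · g i (z i) ≡⟨ cong (sgnD (g i) ·_) (leaf-form e eq (z i)) ⟩
    sgnD (g i) · (sgnD (g i) · lookup (z i) j) ≡⟨ sym (SignP.*-assoc (sgnD (g i)) (sgnD (g i)) _) ⟩
    sgnD (g i) · sgnD (g i) · lookup (z i) j ≡⟨ cong (_· lookup (z i) j) (SignP.s*s≡+ (sgnD (g i))) ⟩
    lookup (z i) j ∎
    where open ≡-Reasoning

  Ψ-sgn : ∀ s {j z x} → Dep G j → Realises z x → Ψ s j (xsgn x) ≡ Ψ s j (column z j)
  Ψ-sgn s {j} {z} {x} dG r = agree-on-Dep (Ψ s j) {xsgn x} {column z j} λ k d →
    let df , eq = Ψ-dep s dG k d
    in trans (xsgn-leaf r (edge-f dG df) eq) (sym (lookup-column z j k))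

  xsgn-agree : ∀ {x x'} k → lookup x k ≡ lookup x' k → lookup (xsgn x) k ≡ lookup (xsgn x') k
  xsgn-agree {x} {x'} k e = trans (lookup∘tabulate _ k)
    (trans (cong (λ t → if deg (g k) ≡ᵇ 1 then sgnD (g k) · t else t) e) (sym (lookup∘tabulate _ k)))

  Ψ-xsgn-agree : ∀ s {j x x'} → Dep G j → (∀ k → Dep (f j) k → deg (g k) ≡ 1 → lookup x k ≡ lookup x' k) →
                 Ψ s j (xsgn x) ≡ Ψ s j (xsgn x')
  Ψ-xsgn-agree s {j} {x} {x'} dG h = agree-on-Dep (Ψ s j) {xsgn x} {xsgn x'} λ k d →
    let df , eq = Ψ-dep s dG k d in xsgn-agree {x} {x'} k (h k df eq)

  flipEntry : Matrix n m → Fin n → Fin m → Matrix n m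
  flipEntry z i j = put i (flipAt (z i) j) z

  flipEntry-realises : ∀ {z x i j} → Realises z x → LinearAt (g i) j → Dep F i → Realises (flipEntry z i j) (flipAt x i)
  flipEntry-realises {z} {x} {i} {j} r lin d = put-realises i _ r
    (trans (lin (z i)) (trans (cong opposite (Realises.value r i d)) (sym (lookup-flip x i))))
    λ k ne → sym (lookup-flip′ x ne)

  flipEntry-other : ∀ z i j j' k → j' ≢ j → lookup (flipEntry z i j k) j' ≡ lookup (z k) j'
  flipEntry-other z i j j' k ne with k FinP.≟ i
  ... | yes refl = lookup-flip′ (z k) ne
  ... | no _ = refl

  flipEntry-off : ∀ z i j k → k ≢ i → lookup (flipEntry z i j k) j ≡ lookup (z k) j
  flipEntry-off z i j k ne = cong (λ r → lookup r j) (put-other i _ z ne)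

  flipEntry-column : ∀ z i j → column (flipEntry z i j) j ≡ flipAt (column z j) i
  flipEntry-column z i j = lookup-ext lem
    where
    lem : ∀ k → lookup (column (flipEntry z i j) j) k ≡ lookup (flipAt (column z j) i) k
    lem k with k FinP.≟ i
    ... | yes refl = trans (lookup-column (flipEntry z i j) j i) (trans (cong (λ r → lookup r j) (put-same i _ z))
            (trans (lookup-flip (z i) j) (sym (trans (lookup-flip (column z j) i) (cong opposite (lookup-column z j i))))))
    ... | no ne = trans (lookup-column (flipEntry z i j) j k) (trans (flipEntry-off z i j k ne)
            (sym (trans (lookup-flip′ (column z j) ne) (lookup-column z j k))))

  move-column : ∀ {x x'} z z' j → Realises z x → Realises z' x' →
                (∀ j' k → j' ≢ j → lookup (z k) j' ≡ lookup (z' k) j') →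
                f j (column z j) ≡ f j (column z' j) → F x ≡ F x'
  move-column z z' j r r' h eq = move z z' r r' lem
    where
    lem : ∀ j' → Dep G j' → f j' (column z j') ≡ f j' (column z' j')
    lem j' _ with j' FinP.≟ j
    ... | yes refl = eq
    ... | no ne = column-agree {z} {z'} j' λ k _ → h j' k ne

  -- A relevant column outside the block meets only rows outside the block, where the two base
  -- matrices agree.
  move-block : ∀ x x' → (∀ i → Dep F i → ¬ T (row i) → lookup x i ≡ lookup x' i) →
               (∀ j → T (col j) → f j (column (base x) j) ≡ f j (column (base x') j)) → F x ≡ F x'
  move-block x x' out h = move (base x) (base x') (base-realises x) (base-realises x') lem
    where
    lem : ∀ j → Dep G j → f j (column (base x) j) ≡ f j (column (base x') j)
    lem j dj with T? (col j)
    ... | yes t = h j t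
    ... | no nt = column-agree {base x} {base x'} j λ k dk → cong (λ s → lookup (preimage k s) j)
          (out k (Edge.row-dep (edge-f dj dk)) λ t → nt (row→col (edge-f dj dk) t))

  blend : Pt n → Pt n → Pt n
  blend x x' = tabulate λ i → if row i then lookup x' i else lookup x i

  -- Relaxes the condition outside the block to rows that `F` reads. The point `blend x x'` takes
  -- the block from `x'` and the rest from `x`; `φ` sees only its block part, and `F` does not
  -- distinguish it from `x'`.
  invariant : (φ : BF n) → (∀ i → Dep φ i → T (row i)) →
              (∀ x x' → (∀ i → ¬ T (row i) → lookup x i ≡ lookup x' i) → φ x ≡ φ x' → F x ≡ F x') →
              ∀ x x' → (∀ i → Dep F i → ¬ T (row i) → lookup x i ≡ lookup x' i) → φ x ≡ φ x' → F x ≡ F x'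
  invariant φ φ-dep inv x x' out eq = trans (inv x y (λ i nt → sym (outside i nt)) (trans eq (sym φy))) Fy
    where
    y = blend x x'
    inside : ∀ i → T (row i) → lookup y i ≡ lookup x' i
    inside i t = trans (lookup∘tabulate _ i) (lem (row i) t)
      where
      lem : ∀ b → T b → (if b then lookup x' i else lookup x i) ≡ lookup x' i
      lem true _ = refl
    outside : ∀ i → ¬ T (row i) → lookup y i ≡ lookup x i
    outside i nt = trans (lookup∘tabulate _ i) (lem (row i) nt)
      where
      lem : ∀ b → ¬ T b → (if b then lookup x' i else lookup x i) ≡ lookup x i
      lem true nt = ⊥-elim (nt tt)
      lem false _ = refl
    φy : φ y ≡ φ x'
    φy = agree-on-Dep φ λ i d → inside i (φ-dep i d)
    Fy : F y ≡ F x'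
    Fy = agree-on-Dep F lem
      where
      lem : ∀ i → Dep F i → lookup y i ≡ lookup x' i
      lem i d with T? (row i)
      ... | yes t = inside i t
      ... | no nt = trans (outside i nt) (out i d nt)

-- Linear blocks

record LinearData {F : BF n} {f : Fin m → BF n} {G : BF m} {g : Fin n → BF m} {S : Sys F f G g}
                  {row : Fin n → Bool} {col : Fin m → Bool} (bl : IsBlock S row col) : Set where
  open Moves S using (E)
  field
    lin-f : ∀ {i j} → E i j → T (row i) → 2 ≤ deg (g i) → 2 ≤ deg (f j) → LinearAt (f j) i
    lin-g : ∀ {i j} → E i j → T (row i) → 2 ≤ deg (g i) → 2 ≤ deg (f j) → LinearAt (g i) j
    no-leaf-edge : ∀ {i j} → E i j → T (row i) → deg (g i) ≡ 1 → deg (f j) ≢ 1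

swapLinear : {F : BF n} {f : Fin m → BF n} {G : BF m} {g : Fin n → BF m} {S : Sys F f G g}
             {row : Fin n → Bool} {col : Fin m → Bool} {bl : IsBlock S row col} → LinearData bl → LinearData (swapBlock bl)
swapLinear {bl = bl} dat = record
  { lin-f = λ e t le le' → lin-g (flipEdge e) (col→row (flipEdge e) t) le' le
  ; lin-g = λ e t le le' → lin-f (flipEdge e) (col→row (flipEdge e) t) le' le
  ; no-leaf-edge = λ e t eq eq' → no-leaf-edge (flipEdge e) (col→row (flipEdge e) t) eq' eq }
  where
  open IsBlock bl
  open LinearData dat

module LinearForm {n m : ℕ} {F : BF n} {f : Fin m → BF n} {G : BF m} {g : Fin n → BF m} (S : Sys F f G g)
                  {row : Fin n → Bool} {col : Fin m → Bool} (bl : IsBlock S row col)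
                  (dat : LinearData bl) where

  open Moves S
  open Edges S
  open Types S
  open IsBlock bl
  open BlockBasics S bl
  open LinearData dat

  φ : Fin m → BF n
  φ = Ψ (λ _ → Sign.+)

  linear-at : ∀ {i j} → E i j → T (row i) → 2 ≤ deg (g i) → LinearAt (f j) i
  linear-at {i} {j} e t le with deg-cases-f j (Edge.col-dep e)
  ... | inj₁ eq = Degrees.leaf-linear (swap S) (flipEdge e) eq
  ... | inj₂ le' = lin-f e t le le'

  f-form : ∀ j → T (col j) → ∀ x → f j x ≡ φ j x · ∏S (depF2 j) (lookup x)
  f-form j t = linear-factor (f j) (depF2 j) λ i ti →
    let d , le = depF2⁻ ti
        e = edge-f (col-dep j t) d
    in linear-at e (col→row e t) le

module LinearBlock {n m : ℕ} {F : BF n} {f : Fin m → BF n} {G : BF m} {g : Fin n → BF m} (S : Sys F f G g)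
                   {row : Fin n → Bool} {col : Fin m → Bool} (bl : IsBlock S row col)
                   (dat : LinearData bl) where

  open Sys S
  open Moves S
  open Edges S
  open Degrees S
  open Types S
  open IsBlock bl
  open BlockBasics S bl
  open LinearForm S bl dat
  open LinearData dat

  private
    module ᵀB = BlockBasics (swap S) (swapBlock bl)
    module ᵀL = LinearForm (swap S) (swapBlock bl) (swapLinear dat)

  col2 : Fin m → Bool
  col2 = ᵀB.row2

  γ : Fin n → BF m
  γ = ᵀL.φ

  f₀ : BF n
  f₀ x = ∏S row2 (lookup x) · ∏S col2 (λ j → φ j (xsgn x))

  f₀-dep : ∀ i → Dep f₀ i → T (row i)
  f₀-dep i (x , ne) with T? (row i)
  ... | yes t = t
  ... | no nt = ⊥-elim (ne (cong₂ _·_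
        (∏S-cong row2 λ k tk → sym (lookup-flip′ x {i} {k} λ { refl → nt (proj₁ (row2⁻ tk)) }))
        (∏S-cong col2 λ j tj → let cj = proj₁ (ᵀB.row2⁻ tj) in
          Ψ-xsgn-agree (λ _ → Sign.+) {j} {x} {flipAt x i} (col-dep j cj) λ k d _ →
            sym (lookup-flip′ x {i} {k} λ { refl → nt (col→row (edge-f (col-dep j cj) d) cj) }))))

  -- Written in terms of the matrix, the block function becomes the product of all γ's, all φ's and
  -- all entries on edges between vertices of degree at least 2. This is symmetric in rows and
  -- columns, whence `LinearMatch.match`.
  f₀-apply : ∀ z → f₀ (apply g z) ≡
             ∏S row2 (λ i → γ i (z i)) · ∏S row2 (λ i → ∏S (ᵀB.depF2 i) (lookup (z i))) · ∏S col2 (λ j → φ j (column z j))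
  f₀-apply z = cong₂ _·_
    (trans (∏S-cong row2 λ i t → trans (lookup-apply g z i) (ᵀL.f-form i (proj₁ (row2⁻ t)) (z i)))
      (∏S-· row2 (λ i → γ i (z i)) (λ i → ∏S (ᵀB.depF2 i) (lookup (z i)))))
    (∏S-cong col2 λ j t → Ψ-sgn (λ _ → Sign.+) (col-dep j (proj₁ (ᵀB.row2⁻ t))) (realises {x = apply g z} λ i _ → sym (lookup-apply g z i)))

  entries-swap : ∀ (z : Fin n → Fin m → Sign) →
    ∏S row2 (λ i → ∏S (ᵀB.depF2 i) (z i)) ≡ ∏S col2 (λ j → ∏S (depF2 j) (λ i → z i j))
  entries-swap z = ∏S-swap row2 ᵀB.depF2 col2 depF2 z λ i j → T-≡ to from
    where
    to : ∀ {i j} → T (row2 i ∧ ᵀB.depF2 i j) → T (col2 j ∧ depF2 j i)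
    to {i} {j} t =
      let r , d = T-∧⁻ {row2 i} t
          ri , le = row2⁻ r
          dg , le' = ᵀB.depF2⁻ d
          e = edge-g (row-dep i ri) dg
      in T-∧⁺ (ᵀB.row2⁺ (row→col e ri) le') (depF2⁺ (Edge.f-dep e) le)
    from : ∀ {i j} → T (col2 j ∧ depF2 j i) → T (row2 i ∧ ᵀB.depF2 i j)
    from {i} {j} t =
      let c , d = T-∧⁻ {col2 j} t
          cj , le = ᵀB.row2⁻ c
          df , le' = depF2⁻ d
          e = edge-f (col-dep j cj) df
      in T-∧⁺ (row2⁺ (col→row e cj) le') (ᵀB.depF2⁺ (Edge.g-dep e) le)

  Toggle : Fin n → Fin n → Set
  Toggle i i' = ∀ x → F (flipAt x i) ≡ F (flipAt x i')

  -- Flipping entry `(i , j)` and flipping entry `(i' , j)` both negate `f j` and touch no other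
  -- column; they negate row `i` and row `i'` respectively.
  toggle-step : ∀ {i i' j} → E i j → E i' j → T (row i) → T (row i') → 2 ≤ deg (g i) → 2 ≤ deg (g i') → Toggle i i'
  toggle-step {i} {i'} {j} e e' t t' le le' x with i' FinP.≟ i
  ... | yes refl = refl
  ... | no ne = move-column (flipEntry z i j) (flipEntry z i' j) j
        (flipEntry-realises (base-realises x) (lin-g e t le 2≤f) (Edge.row-dep e))
        (flipEntry-realises (base-realises x) (lin-g e' t' le' 2≤f) (Edge.row-dep e'))
        (λ j' k j'≢j → trans (flipEntry-other z i j j' k j'≢j) (sym (flipEntry-other z i' j j' k j'≢j)))
        (trans (cong (f j) (flipEntry-column z i j)) (trans (lin-f e t le 2≤f (column z j))
          (sym (trans (cong (f j) (flipEntry-column z i' j)) (lin-f e' t' le' 2≤f (column z j))))))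
    where
    z = base x
    2≤f = two-rows⇒2≤ e e' ne

  f₀-flip-2 : ∀ {i} → T (row i) → 2 ≤ deg (g i) → ∀ x → f₀ (flipAt x i) ≡ opposite (f₀ x)
  f₀-flip-2 {i} t le x = trans (cong₂ _·_
      (trans (∏S-change row2 (lookup (flipAt x i)) (lookup x) i (row2⁺ t le) (λ k ne _ → lookup-flip′ x ne))
        (cong (_· ∏S row2 (lookup x)) (trans (cong (_· lookup x i) (lookup-flip x i)) (trans (opposite-*ˡ (lookup x i) (lookup x i)) (cong opposite (SignP.s*s≡+ (lookup x i)))))))
      (∏S-cong col2 λ j tj → Ψ-xsgn-agree (λ _ → Sign.+) {j} {flipAt x i} {x} (col-dep j (proj₁ (ᵀB.row2⁻ tj))) λ k _ eq →
        lookup-flip′ x {i} {k} λ { refl → 1≢2≤ eq le }))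
    (opposite-*ˡ (∏S row2 (lookup x)) _)

  module _ {i j} (e : E i j) (t : T (row i)) (leaf : deg (g i) ≡ 1) (x : Pt n) where
    private
      c : T (col j)
      c = row→col e t
      2≤f : 2 ≤ deg (f j)
      2≤f with deg-cases-f j (Edge.col-dep e)
      ... | inj₁ eq = ⊥-elim (no-leaf-edge e t leaf eq)
      ... | inj₂ le = le
      P Q R : Sign
      P = φ j (xsgn x)
      Q = φ j (xsgn (flipAt x i))
      z = base x
      R = ∏S (depF2 j) (lookup (column z j))
      z' = flipEntry z i j
      r' : Realises z' (flipAt x i)
      r' = flipEntry-realises (base-realises x) (leaf-linear e leaf) (Edge.row-dep e)
      fz : f j (column z j) ≡ P · R
      fz = trans (f-form j c (column z j)) (cong (_· R) (sym (Ψ-sgn (λ _ → Sign.+) (col-dep j c) (base-realises x))))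
      fz' : f j (column z' j) ≡ Q · R
      fz' = trans (f-form j c (column z' j)) (cong₂ _·_ (sym (Ψ-sgn (λ _ → Sign.+) (col-dep j c) r'))
        (∏S-cong (depF2 j) λ k tk → trans (cong (λ v → lookup v k) (flipEntry-column z i j))
          (lookup-flip′ (column z j) {i} {k} λ { refl → 1≢2≤ leaf (proj₂ (depF2⁻ tk)) })))
      rows-same : ∏S row2 (lookup (flipAt x i)) ≡ ∏S row2 (lookup x)
      rows-same = ∏S-cong row2 λ k tk → lookup-flip′ x {i} {k} λ { refl → 1≢2≤ leaf (proj₂ (row2⁻ tk)) }
      cols-other : ∀ j' → j' ≢ j → T (col2 j') → φ j' (xsgn (flipAt x i)) ≡ φ j' (xsgn x)
      cols-other j' ne t' = Ψ-xsgn-agree (λ _ → Sign.+) {j'} {flipAt x i} {x} dj' λ k d _ →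
        lookup-flip′ x {i} {k} λ { refl → ne (leaf-unique e (edge-f dj' d) leaf) }
        where dj' = col-dep j' (proj₁ (ᵀB.row2⁻ t'))
      cols-change : ∏S col2 (λ j' → φ j' (xsgn (flipAt x i))) ≡ Q · P · ∏S col2 (λ j' → φ j' (xsgn x))
      cols-change = ∏S-change col2 (λ j' → φ j' (xsgn (flipAt x i))) (λ j' → φ j' (xsgn x)) j (ᵀB.row2⁺ c 2≤f) cols-other
      f₀-change : f₀ (flipAt x i) ≡ Q · P · f₀ x
      f₀-change = trans (cong₂ _·_ rows-same cols-change) (x∙yz≈y∙xz (∏S row2 (lookup x)) (Q · P) _)

    -- The flip of a leaf reaches the columns only through `φ j`. If `φ j` keeps its value, no
    -- column changes; otherwise `f j` is negated, exactly as by flipping the row `i'` of degree at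
    -- least 2 in the same column.
    leaf-flip : ∀ {i'} → E i' j → T (row i') → 2 ≤ deg (g i') →
                (f₀ (flipAt x i) ≡ f₀ x × F (flipAt x i) ≡ F x) ⊎
                (f₀ (flipAt x i) ≡ opposite (f₀ x) × F (flipAt x i) ≡ F (flipAt x i'))
    leaf-flip {i'} e' t' le' with Q SignP.≟ P
    ... | yes eq = inj₁ (trans f₀-change (cong (_· f₀ x) (trans (cong (_· P) eq) (SignP.s*s≡+ P)))
        , move-column z' z j r' (base-realises x) (λ j' k → flipEntry-other z i j j' k)
            (trans fz' (trans (cong (_· R) eq) (sym fz))))
    ... | no ne = inj₂ (trans f₀-change (cong (_· f₀ x) (trans (cong (_· P) (≢⇒≡opposite ne)) (trans (opposite-*ˡ P P) (cong opposite (SignP.s*s≡+ P)))))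
        , move-column z' (flipEntry z i' j) j r' (flipEntry-realises (base-realises x) (lin-g e' t' le' 2≤f) (Edge.row-dep e'))
            (λ j' k j'≢j → trans (flipEntry-other z i j j' k j'≢j) (sym (flipEntry-other z i' j j' k j'≢j)))
            (trans fz' (trans (cong (_· R) (≢⇒≡opposite ne)) (trans (opposite-*ˡ P R) (sym (trans (cong (f j) (flipEntry-column z i' j))
              (trans (lin-f e' t' le' 2≤f (column z j)) (cong opposite fz))))))))

  -- Row i₀ absorbs every change: a flip in row i either preserves both f₀ and F, or has
  -- the same effect on both as the flip of row i₀.
  module Anchored (i₀ : Fin n) (t₀ : T (row i₀)) (le₀ : 2 ≤ deg (g i₀)) where

    toggles : ∀ {i} → T (row i) → 2 ≤ deg (g i) → Toggle i₀ i
    toggles {i} t le =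
      let j , dj = dependsOnSome (g i) (nonconst-g i (row-dep i t))
          e = edge-g (row-dep i t) dj
      in connected P closed i₀ i t₀ t start j i e e t le
      where
      P : Fin n → Set
      -- `Toggle` may fail for a leaf, so the invariant of `a` concerns the rows of degree at least
      -- 2 in its columns.
      P a = ∀ j i* → E a j → E i* j → T (row i*) → 2 ≤ deg (g i*) → Toggle i₀ i*
      start : P i₀
      start j i* e e* t* le* = toggle-step e e* t₀ t* le₀ le*
      closed : ∀ a b j → E a j → E b j → P a → P b
      closed a b j ea eb pa j' i* eb' e* t* le* with deg-cases b (Edge.row-dep eb)
      ... | inj₁ eq = pa j i* ea (subst (E i*) (leaf-unique eb eb' eq) e*) t* le*
      ... | inj₂ le = λ x → trans (pa j b ea eb tb le x) (toggle-step eb' e* tb t* le le* x)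
        where tb = col→row eb' (row→col e* t*)

    -- A path from one column to another passes through a row of degree at least 2, because a leaf
    -- meets only one column.
    nonleaf-neighbour : ∀ {i j} → E i j → T (row i) → ∃ λ i' → E i' j × 2 ≤ deg (g i')
    nonleaf-neighbour {i} {j} e t = connected P closed i₀ i t₀ t (λ j e → i₀ , e , le₀) j e
      where
      P : Fin n → Set
      P a = ∀ j → E a j → ∃ λ i' → E i' j × 2 ≤ deg (g i')
      closed : ∀ a b j → E a j → E b j → P a → P b
      closed a b j ea eb pa j' eb' with deg-cases b (Edge.row-dep eb)
      ... | inj₁ eq = subst (λ j → ∃ λ i' → E i' j × 2 ≤ deg (g i')) (sym (leaf-unique eb eb' eq)) (pa j ea)
      ... | inj₂ le = b , eb' , le

    flip-effect : ∀ {i} → T (row i) → ∀ x →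
                  (f₀ (flipAt x i) ≡ f₀ x × F (flipAt x i) ≡ F x) ⊎
                  (f₀ (flipAt x i) ≡ opposite (f₀ x) × F (flipAt x i) ≡ F (flipAt x i₀))
    flip-effect {i} t x with deg-cases i (row-dep i t)
    ... | inj₂ le = inj₂ (f₀-flip-2 t le x , sym (toggles t le x))
    ... | inj₁ eq with dependsOnSome (g i) (nonconst-g i (row-dep i t))
    ...   | j , dj with edge-g (row-dep i t) dj
    ...     | e with nonleaf-neighbour e t
    ...       | i' , e' , le' with leaf-flip e t eq x e' t' le'
      where t' = col→row e' (row→col e t)
    ...         | inj₁ p = inj₁ p
    ...         | inj₂ (p , q) = inj₂ (p , trans q (sym (toggles (col→row e' (row→col e t)) le' x)))

    -- Row `i₀` is used to bring `f₀` to the value `s`. By `flip-effect`, `F (normal s x)` then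
    -- depends on no row of the block, so equal `f₀` yields equal `F`.
    normal : Sign → Pt n → Pt n
    normal s x with f₀ x SignP.≟ s
    ... | yes _ = x
    ... | no _ = flipAt x i₀

    f₀-i₀ : ∀ x → f₀ (flipAt x i₀) ≡ opposite (f₀ x)
    f₀-i₀ = f₀-flip-2 t₀ le₀

    normal-flip : ∀ s {i} → T (row i) → ∀ x → F (normal s x) ≡ F (normal s (flipAt x i))
    normal-flip s {i} t x with f₀ x SignP.≟ s | f₀ (flipAt x i) SignP.≟ s
    ... | yes a | yes b = case flip-effect t x of λ
          { (inj₁ (_ , q)) → sym q
          ; (inj₂ (p , _)) → ⊥-elim (opp≢ (f₀ x) (trans (sym p) (trans b (sym a)))) }
    ... | no a | yes b = case flip-effect t x of λ
          { (inj₁ (p , _)) → ⊥-elim (a (trans (sym p) b))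
          ; (inj₂ (_ , q)) → sym q }
    ... | yes a | no b = case flip-effect t (flipAt x i) of λ
          { (inj₁ (p , _)) → ⊥-elim (b (trans (sym p) (trans (cong f₀ (flip-flip x i)) a)))
          ; (inj₂ (_ , q)) → trans (cong F (sym (flip-flip x i))) q }
    ... | no a | no b = case flip-effect t (flipAt x i₀) of λ
          { (inj₁ (_ , q)) → sym (trans (cong F (flip-comm x i i₀)) q)
          ; (inj₂ (p , _)) → ⊥-elim (opp≢ (f₀ (flipAt x i₀)) (trans (sym p) (trans (cong f₀ (flip-comm x i₀ i))
              (trans (f₀-i₀ (flipAt x i)) (trans (cong opposite (≢-≢⇒≡ b a)) (sym (f₀-i₀ x))))))) }

    normal-id : ∀ x s → f₀ x ≡ s → F (normal s x) ≡ F x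
    normal-id x s eq with f₀ x SignP.≟ s
    ... | yes _ = refl
    ... | no ne = ⊥-elim (ne eq)

    anchored-invariant : ∀ x x' → (∀ i → ¬ T (row i) → lookup x i ≡ lookup x' i) → f₀ x ≡ f₀ x' → F x ≡ F x'
    anchored-invariant x x' out eq = trans (sym (normal-id x (f₀ x) refl))
      (trans (agree-on-Dep (λ y → F (normal (f₀ x) y)) same) (normal-id x' (f₀ x) (sym eq)))
      where
      same : ∀ k → Dep (λ y → F (normal (f₀ x) y)) k → lookup x k ≡ lookup x' k
      same k (y , ne) with T? (row k)
      ... | yes t = ⊥-elim (ne (normal-flip (f₀ x) t y))
      ... | no nt = out k nt

  module Star (leaves : ∀ i → T (row i) → deg (g i) ≡ 1) where

    -- No leaf leads out of its column, so a connected block of leaves has a single column `j`, and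
    -- `f₀` reduces to the one factor `φ j`, the value of that column.
    one-column : ∀ {j j'} → T (col j) → T (col j') → j' ≡ j
    one-column {j} {j'} t t' =
      let i , di = dependsOnSome (f j) (nonconst-f j (col-dep j t))
          k , dk = dependsOnSome (f j') (nonconst-f j' (col-dep j' t'))
          e = edge-f (col-dep j t) di
          e' = edge-f (col-dep j' t') dk
      in connected (λ a → T (row a) → ∀ l → E a l → l ≡ j)
           (λ a b c ea eb h tb l el → trans (leaf-unique eb el (leaves b tb)) (h (col→row ea (row→col eb tb)) c ea))
           i k (col→row e t) (col→row e' t') (λ ti l el → leaf-unique e el (leaves i ti)) (col→row e' t') j' e'

    f-column : ∀ {j} → T (col j) → ∀ x → f j (column (base x) j) ≡ φ j (xsgn x)
    f-column {j} t x = trans (f-form j t (column (base x) j)) (trans (cong₂ _·_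
      (sym (Ψ-sgn (λ _ → Sign.+) (col-dep j t) (base-realises x)))
      (∏S-∅ (depF2 j) (lookup (column (base x) j)) λ i ti → let d , le = depF2⁻ ti in
        1≢2≤ (leaves i (col→row (edge-f (col-dep j t) d) t)) le)) (SignP.*-identityʳ _))

    col2-all : ∀ {j} → T (col j) → T (col2 j)
    col2-all {j} t with deg-cases-f j (col-dep j t)
    ... | inj₂ le = ᵀB.row2⁺ t le
    ... | inj₁ eq with dependsOnSome (f j) (nonconst-f j (col-dep j t))
    ...   | i , d = ⊥-elim (no-leaf-edge e (col→row e t) (leaves i (col→row e t)) eq)
      where e = edge-f (col-dep j t) d

    star-invariant : ∀ x x' → (∀ i → ¬ T (row i) → lookup x i ≡ lookup x' i) → f₀ x ≡ f₀ x' → F x ≡ F x'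
    star-invariant x x' out eq = move-block x x' (λ i _ → out i) λ j t →
      trans (f-column t x) (trans (same j t) (sym (f-column t x')))
      where
      rows-∅ : ∀ y → ∏S row2 (lookup y) ≡ Sign.+
      rows-∅ y = ∏S-∅ row2 (lookup y) λ i t → let ti , le = row2⁻ t in 1≢2≤ (leaves i ti) le
      V W : Fin m → Sign
      V j = φ j (xsgn x)
      W j = φ j (xsgn x')
      products : ∏S col2 V ≡ ∏S col2 W
      products = trans (cong (_· ∏S col2 V) (sym (rows-∅ x))) (trans eq (cong (_· ∏S col2 W) (rows-∅ x')))
      cancel : ∀ a b c → c ≡ a · b · c → a ≡ b
      cancel a b c h = trans (sym (SignP.*-identityʳ a)) (trans (cong (a ·_) (sym (SignP.s*s≡+ b)))
        (trans (sym (SignP.*-assoc a b b)) (cong (_· b) (SignP.*-cancelʳ-≡ c (a · b) Sign.+ (sym h)))))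
      same : ∀ j → T (col j) → V j ≡ W j
      same j t = cancel (V j) (W j) (∏S col2 W) (trans (sym products)
        (∏S-change col2 V W j (col2-all t) λ k ne tk → ⊥-elim (ne (one-column t (proj₁ (ᵀB.row2⁻ tk))))))

  f₀-invariant : ∀ x x' → (∀ i → Dep F i → ¬ T (row i) → lookup x i ≡ lookup x' i) → f₀ x ≡ f₀ x' → F x ≡ F x'
  f₀-invariant = invariant f₀ f₀-dep cases
    where
    cases : ∀ x x' → (∀ i → ¬ T (row i) → lookup x i ≡ lookup x' i) → f₀ x ≡ f₀ x' → F x ≡ F x'
    cases with FinP.any? (λ i → T? (row i) ×-dec (2 ℕP.≤? deg (g i)))
    ... | yes (i₀ , t₀ , le₀) = Anchored.anchored-invariant i₀ t₀ le₀
    ... | no none = Star.star-invariant λ i t → leaf i t (deg-cases i (row-dep i t))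
      where
      leaf : ∀ i → T (row i) → deg (g i) ≡ 1 ⊎ 2 ≤ deg (g i) → deg (g i) ≡ 1
      leaf i t (inj₁ eq) = eq
      leaf i t (inj₂ le) = ⊥-elim (none (i , t , le))

module LinearMatch {n m : ℕ} {F : BF n} {f : Fin m → BF n} {G : BF m} {g : Fin n → BF m} (S : Sys F f G g)
                   {row : Fin n → Bool} {col : Fin m → Bool} (bl : IsBlock S row col)
                   (dat : LinearData bl) where

  open IsBlock bl
  module L = LinearBlock S bl dat
  module ᵀL = LinearBlock (swap S) (swapBlock bl) (swapLinear dat)

  match : ∀ z → L.f₀ (apply g z) ≡ ᵀL.f₀ (apply f (column z))
  match z = trans (L.f₀-apply z) (trans (lem (∏S row2 λ i → γ i (z i)) _ (∏S col2 λ j → φ j (column z j)))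
    (sym (trans (ᵀL.f₀-apply (column z)) (cong₂ _·_ (cong (∏S col2 (λ j → φ j (column z j)) ·_) entries)
      (∏S-cong row2 λ i _ → cong (γ i) (column-column z i))))))
    where
    row2 = BlockBasics.row2 S bl
    col2 = L.col2
    γ = L.γ
    φ = ᵀL.γ
    lem : ∀ a b c → a · b · c ≡ c · b · a
    lem a b c = trans (cong (_· c) (SignP.*-comm a b)) (trans (SignP.*-comm (b · a) c) (sym (SignP.*-assoc c b a)))
    entries : ∏S col2 (λ j → ∏S (BlockBasics.depF2 S bl j) (lookup (column z j))) ≡
              ∏S row2 (λ i → ∏S (BlockBasics.depF2 (swap S) (swapBlock bl) i) (lookup (z i)))
    entries = trans (∏S-cong col2 λ j _ → ∏S-cong (BlockBasics.depF2 S bl j) λ i _ → lookup-column z j i)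
                (sym (L.entries-swap λ i j → lookup (z i) j))

-- Threshold blocks

≡-choose : ∀ {v s b} → (T b → v ≡ s) → (v ≡ s → T b) → v ≡ choose b s
≡-choose {b = true} h k = h tt
≡-choose {b = false} h k = ≢⇒≡opposite k

choose-≢ : ∀ {b s} → ¬ T b → choose b s ≡ opposite s
choose-≢ {true} nt = ⊥-elim (nt tt)
choose-≢ {false} nt = refl

choose-on : ∀ {b s} → T b → choose b s ≡ s
choose-on {true} t = refl

choose-+-injective : ∀ {a b} → choose a Sign.+ ≡ choose b Sign.+ → T a → T b
choose-+-injective {true} {true} e t = tt
choose-+-injective {true} {false} () t

-- κ belongs to an edge, `D` and `B` to a vertex. `row-of` supplies a row that can be switched off
-- when the leaves alone turn column `j` off; `col-of` is its transpose.
record ThresholdData {F : BF n} {f : Fin m → BF n} {G : BF m} {g : Fin n → BF m} {S : Sys F f G g}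
                     {row : Fin n → Bool} {col : Fin m → Bool} (bl : IsBlock S row col) : Set where
  open Moves S using (E)
  field
    κ : Fin n → Fin m → Sign
    D : Fin n → Sign
    B : Fin m → Sign
    g-off : ∀ {i j} → E i j → T (row i) → 2 ≤ deg (g i) → 2 ≤ deg (f j) →
            ∀ y → lookup y j ≡ opposite (κ i j) → g i y ≡ opposite (D i)
    f-off : ∀ {i j} → E i j → T (row i) → 2 ≤ deg (g i) → 2 ≤ deg (f j) →
            ∀ x → lookup x i ≡ opposite (κ i j) → f j x ≡ opposite (B j)
    nonlinear-g : ∀ {i j} → E i j → T (row i) → 2 ≤ deg (g i) → 2 ≤ deg (f j) → ¬ LinearAt (g i) j
    nonlinear-f : ∀ {i j} → E i j → T (row i) → 2 ≤ deg (g i) → 2 ≤ deg (f j) → ¬ LinearAt (f j) i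
    row-of : ∀ j → T (col j) → 2 ≤ deg (f j) → ∃ λ i → E i j × 2 ≤ deg (g i)
    col-of : ∀ i → T (row i) → 2 ≤ deg (g i) → ∃ λ j → E i j × 2 ≤ deg (f j)
    no-leaf-edge : ∀ {i j} → E i j → T (row i) → deg (g i) ≡ 1 → deg (f j) ≢ 1

swapThreshold : {F : BF n} {f : Fin m → BF n} {G : BF m} {g : Fin n → BF m} {S : Sys F f G g}
                {row : Fin n → Bool} {col : Fin m → Bool} {bl : IsBlock S row col} →
                ThresholdData bl → ThresholdData (swapBlock bl)
swapThreshold {bl = bl} dat = record
  { κ = λ j i → κ i j ; D = B ; B = D
  ; g-off = λ e t le le' → f-off (flipEdge e) (col→row (flipEdge e) t) le' le
  ; f-off = λ e t le le' → g-off (flipEdge e) (col→row (flipEdge e) t) le' le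
  ; nonlinear-g = λ e t le le' → nonlinear-f (flipEdge e) (col→row (flipEdge e) t) le' le
  ; nonlinear-f = λ e t le le' → nonlinear-g (flipEdge e) (col→row (flipEdge e) t) le' le
  ; row-of = λ i t le → let j , e , le' = col-of i t le in j , flipEdge e , le'
  ; col-of = λ j t le → let i , e , le' = row-of j t le in i , flipEdge e , le'
  ; no-leaf-edge = λ e t eq eq' → no-leaf-edge (flipEdge e) (col→row (flipEdge e) t) eq' eq }
  where
  open IsBlock bl
  open ThresholdData dat

module ThresholdForm {n m : ℕ} {F : BF n} {f : Fin m → BF n} {G : BF m} {g : Fin n → BF m} (S : Sys F f G g)
                     {row : Fin n → Bool} {col : Fin m → Bool} (bl : IsBlock S row col)
                     (dat : ThresholdData bl) where

  open Moves S
  open Edges S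
  open IsBlock bl
  open BlockBasics S bl
  open ThresholdData dat

  -- With the neighbours of degree at least 2 at κ, the only entries that leave `B j` possible, it
  -- remains to test whether the leaves admit that value.
  φ~ : Fin m → Pt n → Bool
  φ~ j x = Ψ (λ i → κ i j) j x == B j

  matches : Fin m → Pt n → Bool
  matches j x = allᵇ (depF2 j) (λ i → κ i j == lookup x i)

  fill-matching : ∀ j x → T (matches j x) → fill (depF2 j) (λ i → κ i j) x ≡ x
  fill-matching j x t = lookup-ext lem
    where
    lem : ∀ i → lookup (fill (depF2 j) (λ i → κ i j) x) i ≡ lookup x i
    lem i with T? (depF2 j i)
    ... | yes ti = trans (lookup-fill (depF2 j) (λ i → κ i j) x i ti) (==⇒≡ (κ i j) (lookup x i) (allᵇ⁻ (depF2 j) _ t i ti))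
    ... | no nt = lookup-fill′ (depF2 j) (λ i → κ i j) x i nt

  f-on⇒matches : ∀ {j} → T (col j) → 2 ≤ deg (f j) → ∀ x → f j x ≡ B j → T (matches j x)
  f-on⇒matches {j} t le x eq = allᵇ⁺ (depF2 j) _ λ i ti →
    let d , le' = depF2⁻ ti
        e = edge-f (col-dep j t) d
    in ≡⇒== (κ i j) (lookup x i) (decidable-stable (κ i j SignP.≟ lookup x i) λ ne →
         opp≢ (B j) (trans (sym (f-off e (col→row e t) le' le x (≢⇒≡opposite (ne ∘ sym)))) eq))

  -- By `f-off` the value `B j` forces the matching of all entries with κ, and then filling them
  -- with κ changes nothing.
  f-form : ∀ {j} → T (col j) → 2 ≤ deg (f j) → ∀ x → f j x ≡ choose (φ~ j x ∧ matches j x) (B j)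
  f-form {j} t le x = ≡-choose
    (λ h → let p , q = T-∧⁻ {φ~ j x} h in trans (cong (f j) (sym (fill-matching j x q))) (==⇒≡ _ (B j) p))
    (λ eq → let q = f-on⇒matches t le x eq in
      T-∧⁺ (≡⇒== _ (B j) (trans (cong (f j) (fill-matching j x q)) eq)) q)

  φ~-dep : ∀ {j} → Dep G j → ∀ i → Dep (φ~ j) i → Dep (f j) i × deg (g i) ≡ 1
  φ~-dep {j} dG i (x , ne) = Ψ-dep (λ i → κ i j) dG i (x , λ eq → ne (cong (_== B j) eq))

module ThresholdBlock {n m : ℕ} {F : BF n} {f : Fin m → BF n} {G : BF m} {g : Fin n → BF m} (S : Sys F f G g)
                      {row : Fin n → Bool} {col : Fin m → Bool} (bl : IsBlock S row col)
                      (dat : ThresholdData bl) where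

  open Sys S
  open Moves S
  open Edges S
  open Degrees S
  open Types S hiding (nonlinear-f)
  open IsBlock bl
  open BlockBasics S bl
  open ThresholdData dat
  open ThresholdForm S bl dat

  private
    module ᵀB = BlockBasics (swap S) (swapBlock bl)

  col2 : Fin m → Bool
  col2 = ᵀB.row2

  rows-on cols-on on : Pt n → Bool
  rows-on x = allᵇ row2 (λ i → D i == lookup x i)
  cols-on x = allᵇ col2 (λ j → φ~ j (xsgn x))
  on x = rows-on x ∧ cols-on x

  f₀ : BF n
  f₀ x = choose (on x) Sign.+

  on-agree : ∀ {x x'} → (∀ i → T (row i) → lookup x i ≡ lookup x' i) → T (on x) → T (on x')
  on-agree {x} {x'} h t = let a , b = T-∧⁻ {rows-on x} t in T-∧⁺
    (allᵇ⁺ row2 _ λ i ti → subst (λ s → T (D i == s)) (h i (proj₁ (row2⁻ ti))) (allᵇ⁻ row2 _ a i ti))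
    (allᵇ⁺ col2 _ λ j tj → let cj = proj₁ (ᵀB.row2⁻ tj) in
      subst (λ s → T (s == B j)) (Ψ-xsgn-agree (λ i → κ i j) {j} {x} {x'} (col-dep j cj) λ k d _ →
        h k (col→row (edge-f (col-dep j cj) d) cj)) (allᵇ⁻ col2 _ b j tj))

  f₀-dep : ∀ i → Dep f₀ i → T (row i)
  f₀-dep i (x , ne) with T? (row i)
  ... | yes t = t
  ... | no nt = ⊥-elim (ne (cong (λ b → choose b Sign.+) (T-≡ (on-agree {x} {flipAt x i} λ k tk → sym (h k tk)) (on-agree {flipAt x i} {x} h))))
    where
    h : ∀ k → T (row k) → lookup (flipAt x i) k ≡ lookup x k
    h k tk = lookup-flip′ x λ { refl → nt tk }

  on-entry : ∀ {z x} → Realises z x → T (on x) → ∀ {i j} → E i j → T (row i) → 2 ≤ deg (g i) → 2 ≤ deg (f j) →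
             lookup (z i) j ≡ κ i j
  on-entry {z} {x} r t {i} {j} e ti le le' = decidable-stable (lookup (z i) j SignP.≟ κ i j) λ ne →
    opp≢ (D i) (trans (sym (g-off e ti le le' (z i) (≢⇒≡opposite ne)))
      (trans (Realises.value r i (Edge.row-dep e))
        (sym (==⇒≡ (D i) (lookup x i) (allᵇ⁻ row2 _ (proj₁ (T-∧⁻ {rows-on x} t)) i (row2⁺ ti le))))))

  on-matches : ∀ {z x} → Realises z x → T (on x) → ∀ {j} → T (col j) → 2 ≤ deg (f j) → T (matches j (column z j))
  on-matches {z} r t {j} tj le = allᵇ⁺ (depF2 j) _ λ i ti →
    let d , le' = depF2⁻ ti
        e = edge-f (col-dep j tj) d
    in ≡⇒== (κ i j) _ (sym (trans (lookup-column z j i) (on-entry r t e (col→row e tj) le' le)))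

  on-φ : ∀ {z x} → Realises z x → T (on x) → ∀ {j} → T (col j) → 2 ≤ deg (f j) → T (φ~ j (column z j))
  on-φ {z} {x} r t {j} tj le = subst (λ s → T (s == B j)) (Ψ-sgn (λ i → κ i j) (col-dep j tj) r)
    (allᵇ⁻ col2 _ (proj₂ (T-∧⁻ {rows-on x} t)) j (ᵀB.row2⁺ tj le))

  -- Rows at `D` force their entries to κ, and `cols-on` takes care of the leaves. Thus all `on`
  -- points give a column of degree at least 2 the same value.
  on-column : ∀ {z x} → Realises z x → T (on x) → ∀ {j} → T (col j) → 2 ≤ deg (f j) → f j (column z j) ≡ B j
  on-column {z} r t {j} tj le = trans (f-form tj le (column z j))
    (choose-on (T-∧⁺ (on-φ {z} r t tj le) (on-matches r t tj le)))

  RowFree : Fin n → Fin n → Set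
  RowFree i k = ∀ x x' → lookup x i ≡ opposite (D i) → (∀ l → l ≢ k → lookup x l ≡ lookup x' l) → F x ≡ F x'

  -- `g i` is not odd at `j`, so it has an insensitive point, whose value must be `opposite (D i)`;
  -- `insensitive-row` applies at this value.
  row-free-step : ∀ {i k j} → E i j → E k j → k ≢ i → T (row i) → 2 ≤ deg (g i) → RowFree i k
  row-free-step {i} {k} {j} e e' ne t le x x' xi out with ¬LinearAt⇒ (g i) j (nonlinear-g e t le (two-rows⇒2≤ e e' ne))
  ... | a , ins = insensitive-row e e' ne a ins
        (trans xi (sym (off-insensitive (g i) (g-off e t le (two-rows⇒2≤ e e' ne)) a ins))) out

  -- While row `i` is off, row `k` may be switched off for free, and `F` then ignores row `l`;
  -- afterwards `k` is restored.
  row-free-trans : ∀ {i k l} → k ≢ i → l ≢ i → l ≢ k → RowFree i k → RowFree k l → RowFree i l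
  row-free-trans {i} {k} {l} k≢i l≢i l≢k r s x x' xi out =
    trans (r x (x [ k ]≔ opposite (D k)) xi λ h ne → sym (lookup∘update′ ne x _))
      (trans (s (x [ k ]≔ opposite (D k)) (x' [ k ]≔ opposite (D k)) (lookup∘update k x _) mid)
        (sym (r x' (x' [ k ]≔ opposite (D k)) (trans (sym (out i (l≢i ∘ sym))) xi) λ h ne → sym (lookup∘update′ ne x' _))))
    where
    mid : ∀ h → h ≢ l → lookup (x [ k ]≔ opposite (D k)) h ≡ lookup (x' [ k ]≔ opposite (D k)) h
    mid h ne with h FinP.≟ k
    ... | yes refl = trans (lookup∘update k x _) (sym (lookup∘update k x' _))
    ... | no h≢k = trans (lookup∘update′ h≢k x _) (trans (out h ne) (sym (lookup∘update′ h≢k x' _)))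

  module _ {i : Fin n} (t : T (row i)) (le : 2 ≤ deg (g i)) where

    row-free : ∀ k → T (row k) → k ≢ i → RowFree i k
    row-free k tk ne =
      let j , dj = dependsOnSome (g k) (nonconst-g k (row-dep k tk))
          e = edge-g (row-dep k tk) dj
      in connected P closed i k t tk start j k e e tk ne
      where
      P : Fin n → Set
      P a = ∀ j k → E a j → E k j → T (row k) → k ≢ i → RowFree i k
      start : P i
      start j k e e' _ ne = row-free-step e e' ne t le
      closed : ∀ a b j → E a j → E b j → P a → P b
      closed a b j ea eb pa j' k eb' ek tk ne with b FinP.≟ i | k FinP.≟ b
      ... | yes refl | _ = row-free-step eb' ek ne t le
      ... | no b≢i | yes refl = pa j b ea eb tk ne
      ... | no b≢i | no k≢b = case deg-cases b (Edge.row-dep eb) of λ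
            -- A leaf `b` offers no column other than the one it shares with `a`; a row of degree at
            -- least 2 is used as the intermediate row of `row-free-trans`.
            { (inj₁ eq) → pa j k ea (subst (E k) (leaf-unique eb eb' eq) ek) tk ne
            ; (inj₂ le') → let tb = col→row eb' (row→col ek tk) in
                row-free-trans b≢i ne k≢b (pa j b ea eb tb b≢i) (row-free-step eb' ek k≢b tb le') }

    off-constant : ∀ x x' → lookup x i ≡ opposite (D i) → lookup x' i ≡ opposite (D i) →
                   (∀ k → ¬ T (row k) → lookup x k ≡ lookup x' k) → F x ≡ F x'
    -- `F ∘ pin` depends on no row of the block: row `i` is overwritten, and the others are free
    -- once it is off.
    off-constant x x' xi x'i out = trans (cong F (sym (pin≡ x xi))) (trans (agree-on-Dep (F ∘ pin) same) (cong F (pin≡ x' x'i)))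
      where
      pin : Pt n → Pt n
      pin y = y [ i ]≔ opposite (D i)
      pin≡ : ∀ y → lookup y i ≡ opposite (D i) → pin y ≡ y
      pin≡ y yi = lookup-ext lem
        where
        lem : ∀ k → lookup (pin y) k ≡ lookup y k
        lem k with k FinP.≟ i
        ... | yes refl = trans (lookup∘update i y _) (sym yi)
        ... | no ne = lookup∘update′ ne y _
      pin-i : ∀ y → pin y ≡ pin (flipAt y i)
      pin-i y = lookup-ext lem
        where
        lem : ∀ k → lookup (pin y) k ≡ lookup (pin (flipAt y i)) k
        lem k with k FinP.≟ i
        ... | yes refl = trans (lookup∘update i y _) (sym (lookup∘update i (flipAt y i) _))
        ... | no ne = trans (lookup∘update′ ne y _) (sym (trans (lookup∘update′ ne (flipAt y i) _) (lookup-flip′ y ne)))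
      pin-off : ∀ y k l → l ≢ k → lookup (pin y) l ≡ lookup (pin (flipAt y k)) l
      pin-off y k l l≢k with l FinP.≟ i
      ... | yes refl = trans (lookup∘update i y _) (sym (lookup∘update i (flipAt y k) _))
      ... | no ne = trans (lookup∘update′ ne y _) (sym (trans (lookup∘update′ ne (flipAt y k) _) (lookup-flip′ y l≢k)))
      same : ∀ k → Dep (F ∘ pin) k → lookup x k ≡ lookup x' k
      same k (y , ne) with T? (row k)
      ... | no nt = out k nt
      ... | yes tk with k FinP.≟ i
      ...   | yes refl = ⊥-elim (ne (cong F (pin-i y)))
      ...   | no k≢i = ⊥-elim (ne (row-free k tk k≢i (pin y) (pin (flipAt y k)) (lookup∘update i y _) (pin-off y k)))

  -- Passes through a point at which both rows `i` and `i'` are off.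
  off-constant₂ : ∀ {i i'} → T (row i) → 2 ≤ deg (g i) → T (row i') → 2 ≤ deg (g i') →
                  ∀ x x' → lookup x i ≡ opposite (D i) → lookup x' i' ≡ opposite (D i') →
                  (∀ k → ¬ T (row k) → lookup x k ≡ lookup x' k) → F x ≡ F x'
  off-constant₂ {i} {i'} t le t' le' x x' xi x'i' out =
    trans (off-constant t le x y xi yi λ k nt → sym (lookup∘update′ (λ { refl → nt t' }) x _))
      (off-constant t' le' y x' (lookup∘update i' x _) x'i'
        λ k nt → trans (lookup∘update′ (λ { refl → nt t' }) x _) (out k nt))
    where
    y = x [ i' ]≔ opposite (D i')
    yi : lookup y i ≡ opposite (D i)
    yi with i FinP.≟ i'
    ... | yes refl = lookup∘update i' x _
    ... | no ne = trans (lookup∘update′ ne x _) xi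

  -- `x` may fail to be `on` through its leaves only; `x°` has the same `F` and a row of degree at
  -- least 2 that is off.
  record OffPoint (x : Pt n) : Set where
    field
      i : Fin n
      in-row : T (row i)
      2≤ : 2 ≤ deg (g i)
      x° : Pt n
      off : lookup x° i ≡ opposite (D i)
      same-F : F x ≡ F x°
      outside : ∀ k → ¬ T (row k) → lookup x k ≡ lookup x° k

  -- The column j is off because of its leaves, so entry (i , j) can be flipped without
  -- changing f_j, which turns row i off.
  off-column : ∀ x j → T (col j) → 2 ≤ deg (f j) → ¬ T (φ~ j (xsgn x)) →
               ∀ i → E i j → 2 ≤ deg (g i) → lookup x i ≡ D i → OffPoint x
  off-column x j tj le nφ i e le' xi = record
    { i = i ; in-row = ti ; 2≤ = le' ; x° = flipAt x i
    ; off = trans (lookup-flip x i) (cong opposite xi)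
    ; same-F = move-column z z' j (base-realises x) r' (λ j' k ne → sym (flipEntry-other z i j j' k ne))
        (trans (off-value z ψ) (sym (off-value z' (trans ψ' ψ))))
    ; outside = λ k nt → sym (lookup-flip′ x λ { refl → nt ti }) }
    where
    ti = col→row e tj
    z = base x
    z' = flipEntry z i j
    ψ : Ψ (λ i → κ i j) j (column z j) ≡ Ψ (λ i → κ i j) j (xsgn x)
    ψ = sym (Ψ-sgn (λ i → κ i j) (col-dep j tj) (base-realises x))
    ψ' : Ψ (λ i → κ i j) j (column z' j) ≡ Ψ (λ i → κ i j) j (column z j)
    ψ' = cong (f j) (lookup-ext {u = fill (depF2 j) (λ i → κ i j) (column z' j)} {fill (depF2 j) (λ i → κ i j) (column z j)} λ k →
      fill-agree (depF2 j) (λ i → κ i j) {column z' j} {column z j} k λ nt →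
        trans (lookup-column z' j k) (trans (flipEntry-off z i j k λ { refl → nt (depF2⁺ (Edge.f-dep e) le') }) (sym (lookup-column z j k))))
    off-value : ∀ w → Ψ (λ i → κ i j) j (column w j) ≡ Ψ (λ i → κ i j) j (xsgn x) → f j (column w j) ≡ opposite (B j)
    off-value w eq = trans (f-form tj le (column w j)) (choose-≢ λ h →
      nφ (subst (λ s → T (s == B j)) eq (proj₁ (T-∧⁻ {φ~ j (column w j)} h))))
    gz : g i (z i) ≡ D i
    gz = trans (Realises.value (base-realises x) i (Edge.row-dep e)) xi
    zij : lookup (z i) j ≡ κ i j
    zij = decidable-stable (lookup (z i) j SignP.≟ κ i j) λ ne →
      opp≢ (D i) (trans (sym (g-off e ti le' le (z i) (≢⇒≡opposite ne))) gz)
    r' : Realises z' (flipAt x i)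
    r' = put-realises i (flipAt (z i) j) (base-realises x)
      (trans (g-off e ti le' le (flipAt (z i) j) (trans (lookup-flip (z i) j) (cong opposite zij)))
        (sym (trans (lookup-flip x i) (cong opposite xi))))
      λ k ne → sym (lookup-flip′ x ne)

  off-point : ∀ x → ¬ T (on x) → OffPoint x
  off-point x noff with FinP.any? (λ i → T? (row2 i) ×-dec ¬? (lookup x i SignP.≟ D i))
  ... | yes (i , t , ne) = record { i = i ; in-row = proj₁ (row2⁻ t) ; 2≤ = proj₂ (row2⁻ t) ; x° = x
                                  ; off = ≢⇒≡opposite ne ; same-F = refl ; outside = λ _ _ → refl }
  ... | no none with FinP.any? (λ j → T? (col2 j) ×-dec ¬? (T? (φ~ j (xsgn x))))
  ...   | yes (j , t , nφ) =
            let tj , le = ᵀB.row2⁻ t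
                i , e , le' = row-of j tj le
            in off-column x j tj le nφ i e le' (decidable-stable (lookup x i SignP.≟ D i) λ ne →
                 none (i , row2⁺ (col→row e tj) le' , ne))
  ...   | no none' = ⊥-elim (noff (T-∧⁺
            (allᵇ⁺ row2 _ λ i t → ≡⇒== (D i) (lookup x i) (sym (decidable-stable (lookup x i SignP.≟ D i) λ ne → none (i , t , ne))))
            (allᵇ⁺ col2 _ λ j t → decidable-stable (T? (φ~ j (xsgn x))) λ nφ → none' (j , t , nφ))))

  on-invariant : ∀ x x' → (∀ i → ¬ T (row i) → lookup x i ≡ lookup x' i) → T (on x) → T (on x') → F x ≡ F x'
  on-invariant x x' out t t' = move-block x x' (λ i _ → out i) same
    where
    x-on : ∀ {y i} → T (on y) → T (row i) → 2 ≤ deg (g i) → D i ≡ lookup y i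
    x-on {y} {i} h ti le = ==⇒≡ (D i) (lookup y i) (allᵇ⁻ row2 _ (proj₁ (T-∧⁻ {rows-on y} h)) i (row2⁺ ti le))
    same : ∀ j → T (col j) → f j (column (base x) j) ≡ f j (column (base x') j)
    same j tj with deg-cases-f j (col-dep j tj)
    ... | inj₂ le = trans (on-column (base-realises x) t tj le) (sym (on-column (base-realises x') t' tj le))
    -- A leaf column meets only rows of degree at least 2, and these have the value `D` at both
    -- points.
    ... | inj₁ eq = column-agree {base x} {base x'} j λ k dk →
          let e = edge-f (col-dep j tj) dk
              tk = col→row e tj
          in cong (λ s → lookup (preimage k s) j) (case deg-cases k (row-dep k tk) of λ
               { (inj₁ eq') → ⊥-elim (no-leaf-edge e tk eq' eq)
               ; (inj₂ le) → trans (sym (x-on {x} t tk le)) (x-on {x'} t' tk le) })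

  f₀-invariant : ∀ x x' → (∀ i → Dep F i → ¬ T (row i) → lookup x i ≡ lookup x' i) → f₀ x ≡ f₀ x' → F x ≡ F x'
  f₀-invariant = invariant f₀ f₀-dep cases
    where
    cases : ∀ x x' → (∀ i → ¬ T (row i) → lookup x i ≡ lookup x' i) → f₀ x ≡ f₀ x' → F x ≡ F x'
    cases x x' out eq with T? (on x) | T? (on x')
    ... | yes t | yes t' = on-invariant x x' out t t'
    ... | yes t | no nt = ⊥-elim (nt (choose-+-injective eq t))
    ... | no nt | yes t' = ⊥-elim (nt (choose-+-injective (sym eq) t'))
    ... | no nt | no nt' = both (off-point x nt) (off-point x' nt')
      where
      both : OffPoint x → OffPoint x' → F x ≡ F x'
      both O O' = trans O.same-F (trans (off-constant₂ O.in-row O.2≤ O'.in-row O'.2≤ O.x° O'.x° O.off O'.off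
          λ k nt → trans (sym (O.outside k nt)) (trans (out k nt) (O'.outside k nt))) (sym O'.same-F))
        where
        module O = OffPoint O
        module O' = OffPoint O'

module ThresholdHalf {n m : ℕ} {F : BF n} {f : Fin m → BF n} {G : BF m} {g : Fin n → BF m} (S : Sys F f G g)
                     {row : Fin n → Bool} {col : Fin m → Bool} (bl : IsBlock S row col)
                     (dat : ThresholdData bl) where

  open IsBlock bl
  open ThresholdData dat
  module L = ThresholdBlock S bl dat
  module ᵀL = ThresholdBlock (swap S) (swapBlock bl) (swapThreshold dat)

  private
    module ᵀF = ThresholdForm (swap S) (swapBlock bl) (swapThreshold dat)

    self : ∀ z → Moves.Realises S z (apply g z)
    self z = Moves.realises λ i _ → sym (lookup-apply g z i)
    selfᵀ : ∀ z → Moves.Realises (swap S) (column z) (apply f (column z))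
    selfᵀ z = Moves.realises λ j _ → sym (lookup-apply f (column z) j)

  -- For a matrix with `on` row values, the columns of degree at least 2 have value `B` by
  -- `on-column`, and a row with `g i` at `D i` satisfies its γ~ by `f-form`. The converse is this
  -- statement for the transposed system.
  on-transpose : ∀ z → T (L.on (apply g z)) → T (ᵀL.on (apply f (column z)))
  on-transpose z t = T-∧⁺
    (allᵇ⁺ L.col2 _ λ j tj → let cj , le = BlockBasics.row2⁻ (swap S) (swapBlock bl) tj in
      ≡⇒== (B j) _ (sym (trans (lookup-apply f (column z) j) (L.on-column (self z) t cj le))))
    (allᵇ⁺ (BlockBasics.row2 S bl) _ λ i ti → let ri , le = BlockBasics.row2⁻ S bl ti in
      subst (λ s → T (s == D i)) (sym (trans (BlockBasics.Ψ-sgn (swap S) (swapBlock bl) (κ i) (row-dep i ri) (selfᵀ z)) (cong (ᵀB.Ψ (κ i) i) (column-column z i)))) (γ-on i ri le))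
    where
    module ᵀB = BlockBasics (swap S) (swapBlock bl)
    γ-on : ∀ i → T (row i) → 2 ≤ deg (g i) → T (ᵀF.φ~ i (z i))
    γ-on i ri le = proj₁ (T-∧⁻ {ᵀF.φ~ i (z i)} (on⇒ (ᵀF.f-form ri le (z i)) gi))
      where
      gi : g i (z i) ≡ D i
      gi = trans (sym (lookup-apply g z i)) (sym (==⇒≡ (D i) _ (allᵇ⁻ (BlockBasics.row2 S bl) _
             (proj₁ (T-∧⁻ {L.rows-on (apply g z)} t)) i (BlockBasics.row2⁺ S bl ri le))))
      on⇒ : ∀ {v b s} → v ≡ choose b s → v ≡ s → T b
      on⇒ {b = true} _ _ = tt
      on⇒ {b = false} {s} e e' = ⊥-elim (opp≢ s (trans (sym e) e'))

module ThresholdMatch {n m : ℕ} {F : BF n} {f : Fin m → BF n} {G : BF m} {g : Fin n → BF m} (S : Sys F f G g)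
                      {row : Fin n → Bool} {col : Fin m → Bool} (bl : IsBlock S row col)
                      (dat : ThresholdData bl) where

  open ThresholdHalf S bl dat

  match : ∀ z → L.f₀ (apply g z) ≡ ᵀL.f₀ (apply f (column z))
  match z = cong (λ b → choose b Sign.+) (T-≡ (on-transpose z) from)
    where
    from : T (ᵀL.on (apply f (column z))) → T (L.on (apply g z))
    from t = subst (λ x → T (L.on x)) (tabulate-cong λ i → cong (g i) (column-column z i))
      (ThresholdHalf.on-transpose (swap S) (swapBlock bl) (swapThreshold dat) (column z) t)

-- Classification of the blocks

threshold-ℚ : (p : Fin n → Bool) (κ : Fin n → Sign) (s : Sign) (b : Bool) (x : Pt n) →
              toℚ (choose (b ∧ allᵇ p (λ i → κ i == lookup x i)) s) ≡
              b01 b ℚ.* (twoℚ ℚ.* toℚ s ℚ.* ∏Q p (λ i → (toℚ (κ i) ℚ.* toℚ (lookup x i) ℚ.+ 1ℚ) ℚ.* ½)) ℚ.- toℚ s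
threshold-ℚ p κ s b x = trans (toℚ-choose b (allᵇ p (λ i → κ i == lookup x i)) s)
  (cong (λ q → b01 b ℚ.* (twoℚ ℚ.* toℚ s ℚ.* q) ℚ.- toℚ s)
    (sym (∏Q≡b01 p _ (λ i → κ i == lookup x i) λ i → half-match (κ i) (lookup x i))))

on-ℚ : (p : Fin n → Bool) (D : Fin n → Sign) (q : Fin m → Bool) (w : Fin m → Bool) (x : Pt n) →
       toℚ (choose (allᵇ p (λ i → D i == lookup x i) ∧ allᵇ q w) Sign.+) ≡
       twoℚ ℚ.* ∏Q p (λ i → (toℚ (D i) ℚ.* toℚ (lookup x i) ℚ.+ 1ℚ) ℚ.* ½) ℚ.* ∏Q q (λ j → b01 (w j)) ℚ.- 1ℚ
on-ℚ p D q w x = trans (toℚ-choose-+ (allᵇ p (λ i → D i == lookup x i)) (allᵇ q w))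
  (cong₂ (λ a b → twoℚ ℚ.* a ℚ.* b ℚ.- 1ℚ)
    (sym (∏Q≡b01 p _ (λ i → D i == lookup x i) λ i → half-match (D i) (lookup x i)))
    (sym (∏Q≡b01 q _ w λ _ → refl)))

-- Spreading of the alternative within a component

module Propagation {n m : ℕ} {F : BF n} {f : Fin m → BF n} {G : BF m} {g : Fin n → BF m} (S : Sys F f G g) where

  open Moves S
  open Edges S
  open Degrees S
  open Types S

  linear-f : ∀ {i j} → E i j → 2 ≤ deg (g i) → LinearAt (g i) j → LinearAt (f j) i
  linear-f {i} {j} e le lin = decidable-stable (linearAt? (f j) i) λ nl →
    Types.nonlinear-f (swap S) (flipEdge e) le nl lin

  -- With entry `j` at `opposite κ` the function `g i` is constant in all other entries, so it
  -- cannot be odd in any of them.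
  nonlinear-row : ∀ {i j j'} → E i j → 2 ≤ deg (g i) → 2 ≤ deg (f j) → ¬ LinearAt (g i) j → ¬ LinearAt (g i) j'
  nonlinear-row {i} {j} {j'} e le le' nl lin with j' FinP.≟ j
  ... | yes refl = nl lin
  ... | no ne = opp≢ (opposite D) (trans (cong opposite (sym (g-off y yj))) (trans (sym (lin y))
        (g-off (flipAt y j') (trans (lookup-flip′ y (ne ∘ sym)) yj))))
    where
    open ThresholdEdge (threshold-edge e le le' nl)
    y = replicate m Sign.+ [ j ]≔ opposite κ
    yj = lookup∘update j (replicate m Sign.+) (opposite κ)

  -- With the entries of both columns at their off values, `g i` is forced to both opposites at
  -- once.
  D-unique : ∀ {i j j'} → ¬ LinearAt (g i) j → (t : ThresholdEdge i j) (t' : ThresholdEdge i j') →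
             ThresholdEdge.D t ≡ ThresholdEdge.D t'
  D-unique {i} {j} {j'} nl t t' with j' FinP.≟ j
  -- On a single column the two edges might carry different κ's, so the comparison is made at an
  -- insensitive point.
  ... | yes refl = let a , ins = ¬LinearAt⇒ (g i) j nl in SignP.opposite-injective
        (trans (sym (off-insensitive (g i) t.g-off a ins)) (off-insensitive (g i) t'.g-off a ins))
    where
    module t = ThresholdEdge t
    module t' = ThresholdEdge t'
  ... | no ne = SignP.opposite-injective (trans (sym (t.g-off y (trans (lookup∘update′ (ne ∘ sym) y₀ _) (lookup∘update j 1s _))))
        (t'.g-off y (lookup∘update j' y₀ _)))
    where
    module t = ThresholdEdge t
    module t' = ThresholdEdge t'
    1s = replicate m Sign.+
    y₀ = 1s [ j ]≔ opposite t.κ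
    y = y₀ [ j' ]≔ opposite t'.κ

  swapEdge : ∀ {i j} → ThresholdEdge i j → Types.ThresholdEdge (swap S) j i
  swapEdge t = record { κ = κ ; D = B ; B = D ; g-off = f-off ; f-off = g-off }
    where open ThresholdEdge t

  Nonlinear : Fin n → Fin m → Set
  Nonlinear i j = E i j × 2 ≤ deg (g i) × 2 ≤ deg (f j) × ¬ LinearAt (g i) j

module BlockKind {n m : ℕ} {F : BF n} {f : Fin m → BF n} {G : BF m} {g : Fin n → BF m} (S : Sys F f G g)
                 {row : Fin n → Bool} {col : Fin m → Bool} (bl : IsBlock S row col)
                 (no-leaf-edge : ∀ {i j} → Edge F f G g i j → T (row i) → deg (g i) ≡ 1 → deg (f j) ≢ 1) where

  open Sys S
  open Moves S
  open Edges S
  open Degrees S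
  open Types S
  open Propagation S
  open IsBlock bl

  linear-data : (∀ {i j} → E i j → T (row i) → 2 ≤ deg (g i) → 2 ≤ deg (f j) → LinearAt (g i) j) → LinearData bl
  linear-data lin = record
    { lin-f = λ e t le le' → linear-f e le (lin e t le le')
    ; lin-g = lin
    ; no-leaf-edge = no-leaf-edge }

  nonlinear-column : ∀ {i i' j} → Nonlinear i j → E i' j → 2 ≤ deg (g i') → ¬ LinearAt (g i') j
  nonlinear-column (e , le , le' , nl) e' le″ = Types.nonlinear-f (swap S) (flipEdge e') le″
    (Propagation.nonlinear-row (swap S) (flipEdge e) le' le (nonlinear-f e le' nl))

  -- A leaf lies on no `Nonlinear` edge, but it can share a column with one; this weaker property
  -- survives every step through the component.
  Touched : Fin n → Set
  Touched a = ∃ λ j → E a j × ∃ λ i → Nonlinear i j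

  touched-closed : ∀ a b l → E a l → E b l → Touched a → Touched b
  touched-closed a b l ea eb (j , e , i , nl) with b FinP.≟ a
  ... | yes refl = j , e , i , nl
  ... | no b≢a with deg-cases a (Edge.row-dep ea)
  ...   | inj₁ eq = j , subst (E b) (leaf-unique e ea eq) eb , i , nl
  ...   | inj₂ le = l , eb , a , ea , le , two-rows⇒2≤ ea eb b≢a ,
                    nonlinear-row e le (proj₁ (proj₂ (proj₂ nl))) (nonlinear-column nl e le)

  module _ {i₀ j₀} (t₀ : T (row i₀)) (nl₀ : Nonlinear i₀ j₀) where

    touched : ∀ i → T (row i) → Touched i
    touched i t = connected Touched touched-closed i₀ i t₀ t (j₀ , proj₁ nl₀ , i₀ , nl₀)

    all-nonlinear : ∀ {i j} → E i j → T (row i) → 2 ≤ deg (g i) → ¬ LinearAt (g i) j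
    all-nonlinear {i} e t le = let j' , e' , i' , nl = touched i t in
      nonlinear-row e' le (proj₁ (proj₂ (proj₂ nl))) (nonlinear-column nl e' le)

    col-of : ∀ i → T (row i) → 2 ≤ deg (g i) → ∃ λ j → E i j × 2 ≤ deg (f j)
    col-of i t le = let j , e , i' , nl = touched i t in j , e , proj₁ (proj₂ (proj₂ nl))

    row-of : ∀ j → T (col j) → 2 ≤ deg (f j) → ∃ λ i → E i j × 2 ≤ deg (g i)
    row-of j t le with dependsOnSome (f j) (nonconst-f j (col-dep j t))
    ... | i , d with edge-f (col-dep j t) d
    ...   | e with deg-cases i (Edge.row-dep e) | touched i (col→row e t)
    ...     | inj₂ le' | _ = i , e , le'
    ...     | inj₁ eq | j' , e' , i' , e″ , le″ , _ = i' , subst (E i') (leaf-unique e e' eq) e″ , le″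

    Thick : Fin n → Fin m → Set
    Thick i j = E i j × T (row i) × 2 ≤ deg (g i) × 2 ≤ deg (f j)

    thick-threshold : ∀ {i j} → Thick i j → ThresholdEdge i j
    thick-threshold (e , t , le , le') = threshold-edge e le le' (all-nonlinear e t le)

    module _ (thick? : ∀ i j → Dec (Thick i j)) where

      private
        -- Nothing constrains κ, `D` and `B` away from the edges between vertices of degree at least
        -- 2; + is a default there.
        κ′ : ∀ {i j} → Dec (Thick i j) → Sign
        κ′ (yes p) = ThresholdEdge.κ (thick-threshold p)
        κ′ (no _) = Sign.+
        D′ : ∀ {i} → Dec (∃ (Thick i)) → Sign
        D′ (yes (_ , p)) = ThresholdEdge.D (thick-threshold p)
        D′ (no _) = Sign.+
        B′ : ∀ {j} → Dec (∃ λ i → Thick i j) → Sign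
        B′ (yes (_ , p)) = ThresholdEdge.B (thick-threshold p)
        B′ (no _) = Sign.+

        g-off′ : ∀ {i j} (d : Dec (Thick i j)) (d' : Dec (∃ (Thick i))) → Thick i j →
                 ∀ y → lookup y j ≡ opposite (κ′ d) → g i y ≡ opposite (D′ d')
        g-off′ (no np) d' p y h = ⊥-elim (np p)
        g-off′ (yes _) (no np) p y h = ⊥-elim (np (_ , p))
        g-off′ (yes p@(e , t , le , le')) (yes (_ , q)) _ y h =
          trans (ThresholdEdge.g-off (thick-threshold p) y h)
            (cong opposite (D-unique (all-nonlinear e t le) (thick-threshold p) (thick-threshold q)))
        f-off′ : ∀ {i j} (d : Dec (Thick i j)) (d' : Dec (∃ λ i → Thick i j)) → Thick i j →
                 ∀ x → lookup x i ≡ opposite (κ′ d) → f j x ≡ opposite (B′ d')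
        f-off′ (no np) d' p y h = ⊥-elim (np p)
        f-off′ (yes _) (no np) p y h = ⊥-elim (np (_ , p))
        f-off′ (yes p@(e , t , le , le')) (yes (_ , q)) _ y h =
          trans (ThresholdEdge.f-off (thick-threshold p) y h)
            (cong opposite (Propagation.D-unique (swap S) (nonlinear-f e le' (all-nonlinear e t le))
              (swapEdge (thick-threshold p)) (swapEdge (thick-threshold q))))

      threshold-data : ThresholdData bl
      threshold-data = record
        { κ = λ i j → κ′ (thick? i j)
        ; D = λ i → D′ (FinP.any? (thick? i))
        ; B = λ j → B′ (FinP.any? (λ i → thick? i j))
        ; g-off = λ {i} {j} e t le le' → g-off′ (thick? i j) (FinP.any? (thick? i)) (e , t , le , le')
        ; f-off = λ {i} {j} e t le le' → f-off′ (thick? i j) (FinP.any? (λ i → thick? i j)) (e , t , le , le')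
        ; nonlinear-g = λ e t le le' → all-nonlinear e t le
        ; nonlinear-f = λ e t le le' → nonlinear-f e le' (all-nonlinear e t le)
        ; row-of = row-of ; col-of = col-of ; no-leaf-edge = no-leaf-edge }

-- The block decomposition

pinned : (Fin n → BF m) → Pt n → Pt n
pinned {m = m} g x = tabulate λ i → if does (const? (g i)) then g i (replicate m Sign.+) else lookup x i

-- Only inputs with constant `g i` are overwritten, and by the value that `g' i` takes anyway.
-- Allowing `g'` different from `g` serves `unconstrained`.
pinned-apply : (g g' : Fin n → BF m) → (∀ i → IsConst (g i) → ∀ y → g' i y ≡ g i y) →
               ∀ z → pinned g (apply g' z) ≡ apply g' z
pinned-apply {m = m} g g' h z = tabulate-cong lem
  where
  lem : ∀ i → (if does (const? (g i)) then g i (replicate m Sign.+) else lookup (apply g' z) i) ≡ g' i (z i)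
  lem i with const? (g i)
  ... | yes c = sym (trans (h i c (z i)) (c (z i)))
  ... | no _ = lookup-apply g' z i

pinned-dep : (f0 : BF n) (g : Fin n → BF m) → ∀ i → Dep (f0 ∘ pinned g) i → NonConst (g i)
pinned-dep {m = m} f0 g i (x , ne) c = ne (cong f0 (tabulate-cong lem))
  where
  lem : ∀ k → (if does (const? (g k)) then g k (replicate m Sign.+) else lookup x k) ≡
              (if does (const? (g k)) then g k (replicate m Sign.+) else lookup (flipAt x i) k)
  lem k with const? (g k)
  ... | yes _ = refl
  ... | no nc = sym (lookup-flip′ x λ { refl → nc c })

identity-matrix : (f0 : BF n) (f : Fin m → BF n) (g0 : BF m) (g : Fin n → BF m) → Identity f0 f g0 g →
                  ∀ z → f0 (apply g z) ≡ g0 (apply f (column z))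
identity-matrix f0 f g0 g idn z =
  trans (cong f0 (tabulate-cong λ i → cong (g i) (sym (tabulate∘lookup (z i))))) (idn λ i j → lookup (z i) j)

module Decomposition {n m : ℕ} (f0 : BF n) (f : Fin m → BF n) (g0 : BF m) (g : Fin n → BF m)
                     (idn : Identity f0 f g0 g) where

  open System f0 f g0 g

  S : Sys F0 f G0 g
  S = record
    { identity = λ z → trans (cong f0 (pinned-apply g g (λ _ _ _ → refl) z)) (trans (identity-matrix f0 f g0 g idn z)
        (sym (cong g0 (pinned-apply f f (λ _ _ _ → refl) (column z)))))
    ; nonconst-g = pinned-dep f0 g
    ; nonconst-f = pinned-dep g0 f }

  open Sys S
  open Moves S
  open Edges S
  open Degrees S
  open Types S
  open Propagation S

  -- Constant inputs are unchanged, so `f0` and `g0` act as `F0` and `G0`, which read only functions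
  -- that are kept.
  unconstrained : ∀ (f' : Fin m → BF n) (g' : Fin n → BF m) →
    (∀ j → ¬ (J j × ¬ Jtil j) → ∀ x → f' j x ≡ f j x) →
    (∀ i → ¬ (I i × ¬ Itil i) → ∀ y → g' i y ≡ g i y) → Identity f0 f' g0 g'
  unconstrained f' g' hf hg z = trans (cong f0 (sym (pinned-apply g g' (λ i c → hg i λ { (nc , _) → nc c }) Z)))
    (trans (agree-on-Dep F0 {apply g' Z} {apply g Z} λ i d → trans (lookup-apply g' Z i) (trans (hg i (λ { (_ , nd) → nd d }) (Z i)) (sym (lookup-apply g Z i))))
      (trans (identity Z)
        (trans (agree-on-Dep G0 {apply f (column Z)} {apply f' (column Z)} λ j d → trans (lookup-apply f (column Z) j)
            (trans (sym (hf j (λ { (_ , nd) → nd d }) (column Z j))) (sym (lookup-apply f' (column Z) j))))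
          (trans (cong g0 (pinned-apply f f' (λ j c → hf j λ { (nc , _) → nc c }) (column Z)))
            (cong g0 (tabulate-cong λ j → cong (f' j) (tabulate-cong λ i → lookup∘tabulate (z i) j)))))))
    where
    Z : Matrix n m
    Z i = tabulate (z i)

  edge? : ∀ i j → Dec (E i j)
  edge? i j with dep? F0 i | dep? (g i) j
  ... | yes d | yes d' = yes (edge-g d d')
  ... | no nd | _ = no λ e → nd (Edge.row-dep e)
  ... | yes _ | no nd = no λ e → nd (Edge.g-dep e)

  -- Only rows are classified; a column takes the class of any row meeting it, and all such rows are
  -- linked.
  Linked : Fin n → Fin n → Set
  Linked a b = ∃ λ j → E a j × E b j

  -- A row that `F0` ignores lies on no edge. Numbering only the classes with a relevant row keeps
  -- the blocks non-empty.
  Used : Components Linked → Fin n → Set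
  Used C r = ∃ λ i → Dep F0 i × Components.class C i ≡ r

  used? : ∀ C r → Dec (Used C r)
  used? C r = FinP.any? λ i → dep? F0 i ×-dec (Components.class C i FinP.≟ r)

  abstract
    linked : Components Linked
    linked = components (λ a b → FinP.any? λ j → edge? a j ×-dec edge? b j) λ { (j , e , e') → j , e' , e }

    used : Enumeration (Used linked)
    used = enumerate (used? linked)

module Blocks {n m : ℕ} (f0 : BF n) (f : Fin m → BF n) (g0 : BF m) (g : Fin n → BF m) (idn : Identity f0 f g0 g)
              (C : Components (Decomposition.Linked f0 f g0 g idn))
              (N : Enumeration (Decomposition.Used f0 f g0 g idn C)) where

  open System f0 f g0 g
  open Decomposition f0 f g0 g idn
  open Sys S
  open Moves S
  open Edges S
  open Degrees S
  open Components C
  open Enumeration N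

  Z : Fin size → Fin n → Fin m → Bool
  Z ℓ i j = does (edge? i j) ∧ does (class i FinP.≟ elem ℓ)

  Z⁺ : ∀ ℓ {i j} → E i j → class i ≡ elem ℓ → T (Z ℓ i j)
  Z⁺ ℓ {i} {j} e c = T-∧⁺ (does⁺ (edge? i j) e) (does⁺ (class i FinP.≟ elem ℓ) c)

  Z⁻ : ∀ ℓ {i j} → T (Z ℓ i j) → E i j × class i ≡ elem ℓ
  Z⁻ ℓ {i} {j} t = let a , b = T-∧⁻ {does (edge? i j)} t in does⁻ (edge? i j) a , does⁻ (class i FinP.≟ elem ℓ) b

  rows : Fin size → Fin n → Bool
  rows ℓ = Block.rowsᵇ (Z ℓ)

  cols : Fin size → Fin m → Bool
  cols ℓ = Block.colsᵇ (Z ℓ)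

  rows⁺ : ∀ ℓ {i} → Dep F0 i → class i ≡ elem ℓ → T (rows ℓ i)
  rows⁺ ℓ {i} d c = let j , dj = dependsOnSome (g i) (nonconst-g i d) in
    anyᵇ⁺ (Z ℓ i) j (Z⁺ ℓ (edge-g d dj) c)

  rows⁻ : ∀ ℓ {i} → T (rows ℓ i) → Dep F0 i × class i ≡ elem ℓ
  rows⁻ ℓ {i} t = let j , tj = anyᵇ⁻ (Z ℓ i) t
                      e , c = Z⁻ ℓ tj in Edge.row-dep e , c

  cols⁺ : ∀ ℓ {i j} → E i j → class i ≡ elem ℓ → T (cols ℓ j)
  cols⁺ ℓ {i} {j} e c = anyᵇ⁺ (λ i → Z ℓ i j) i (Z⁺ ℓ e c)

  cols⁻ : ∀ ℓ {j} → T (cols ℓ j) → ∃ λ i → E i j × class i ≡ elem ℓ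
  cols⁻ ℓ {j} t = let i , ti = anyᵇ⁻ (λ i → Z ℓ i j) t in i , Z⁻ ℓ ti

  isBlock : ∀ ℓ → IsBlock S (rows ℓ) (cols ℓ)
  isBlock ℓ = record
    { row-dep = λ i t → proj₁ (rows⁻ ℓ t)
    ; col-dep = λ j t → Edge.col-dep (proj₁ (proj₂ (cols⁻ ℓ t)))
    ; row→col = λ e t → cols⁺ ℓ e (proj₂ (rows⁻ ℓ t))
    ; col→row = λ {i} {j} e t → let i' , e' , c = cols⁻ ℓ t in rows⁺ ℓ (Edge.row-dep e) (trans (complete (j , e , e')) c)
    ; connected = λ P cl i k ti tk → sound P (λ a b (j , ea , eb) → cl a b j ea eb) i k
        (trans (proj₂ (rows⁻ ℓ ti)) (sym (proj₂ (rows⁻ ℓ tk)))) }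

  -- `f₀-invariant` makes `F0` a function of the block values, and `match` lets the same function
  -- serve `G0`.
  record BlockForm (ℓ : Fin size) : Set where
    field
      f₀ : BF n
      g₀ : BF m
      f₀-dep : ∀ i → Dep f₀ i → T (rows ℓ i)
      g₀-dep : ∀ j → Dep g₀ j → T (cols ℓ j)
      f₀-invariant : ∀ x x' → (∀ i → Dep F0 i → ¬ T (rows ℓ i) → lookup x i ≡ lookup x' i) → f₀ x ≡ f₀ x' → F0 x ≡ F0 x'
      match : ∀ z → f₀ (apply g z) ≡ g₀ (apply f (column z))
      cases : Block.Cases (Z ℓ) f₀ g₀

  module _ (ℓ : Fin size) where

    open IsBlock (isBlock ℓ)

    case1 : ∀ {i j} → E i j → T (rows ℓ i) → deg (g i) ≡ 1 → deg (f j) ≡ 1 → BlockForm ℓ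
    case1 {i} {j} e t eq eq' = record
      { f₀ = λ x → s · lookup x i ; g₀ = λ y → u · lookup y j
      ; f₀-dep = λ k d → subst (T ∘ rows ℓ) (sym (dictator-Dep {s = s} {i} (λ _ → refl) k d)) t
      ; g₀-dep = λ k d → subst (T ∘ cols ℓ) (sym (dictator-Dep {s = u} {j} (λ _ → refl) k d)) (row→col e t)
      ; f₀-invariant = λ x x' out h → agree-on-Dep F0 {x} {x'} (same x x' out h)
      ; match = λ z → trans (cong (s ·_) (trans (lookup-apply g z i) (g-form (z i))))
          (trans (x∙yz≈y∙xz s u (lookup (z i) j)) (sym (cong (u ·_)
            (trans (lookup-apply f (column z) j) (trans (f-form (column z j)) (cong (s ·_) (lookup-column z j i)))))))
      ; cases = inj₁ (i , j , (λ i' j' → single i' j' , λ { (refl , refl) → Z⁺ ℓ e (proj₂ (rows⁻ ℓ t)) })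
          , s , u , f-form , g-form , (λ _ → refl) , λ _ → refl) }
      where
      s = sgnD (f j)
      u = sgnD (g i)
      f-form = Degrees.leaf-form (swap S) (flipEdge e) eq'
      g-form = leaf-form e eq
      -- A row linked to the leaf `i` meets its only column `j`, and the leaf `f j` meets no row but
      -- `i`.
      only-row : ∀ k → T (rows ℓ k) → k ≡ i
      only-row k tk = connected (_≡ i) (λ { a b l ea eb refl → Degrees.leaf-unique (swap S) (flipEdge e)
        (flipEdge (subst (E b) (leaf-unique e ea eq) eb)) eq' }) i k t tk refl
      single : ∀ i' j' → T (Z ℓ i' j') → i' ≡ i × j' ≡ j
      single i' j' h = let e' , c = Z⁻ ℓ h
                           i'≡i = only-row i' (rows⁺ ℓ (Edge.row-dep e') c)
                       in i'≡i , leaf-unique e (subst (λ k → E k j') i'≡i e') eq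
      same : ∀ x x' → (∀ k → Dep F0 k → ¬ T (rows ℓ k) → lookup x k ≡ lookup x' k) → s · lookup x i ≡ s · lookup x' i →
             ∀ k → Dep F0 k → lookup x k ≡ lookup x' k
      same x x' out h k d with T? (rows ℓ k)
      ... | no nt = out k d nt
      ... | yes tk = subst (λ k → lookup x k ≡ lookup x' k) (sym (only-row k tk)) (SignP.*-cancelˡ-≡ s (lookup x i) (lookup x' i) h)

    case2 : LinearData (isBlock ℓ) → BlockForm ℓ
    case2 dat = record
      { f₀ = L.f₀ ; g₀ = ᵀL.f₀ ; f₀-dep = L.f₀-dep ; g₀-dep = ᵀL.f₀-dep
      ; f₀-invariant = L.f₀-invariant ; match = match
      ; cases = inj₂ (inj₁ (LF.φ , ᵀF.φ
          , (λ j t → BlockBasics.Ψ-dep S (isBlock ℓ) (λ _ → Sign.+) (col-dep j t) , LF.f-form j t)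
          , (λ i t → BlockBasics.Ψ-dep (swap S) (swapBlock (isBlock ℓ)) (λ _ → Sign.+) (row-dep i t) , ᵀF.f-form i t)
          , (λ _ → refl) , λ _ → refl)) }
      where
      open LinearMatch S (isBlock ℓ) dat
      module LF = LinearForm S (isBlock ℓ) dat
      module ᵀF = LinearForm (swap S) (swapBlock (isBlock ℓ)) (swapLinear dat)

    case3 : ThresholdData (isBlock ℓ) → BlockForm ℓ
    case3 dat = record
      { f₀ = L.f₀ ; g₀ = ᵀL.f₀ ; f₀-dep = L.f₀-dep ; g₀-dep = ᵀL.f₀-dep
      ; f₀-invariant = L.f₀-invariant ; match = ThresholdMatch.match S (isBlock ℓ) dat
      ; cases = inj₂ (inj₂ (
            (λ i t → let a , b = T-∧⁻ {rows ℓ i} t in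
              deg≤1⇒dictator (g i) (nonconst-g i (row-dep i a)) (ℕP.≤-reflexive (ℕP.≡ᵇ⇒≡ (deg (g i)) 1 b)))
          , (λ j t → let a , b = T-∧⁻ {cols ℓ j} t in
              deg≤1⇒dictator (f j) (nonconst-f j (col-dep j a)) (ℕP.≤-reflexive (ℕP.≡ᵇ⇒≡ (deg (f j)) 1 b)))
          , B , D , κ , LF.φ~ , ᵀF.φ~
          , (λ j t → let tj , le = ᵀB.row2⁻ t in LF.φ~-dep (col-dep j tj) , λ x →
              trans (cong toℚ (LF.f-form tj le x)) (threshold-ℚ (B.depF2 j) (λ i → κ i j) (B j) (LF.φ~ j x) x))
          , (λ i t → let ti , le = B.row2⁻ t in ᵀF.φ~-dep (row-dep i ti) , λ y →
              trans (cong toℚ (ᵀF.f-form ti le y)) (threshold-ℚ (ᵀB.depF2 i) (κ i) (D i) (ᵀF.φ~ i y) y))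
          , (λ x → on-ℚ B.row2 D ᵀB.row2 (λ j → LF.φ~ j (B.xsgn x)) x)
          , λ y → on-ℚ ᵀB.row2 B B.row2 (λ i → ᵀF.φ~ i (ᵀB.xsgn y)) y)) }
      where
      open ThresholdData dat
      open ThresholdHalf S (isBlock ℓ) dat
      module B = BlockBasics S (isBlock ℓ)
      module ᵀB = BlockBasics (swap S) (swapBlock (isBlock ℓ))
      module LF = ThresholdForm S (isBlock ℓ) dat
      module ᵀF = ThresholdForm (swap S) (swapBlock (isBlock ℓ)) (swapThreshold dat)

    abstract
      blockForm : BlockForm ℓ
      blockForm with FinP.any? (λ i → FinP.any? (λ j → edge? i j ×-dec T? (rows ℓ i) ×-dec (deg (g i) ℕP.≟ 1) ×-dec (deg (f j) ℕP.≟ 1)))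
      ... | yes (i , j , e , t , eq , eq') = case1 e t eq eq'
      ... | no no-leaf with FinP.any? (λ i → FinP.any? (λ j → T? (rows ℓ i) ×-dec edge? i j ×-dec (2 ℕP.≤? deg (g i)) ×-dec (2 ℕP.≤? deg (f j)) ×-dec ¬? (linearAt? (g i) j)))
      ...   | yes (i , j , t , nl) = case3 (K.threshold-data t nl λ i j →
                edge? i j ×-dec T? (rows ℓ i) ×-dec (2 ℕP.≤? deg (g i)) ×-dec (2 ℕP.≤? deg (f j)))
        where module K = BlockKind S (isBlock ℓ) (λ {i} {j} e t eq eq' → no-leaf (i , j , e , t , eq , eq'))
      ...   | no linear = case2 (K.linear-data λ {i} {j} e t le le' →
                decidable-stable (linearAt? (g i) j) λ nl → linear (i , j , t , e , le , le' , nl))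
        where module K = BlockKind S (isBlock ℓ) (λ {i} {j} e t eq eq' → no-leaf (i , j , e , t , eq , eq'))

-- The outer function `h`

module Assembly {n m : ℕ} (f0 : BF n) (f : Fin m → BF n) (g0 : BF m) (g : Fin n → BF m) (idn : Identity f0 f g0 g)
                (C : Components (Decomposition.Linked f0 f g0 g idn))
                (N : Enumeration (Decomposition.Used f0 f g0 g idn C))
                (forms : ∀ ℓ → Blocks.BlockForm f0 f g0 g idn C N ℓ) where

  open System f0 f g0 g
  open Decomposition f0 f g0 g idn
  open Blocks f0 f g0 g idn C N
  open Components C
  open Enumeration N
  module B ℓ = BlockForm (forms ℓ)

  values : Pt n → Pt size
  values x = tabulate λ ℓ → B.f₀ ℓ x

  module _ (x x' : Pt n) (same : ∀ ℓ → B.f₀ ℓ x ≡ B.f₀ ℓ x') where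

    private
      -- Leads from `x` to `x'` one class at a time: the classes with label below `t` have already
      -- been switched. Labels lie in `Fin n`, so `n` steps suffice.
      mix : ℕ → Pt n
      mix t = tabulate λ i → if does (toℕ (class i) ℕP.<? t) then lookup x' i else lookup x i

      mix-new : ∀ t i → toℕ (class i) < t → lookup (mix t) i ≡ lookup x' i
      mix-new t i lt = trans (lookup∘tabulate _ i) (lem (toℕ (class i) ℕP.<? t))
        where
        lem : (d : Dec (toℕ (class i) < t)) → (if does d then lookup x' i else lookup x i) ≡ lookup x' i
        lem (yes _) = refl
        lem (no nlt) = ⊥-elim (nlt lt)

      mix-old : ∀ t i → ¬ toℕ (class i) < t → lookup (mix t) i ≡ lookup x i
      mix-old t i nlt = trans (lookup∘tabulate _ i) (lem (toℕ (class i) ℕP.<? t))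
        where
        lem : (d : Dec (toℕ (class i) < t)) → (if does d then lookup x' i else lookup x i) ≡ lookup x i
        lem (yes lt) = ⊥-elim (nlt lt)
        lem (no _) = refl

      mix-step : ∀ t i → toℕ (class i) ≢ t → lookup (mix t) i ≡ lookup (mix (suc t)) i
      mix-step t i ne with toℕ (class i) ℕP.<? t
      ... | yes lt = trans (mix-new t i lt) (sym (mix-new (suc t) i (ℕP.m<n⇒m<1+n lt)))
      ... | no nlt = trans (mix-old t i nlt) (sym (mix-old (suc t) i λ lt → nlt (ℕP.≤∧≢⇒< (ℕP.≤-pred lt) ne)))

      step : ∀ t → t < n → F0 (mix t) ≡ F0 (mix (suc t))
      step t t<n with used? C (fromℕ< t<n)
      -- No relevant row carries the label `t`, so `F0` does not notice this step.
      ... | no unused = agree-on-Dep F0 {mix t} {mix (suc t)} λ i d → mix-step t i λ eq →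
              unused (i , d , FinP.toℕ-injective (trans eq (sym (FinP.toℕ-fromℕ< t<n))))
      ... | yes u with elem-onto (fromℕ< t<n) u
      ...   | ℓ , eℓ = B.f₀-invariant ℓ (mix t) (mix (suc t))
                (λ i d nt → mix-step t i λ eq → nt (rows⁺ ℓ d (FinP.toℕ-injective (trans eq (sym lab)))))
                (trans (agree-on-Dep (B.f₀ ℓ) {mix t} {x} λ i d → mix-old t i λ lt → ℕP.<-irrefl (at i d) lt)
                  (trans (same ℓ) (sym (agree-on-Dep (B.f₀ ℓ) {mix (suc t)} {x'} λ i d →
                    mix-new (suc t) i (s≤s (ℕP.≤-reflexive (at i d)))))))
        where
        lab : toℕ (elem ℓ) ≡ t
        lab = trans (cong toℕ eℓ) (FinP.toℕ-fromℕ< t<n)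
        at : ∀ i → Dep (B.f₀ ℓ) i → toℕ (class i) ≡ t
        at i d = trans (cong toℕ (proj₂ (rows⁻ ℓ (B.f₀-dep ℓ i d)))) lab

      walk : ∀ t → t ≤ n → F0 (mix 0) ≡ F0 (mix t)
      walk zero _ = refl
      walk (suc t) le = trans (walk t (ℕP.<⇒≤ le)) (step t le)

    F0-determined : F0 x ≡ F0 x'
    F0-determined = trans (agree-on-Dep F0 {x} {mix 0} λ i _ → sym (mix-old 0 i λ ()))
      (trans (walk n ℕP.≤-refl) (agree-on-Dep F0 {mix n} {x'} λ i _ → mix-new n i (FinP.toℕ<n (class i))))

  -- Read off any preimage, which `F0-determined` makes independent of the choice; outside the image
  -- of `values` the + is arbitrary.
  h : BF size
  h w with anyPt? n (λ x → ≡-dec SignP._≟_ (values x) w)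
  ... | yes (x , _) = F0 x
  ... | no _ = Sign.+

  F0-h : ∀ x → F0 x ≡ h (values x)
  F0-h x with anyPt? n (λ x' → ≡-dec SignP._≟_ (values x') (values x))
  ... | yes (x' , eq) = F0-determined x x' λ ℓ → trans (sym (lookup∘tabulate _ ℓ))
          (trans (cong (λ v → lookup v ℓ) (sym eq)) (lookup∘tabulate _ ℓ))
  ... | no none = ⊥-elim (none (x , refl))

  -- A matrix whose column values agree with `y` where `G0` reads them turns `G0 y` into `F0` at its
  -- row values; `match` then rewrites each block value as `B.g₀ ℓ y`.
  G0-h : ∀ y → G0 y ≡ h (tabulate λ ℓ → B.g₀ ℓ y)
  G0-h y = trans (agree-on-Dep G0 {y} {apply f c} λ j d → sym (trans (lookup-apply f c j) (Moves.preimage-value (swap S) j (lookup y j) d)))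
    (trans (Sys.identity (swap S) c)
      (trans (F0-h (apply g (column c))) (cong h (tabulate-cong λ ℓ → trans (B.match ℓ (column c))
        (agree-on-Dep (B.g₀ ℓ) {apply f (column (column c))} {y} λ j d → trans (lookup-apply f (column (column c)) j)
          (trans (cong (f j) (column-column c j)) (Moves.preimage-value (swap S) j (lookup y j)
            (IsBlock.col-dep (isBlock ℓ) j (B.g₀-dep ℓ j d)))))))))
    where
    c : Matrix m n
    c = Moves.base (swap S) y


theorem4p33 : ∀ (n m : ℕ) (f0 : BF n) (f : Fin m → BF n) (g0 : BF m) (g : Fin n → BF m) →
    Identity f0 f g0 g →
    let open System f0 f g0 g in
    (∀ j → Jtil j → ∀ i → Dep (f j) i → Itil i) ×
    (∀ i → Itil i → ∀ j → Dep (g i) j → Jtil j) ×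
    Σ ℕ (λ k → Σ (Fin k → Fin n → Fin m → Bool) λ Z →
    Σ (BF k) λ h → Σ (Fin k → BF n) λ f0ℓ → Σ (Fin k → BF m) λ g0ℓ →
    (∀ ℓ i j → T (Z ℓ i j) → Itil i × Jtil j) ×
    (∀ ℓ → ∃₂ λ i j → T (Z ℓ i j)) ×
    (∀ ℓ ℓ' i j j' → T (Z ℓ i j) → T (Z ℓ' i j') → ℓ ≡ ℓ') ×
    (∀ ℓ ℓ' i i' j → T (Z ℓ i j) → T (Z ℓ' i' j) → ℓ ≡ ℓ') ×
    (∀ ℓ i j → T (Z ℓ i j) →
    (∀ j' → Dep (g i) j' → T (Block.colsᵇ (Z ℓ) j')) ×
    (∀ i' → Dep (f j) i' → T (Block.rowsᵇ (Z ℓ) i'))) ×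
    (∀ ℓ i j → T (Block.rowsᵇ (Z ℓ) i) → T (Block.colsᵇ (Z ℓ) j) →
    (Dep (g i) j → Dep (f j) i) × (Dep (f j) i → Dep (g i) j)) ×
    (∀ ℓ i → Dep (f0ℓ ℓ) i → T (Block.rowsᵇ (Z ℓ) i)) ×
    (∀ ℓ j → Dep (g0ℓ ℓ) j → T (Block.colsᵇ (Z ℓ) j)) ×
    (∀ x → F0 x ≡ h (tabulate λ ℓ → f0ℓ ℓ x)) ×
    (∀ y → G0 y ≡ h (tabulate λ ℓ → g0ℓ ℓ y)) ×
    (∀ ℓ → Block.Cases (Z ℓ) (f0ℓ ℓ) (g0ℓ ℓ))) ×
    (∀ (f' : Fin m → BF n) (g' : Fin n → BF m) →
    (∀ j → ¬ (J j × ¬ Jtil j) → ∀ x → f' j x ≡ f j x) →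
    (∀ i → ¬ (I i × ¬ Itil i) → ∀ y → g' i y ≡ g i y) →
    Identity f0 f' g0 g')
theorem4p33 n m f0 f g0 g idn =
    (λ j dj i di → Edge.row-dep (edge-f dj di))
  , (λ i di j dj → Edge.col-dep (edge-g di dj))
  , (size , Z , h , B.f₀ , B.g₀
    , (λ ℓ i j t → let e , _ = Z⁻ ℓ t in Edge.row-dep e , Edge.col-dep e)
    , (λ ℓ → let i , d , c = elem-∈ ℓ
                 j , dj = dependsOnSome (g i) (nonconst-g i d)
             in i , j , Z⁺ ℓ (edge-g d dj) c)
    , (λ ℓ ℓ' i j j' t t' → elem-injective ℓ ℓ' (trans (sym (proj₂ (Z⁻ ℓ t))) (proj₂ (Z⁻ ℓ' t'))))
    , (λ ℓ ℓ' i i' j t t' → let e , c = Z⁻ ℓ t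
                                e' , c' = Z⁻ ℓ' t'
                            in elem-injective ℓ ℓ' (trans (sym c) (trans (complete (j , e , e')) c')))
    , (λ ℓ i j t → let e , c = Z⁻ ℓ t in
          (λ j' d → cols⁺ ℓ (edge-g (Edge.row-dep e) d) c)
        , (λ i' d → let e' = edge-f (Edge.col-dep e) d in rows⁺ ℓ (Edge.row-dep e') (trans (complete (j , e' , e)) c)))
    , (λ ℓ i j ti tj → (λ d → Edge.f-dep (edge-g (IsBlock.row-dep (isBlock ℓ) i ti) d))
                     , (λ d → Edge.g-dep (edge-f (IsBlock.col-dep (isBlock ℓ) j tj) d)))
    , B.f₀-dep , B.g₀-dep , F0-h , G0-h , B.cases)
  , unconstrained
  where
  open Decomposition f0 f g0 g idn
  open Sys S
  open Moves S
  open Edges S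
  open Blocks f0 f g0 g idn linked used
  open Assembly f0 f g0 g idn linked used blockForm
  open Components linked
  open Enumeration used
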